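{- Let $A$ be a punctual injection structure which is relatively $\Delta^0_3$-categorical but not relatively $\Delta^0_2$-categorical. Then $\mathrm{PRCatSpec}(A)=\mathrm{Cone}(\Delta^0_3)$.
   Context: A punctual structure is a structure with domain $\omega$ whose operations and relations are uniformly primitive recursive. An injection structure is a structure $(D,f)$ in the language of one unary function symbol, with $f:D\to D$ injective. A computable structure $A$ is relatively $\Delta^0_\alpha$-categorical if for every structure $B\cong A$ with domain $\omega$ (not necessarily computable) there is an isomorphism from $A$ to $B$ which is $\Delta^0_\alpha$ relative to the atomic diagram of $B$. For total functions $f,g:\omega\to\omega$, write $f\leq_{PR} g$ if there is a primitive recursive scheme $\Psi$ (a primitive recursive definition which may additionally use the oracle function as a basic function) with $\Psi^{g}=f$. Write $f\equiv_{PR}g$ if $f\leq_{PR}g$ and $g\leq_{PR}f$. The $\equiv_{PR}$-classes are the PR-degrees, ordered by $\leq_{PR}$. For a punctual structure $A$, $\mathrm{PRCatSpec}(A)$ is the set of all PR-degrees $\mathbf d$ such that for every punctual structure $B\cong A$ there is an isomorphism $f:A\to B$ with $f\leq_{PR}\mathbf d$ and $f^{ -1}\leq_{PR}\mathbf d$. For a computable ordinal $\alpha>0$, $\mathrm{Cone}(\Delta^0_\alpha)$ is the set of all PR-degrees $\mathbf d$ such that $f\leq_{PR}\mathbf d$ for every total $\Delta^0_\alpha$ function $f:\omega\to\omega$. -}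

module Defs where

open import Data.Bool.Base using (Bool; T; if_then_else_)
open import Data.Fin.Base using (Fin)
open import Data.List.Base using (List; []; _∷_)
open import Data.List.Membership.Propositional using (_∈_)
open import Data.List.Relation.Unary.All as All using (All; []; _∷_)
open import Data.List.Relation.Unary.Any using (here)
open import Data.Nat.Base using (ℕ; zero; suc; _+_; _<_; _≡ᵇ_)
open import Data.Nat.GeneralisedArithmetic using (fold)
open import Data.Product.Base using (Σ-syntax; ∃-syntax; _×_; _,_)
open import Data.Vec.Base using (Vec; []; _∷_; head; lookup)
open import Function.Base using (_∘_)
open import Function.Bundles using (_↔_; _⇔_; Inverse)
open import Function.Definitions using (Injective)
open import Level using (0ℓ)
open import Relation.Binary.Bundles using (Setoid)
open import Relation.Binary.Definitions using (_Respects_)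
open import Relation.Binary.PropositionalEquality
  using (_≡_; refl; trans; cong; cong₂)
open import Relation.Unary using (Pred)

-- An oracle is a finite list of total functions; the index lists their
-- arities.  The empty oracle [] gives the unrelativised notions.

Oracle : List ℕ → Set
Oracle = All (λ a → Vec ℕ a → ℕ)

⟨_⟩ : (ℕ → ℕ) → Oracle (1 ∷ [])
⟨ g ⟩ = (g ∘ head) ∷ []

------------------------------------------------------------------------
-- Primitive recursion

data PR (os : List ℕ) : ℕ → Set where
  zer  : PR os 0
  suc  : PR os 1
  proj : ∀ {n} → Fin n → PR os n
  orac : ∀ {n} → n ∈ os → PR os n
  comp : ∀ {m n} → PR os m → Vec (PR os n) m → PR os n
  prec : ∀ {n} → PR os n → PR os (2 + n) → PR os (suc n)

module _ {os : List ℕ} (X : Oracle os) where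
  mutual
    eval : ∀ {n} → PR os n → Vec ℕ n → ℕ
    eval zer        _            = 0
    eval suc        (x ∷ [])     = suc x
    eval (proj i)   xs           = lookup xs i
    eval (orac i)   xs           = All.lookup X i xs
    eval (comp f gs) xs          = eval f (eval* gs xs)
    eval (prec f g) (zero  ∷ xs) = eval f xs
    eval (prec f g) (suc n ∷ xs) = eval g (n ∷ eval (prec f g) (n ∷ xs) ∷ xs)

    eval* : ∀ {m n} → Vec (PR os n) m → Vec ℕ n → Vec ℕ m
    eval* []       xs = []
    eval* (g ∷ gs) xs = eval g xs ∷ eval* gs xs

PrimitiveRecursive : (ℕ → ℕ) → Set
PrimitiveRecursive f = Σ[ Ψ ∈ PR [] 1 ] (∀ x → eval [] Ψ (x ∷ []) ≡ f x)

infix 4 _≤PR_ _≡PR_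

_≤PR_ : (ℕ → ℕ) → (ℕ → ℕ) → Set
f ≤PR g = Σ[ Ψ ∈ PR (1 ∷ []) 1 ] (∀ x → eval ⟨ g ⟩ Ψ (x ∷ []) ≡ f x)

_≡PR_ : (ℕ → ℕ) → (ℕ → ℕ) → Set
f ≡PR g = f ≤PR g × g ≤PR f

mutual
  substitute : ∀ {os n} → PR os 1 → PR (1 ∷ []) n → PR os n
  substitute Φ zer                = zer
  substitute Φ suc                = suc
  substitute Φ (proj i)           = proj i
  substitute Φ (orac (here refl)) = Φ
  substitute Φ (comp f gs)        = comp (substitute Φ f) (substitute* Φ gs)
  substitute Φ (prec f g)         = prec (substitute Φ f) (substitute Φ g)

  substitute* : ∀ {os m n} → PR os 1 → Vec (PR (1 ∷ []) n) m → Vec (PR os n) m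
  substitute* Φ []       = []
  substitute* Φ (g ∷ gs) = substitute Φ g ∷ substitute* Φ gs

module _ {os} {X : Oracle os} {g : ℕ → ℕ} (Φ : PR os 1)
         (Φ≡g : ∀ x → eval X Φ (x ∷ []) ≡ g x) where
  mutual
    eval-substitute : ∀ {n} (Ψ : PR (1 ∷ []) n) (xs : Vec ℕ n) →
                      eval X (substitute Φ Ψ) xs ≡ eval ⟨ g ⟩ Ψ xs
    eval-substitute zer                _            = refl
    eval-substitute suc                (x ∷ [])     = refl
    eval-substitute (proj i)           xs           = refl
    eval-substitute (orac (here refl)) (x ∷ [])     = Φ≡g x
    eval-substitute (comp f gs)        xs           =
      trans (eval-substitute f _) (cong (eval ⟨ g ⟩ f) (eval-substitute* gs xs))
    eval-substitute (prec f h)         (zero  ∷ xs) = eval-substitute f xs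
    eval-substitute (prec f h)         (suc n ∷ xs) =
      trans (eval-substitute h _)
            (cong (λ r → eval ⟨ g ⟩ h (n ∷ r ∷ xs))
                  (eval-substitute (prec f h) (n ∷ xs)))

    eval-substitute* : ∀ {m n} (Ψs : Vec (PR (1 ∷ []) n) m) (xs : Vec ℕ n) →
                       eval* X (substitute* Φ Ψs) xs ≡ eval* ⟨ g ⟩ Ψs xs
    eval-substitute* []       xs = refl
    eval-substitute* (Ψ ∷ Ψs) xs =
      cong₂ _∷_ (eval-substitute Ψ xs) (eval-substitute* Ψs xs)

≤PR-refl : ∀ f → f ≤PR f
≤PR-refl _ = orac (here refl) , λ _ → refl

≤PR-trans : ∀ f g h → f ≤PR g → g ≤PR h → f ≤PR h
≤PR-trans _ _ _ (Ψ , Ψ≡f) (Φ , Φ≡g) =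
  substitute Φ Ψ , λ x → trans (eval-substitute Φ Φ≡g Ψ (x ∷ [])) (Ψ≡f x)

-- A PR-degree is given by a representative, so a set of PR-degrees is a
-- predicate on functions that respects _≡PR_.

PRDegrees : Setoid 0ℓ 0ℓ
PRDegrees = record
  { Carrier       = ℕ → ℕ
  ; _≈_           = _≡PR_
  ; isEquivalence = record
    { refl  = λ {f} → ≤PR-refl f , ≤PR-refl f
    ; sym   = λ (p , q) → q , p
    ; trans = λ {f} {g} {h} (p , q) (p′ , q′) →
        ≤PR-trans f g h p p′ , ≤PR-trans h g f q′ q
    }
  }

PRDegree : Set
PRDegree = Setoid.Carrier PRDegrees

------------------------------------------------------------------------
-- Partial recursion, relative to an oracle

data Rec (os : List ℕ) : ℕ → Set where
  zer  : Rec os 0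
  suc  : Rec os 1
  proj : ∀ {n} → Fin n → Rec os n
  orac : ∀ {n} → n ∈ os → Rec os n
  comp : ∀ {m n} → Rec os m → Vec (Rec os n) m → Rec os n
  prec : ∀ {n} → Rec os n → Rec os (2 + n) → Rec os (suc n)
  mu   : ∀ {n} → Rec os (suc n) → Rec os n

module _ {os : List ℕ} (X : Oracle os) where
  mutual
    data Converges : ∀ {n} → Rec os n → Vec ℕ n → ℕ → Set where
      zer   : Converges zer [] 0
      suc   : ∀ {x} → Converges suc (x ∷ []) (suc x)
      proj  : ∀ {n} {i : Fin n} {xs} → Converges (proj i) xs (lookup xs i)
      orac  : ∀ {n} {i : n ∈ os} {xs} →
              Converges (orac i) xs (All.lookup X i xs)
      comp  : ∀ {m n} {f : Rec os m} {gs : Vec (Rec os n) m} {xs ys z} →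
              Converges* gs xs ys → Converges f ys z →
              Converges (comp f gs) xs z
      prec₀ : ∀ {n} {f : Rec os n} {g xs z} →
              Converges f xs z → Converges (prec f g) (0 ∷ xs) z
      precₛ : ∀ {n} {f : Rec os n} {g k xs y z} →
              Converges (prec f g) (k ∷ xs) y →
              Converges g (k ∷ y ∷ xs) z →
              Converges (prec f g) (suc k ∷ xs) z
      mu    : ∀ {n} {f : Rec os (suc n)} {xs y} →
              Converges f (y ∷ xs) 0 →
              (∀ z → z < y → ∃[ k ] Converges f (z ∷ xs) (suc k)) →
              Converges (mu f) xs y

    data Converges* : ∀ {m n} → Vec (Rec os n) m → Vec ℕ n → Vec ℕ m → Set where
      []  : ∀ {n} {xs : Vec ℕ n} → Converges* [] xs []
      _∷_ : ∀ {m n} {g : Rec os n} {gs : Vec (Rec os n) m} {xs y ys} →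
            Converges g xs y → Converges* gs xs ys →
            Converges* (g ∷ gs) xs (y ∷ ys)

  ComputableRel : ∀ {k} → (Vec ℕ k → Bool) → Set
  ComputableRel {k} R =
    Σ[ e ∈ Rec os k ] (∀ xs → Converges e xs (if R xs then 1 else 0))

------------------------------------------------------------------------
-- Arithmetical hierarchy, relative to an oracle

-- ∃-prefix n R xs is ∃y₁ ∀y₂ ∃y₃ … Qyₙ. R(y₁,…,yₙ,xs), and ∀-prefix n R xs
-- is ∀y₁ ∃y₂ ∀y₃ … Qyₙ. R(y₁,…,yₙ,xs).

mutual
  ∃-prefix : ∀ n {k} → (Vec ℕ (n + k) → Bool) → Vec ℕ k → Set
  ∃-prefix zero    R xs = T (R xs)
  ∃-prefix (suc n) R xs = ∃[ y ] ∀-prefix n (λ ys → R (y ∷ ys)) xs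

  ∀-prefix : ∀ n {k} → (Vec ℕ (n + k) → Bool) → Vec ℕ k → Set
  ∀-prefix zero    R xs = T (R xs)
  ∀-prefix (suc n) R xs = ∀ y → ∃-prefix n (λ ys → R (y ∷ ys)) xs

module _ {os : List ℕ} (n : ℕ) (X : Oracle os) where

  Σ⁰ : ∀ {k} → Pred (Vec ℕ k) 0ℓ → Set
  Σ⁰ {k} P = Σ[ R ∈ (Vec ℕ (n + k) → Bool) ]
    ComputableRel X R × (∀ xs → P xs ⇔ ∃-prefix n R xs)

  Π⁰ : ∀ {k} → Pred (Vec ℕ k) 0ℓ → Set
  Π⁰ {k} P = Σ[ R ∈ (Vec ℕ (n + k) → Bool) ]
    ComputableRel X R × (∀ xs → P xs ⇔ ∀-prefix n R xs)

  Δ⁰ : ∀ {k} → Pred (Vec ℕ k) 0ℓ → Set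
  Δ⁰ P = Σ⁰ P × Π⁰ P

Graph : (ℕ → ℕ) → Pred (Vec ℕ 2) 0ℓ
Graph f (x ∷ y ∷ []) = f x ≡ y

Δ⁰-function : ∀ {os} → ℕ → Oracle os → (ℕ → ℕ) → Set
Δ⁰-function n X f = Δ⁰ n X (Graph f)

------------------------------------------------------------------------
-- Structures (ω, f) with one unary function

UnaryStructure : Set
UnaryStructure = ℕ → ℕ

InjectionStructure : UnaryStructure → Set
InjectionStructure f = Injective _≡_ _≡_ f

Punctual : UnaryStructure → Set
Punctual f = PrimitiveRecursive f

infix 4 _≅_

record _≅_ (A B : UnaryStructure) : Set where
  field
    bijection : ℕ ↔ ℕ
  open Inverse bijection public using (to; from)
  field
    homo : ∀ x → to (A x) ≡ B (to x)

open _≅_ public using (to; from)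

-- With a constant for each element of ω, the closed terms are fⁱ(a) and the
-- atomic sentences are fⁱ(a) = fʲ(b), coded here by (i, a, j, b).

atomicDiagram : UnaryStructure → Oracle (4 ∷ [])
atomicDiagram f =
  (λ { (i ∷ a ∷ j ∷ b ∷ []) → if fold a f i ≡ᵇ fold b f j then 1 else 0 }) ∷ []

RelativelyΔ⁰-categorical : ℕ → UnaryStructure → Set
RelativelyΔ⁰-categorical n A = (B : UnaryStructure) → A ≅ B →
  Σ[ h ∈ A ≅ B ] Δ⁰-function n (atomicDiagram B) (to h)

PRCatSpec : UnaryStructure → Pred PRDegree 0ℓ
PRCatSpec A d = (B : UnaryStructure) → Punctual B → A ≅ B →
  Σ[ h ∈ A ≅ B ] (to h ≤PR d × from h ≤PR d)

ConeΔ⁰ : ℕ → Pred PRDegree 0ℓ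
ConeΔ⁰ n d = (f : ℕ → ℕ) → Δ⁰-function n [] f → f ≤PR d

PRCatSpec-resp : ∀ A → PRCatSpec A Respects _≡PR_
PRCatSpec-resp A {d} {e} (d≤e , _) p B pB A≅B =
  let h , to≤d , from≤d = p B pB A≅B
  in  h , ≤PR-trans (to h) d e to≤d d≤e , ≤PR-trans (from h) d e from≤d d≤e

ConeΔ⁰-resp : ∀ n → ConeΔ⁰ n Respects _≡PR_
ConeΔ⁰-resp n {d} {e} (d≤e , _) p f Δf = ≤PR-trans f d e (p f Δf) d≤e

{-# OPTIONS --safe #-}
module Submission where

-- The isomorphism type of an injection structure is given by the numbers of
-- its cycles of each length, its ω-orbits and its ℤ-orbits.  If there are only
-- finitely many ω-orbits or only finitely many ℤ-orbits, then the type of an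
-- element is a limit computable function, and matching the n-th orbit of each
-- type gives a Δ⁰₂ isomorphism.  So A has infinitely many orbits of both kinds.
--
-- Then A has a punctual copy in which the s-th of a sequence of chains has
-- type ℤ exactly when a given Π⁰₂ condition holds for s, all other infinite
-- orbits being ω-orbits.  For a Δ⁰₃ function f this condition is chosen so that
-- for each n it holds for exactly one s of the form ⟨n, …⟩, and that this s
-- codes f(0), …, f(n).  In another copy the condition is always true, so that
-- the ℤ-orbits are known.  An isomorphism from the latter to the former maps
-- x + 1 known ℤ-orbits to chains with different n; one of these has n ≥ x, and
-- f(x) can be read off it.

open import Defs
open import Axiom.ExcludedMiddle using (ExcludedMiddle)
open import Data.Bool.Base using (Bool; true; false; T; if_then_else_)
open import Data.Fin.Base using (Fin; zero; suc; fromℕ<; toℕ)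
open import Data.Fin.Properties using (pigeonhole; toℕ-fromℕ<; toℕ<n)
open import Data.List.Base using (List; []; _∷_)
open import Data.List.Membership.Propositional using (_∈_)
open import Data.List.Relation.Unary.All using ([]; _∷_) renaming (lookup to All-lookup)
open import Data.List.Relation.Unary.Any using (here)
open import Data.Nat.Base
  using (ℕ; zero; suc; pred; >-nonZero; _+_; _∸_; _⊔_; _≤_; _<_; z≤n; s≤s; s≤s⁻¹; _≡ᵇ_)
open import Data.Nat.GeneralisedArithmetic using (fold; fold-+)
open import Data.Nat.Induction using (<-rec)
open import Data.Nat.Properties
open import Data.Product.Base
  using (Σ-syntax; ∃-syntax; ∃; _×_; _,_; proj₁; proj₂; map₂)
open import Data.Sum.Base using (_⊎_; inj₁; inj₂; [_,_]′)
open import Data.Unit.Base using (⊤; tt)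
open import Data.Vec.Base using (Vec; []; _∷_; head; tail; lookup; tabulate)
open import Data.Vec.Properties using (lookup∘tabulate)
open import Function.Base using (_∘_; id)
open import Function.Bundles using (_⇔_; mk⇔; mk↔ₛ′; Equivalence; Inverse)
open import Level using (0ℓ)
open import Relation.Binary.Definitions using (tri<; tri≈; tri>)
open import Relation.Binary.PropositionalEquality
  using (_≡_; _≢_; refl; sym; trans; cong; cong₂; subst; subst₂; module ≡-Reasoning)
open import Relation.Nullary.Decidable.Core using (Dec; yes; no; does)
open import Relation.Nullary.Negation.Core using (¬_; contradiction)
open import Relation.Unary using (_≐_)

-- The reduction of `f` to `d` must be primitive recursive, so the search for a suitable ℤ-orbit has
-- to be bounded in advance, although the isomorphism may permute these orbits arbitrarily. The
-- bound comes from the pigeonhole principle, and this is why each `n` must own exactly one ℤ-chain.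
-- A Σ⁰₃ definition may offer many witnesses; uniqueness is forced by guessing the least code `w`
-- together with the exact stage `k` after which smaller codes stop acting. Two copies are compared
-- because the ℤ-orbits of `A` itself need not be recognisable. The spectrum supplies isomorphisms
-- out of `A`, so the map between the copies passes through `A` and uses one of them backwards. In
-- the bounded case, lying in an infinite orbit is Π⁰₁ in the diagram, so a limit computable test
-- for one infinite type yields one for the other. Isomorphisms with the copies are not written down
-- directly: it is enough to compare the numbers of orbits of each type in both directions.

module Classical (em : ExcludedMiddle 0ℓ) where

  -- Classical case distinction, counting, eventual properties

  ite : Set → ℕ → ℕ → ℕ
  ite P a b = if does (em {P}) then a else b

  ite-yes : ∀ {P a b} → P → ite P a b ≡ a
  ite-yes {P} p with em {P}
  ... | yes _ = refl
  ... | no ¬p = contradiction p ¬p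

  ite-no : ∀ {P a b} → ¬ P → ite P a b ≡ b
  ite-no {P} ¬p with em {P}
  ... | yes p = contradiction p ¬p
  ... | no _  = refl

  χ : Set → ℕ
  χ P = ite P 1 0

  χ-true : ∀ {P} → χ P ≡ 1 → P
  χ-true {P} eq with em {P}
  ... | yes p = p

  χ-⇔ : ∀ {P Q} → (P → Q) → (Q → P) → χ P ≡ χ Q
  χ-⇔ {P} {Q} p⇒q q⇒p with em {P} | em {Q}
  ... | yes _ | yes _ = refl
  ... | yes p | no ¬q = contradiction (p⇒q p) ¬q
  ... | no ¬p | yes q = contradiction (q⇒p q) ¬p
  ... | no _  | no _  = refl

  byContradiction : ∀ {P : Set} → ¬ ¬ P → P
  byContradiction {P} ¬¬p with em {P}
  ... | yes p = p
  ... | no ¬p = contradiction ¬p ¬¬p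

  ¬∀⇒∃¬ : ∀ {A : Set} {P : A → Set} → ¬ (∀ x → P x) → ∃[ x ] ¬ P x
  ¬∀⇒∃¬ ¬∀ = byContradiction λ ¬∃ → ¬∀ λ x → byContradiction λ ¬p → ¬∃ (x , ¬p)

  least : {P : ℕ → Set} → ∃ P → ∃[ n ] (P n × ∀ m → m < n → ¬ P m)
  least {P} (n , p) = <-rec (λ n → P n → ∃[ n ] (P n × ∀ m → m < n → ¬ P m))
    (λ n rec p → step n rec p (em {∃[ m ] (m < n × P m)})) n p
    where
    step : ∀ n → (∀ {m} → m < n → P m → ∃[ n ] (P n × ∀ m → m < n → ¬ P m)) → P n →
           Dec (∃[ m ] (m < n × P m)) → ∃[ n ] (P n × ∀ m → m < n → ¬ P m)
    step n rec p (yes (m , m<n , q)) = rec m<n q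
    step n rec p (no ¬∃)             = n , p , λ m m<n q → ¬∃ (m , m<n , q)

  natrec : ℕ → (ℕ → ℕ → ℕ) → ℕ → ℕ
  natrec z s zero    = z
  natrec z s (suc n) = s n (natrec z s n)

  count : (ℕ → Set) → ℕ → ℕ
  count P = natrec 0 (λ k r → ite (P k) (suc r) r)

  module _ {P : ℕ → Set} where

    count-yes : ∀ {n} → P n → count P (suc n) ≡ suc (count P n)
    count-yes p = ite-yes p

    count-no : ∀ {n} → ¬ P n → count P (suc n) ≡ count P n
    count-no ¬p = ite-no ¬p

    count-≤-suc : ∀ n → count P n ≤ count P (suc n)
    count-≤-suc n with em {P n}
    ... | yes p = n≤1+n _
    ... | no ¬p = ≤-refl

    count-mono : ∀ {m n} → m ≤ n → count P m ≤ count P n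
    count-mono {m} {zero}  z≤n = ≤-refl
    count-mono {m} {suc n} m≤n with m≤n⇒m<n∨m≡n m≤n
    ... | inj₁ m<n  = ≤-trans (count-mono (s≤s⁻¹ m<n)) (count-≤-suc n)
    ... | inj₂ refl = ≤-refl

    count-< : ∀ {m n} → m < n → P m → count P m < count P n
    count-< m<n p = ≤-trans (≤-reflexive (sym (count-yes p))) (count-mono m<n)

    count-injective : ∀ {m n} → P m → P n → count P m ≡ count P n → m ≡ n
    count-injective {m} {n} p q eq with <-cmp m n
    ... | tri< m<n _ _ = contradiction eq (<⇒≢ (count-< m<n p))
    ... | tri≈ _ m≡n _ = m≡n
    ... | tri> _ _ n<m = contradiction (sym eq) (<⇒≢ (count-< n<m q))

    count-attained : ∀ i n → i < count P n → ∃[ m ] (P m × count P m ≡ i)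
    count-attained i (suc n) i<c with em {P n}
    ... | no ¬p = count-attained i n i<c
    ... | yes p with m<1+n⇒m<n∨m≡n i<c
    ...   | inj₁ i<c′ = count-attained i n i<c′
    ...   | inj₂ i≡c  = n , p , sym i≡c

    -- Minimisation by counting: if `P i` says that no candidate up to `i` succeeds, then `P` holds
    -- exactly below the least success `y`, and `count` returns `y`. The bounded searches below have
    -- this form.
    count-initial : ∀ {y} → (∀ {i} → i < y → P i) → (∀ {i} → P i → i < y) →
                    ∀ {n} → y ≤ n → count P n ≡ y
    count-initial {y} below above {n} y≤n with m≤n⇒m<n∨m≡n y≤n
    count-initial {zero}  below above {zero}  y≤n | _ = refl
    count-initial {suc y} below above {suc n} y≤n | inj₂ refl =
      trans (count-yes (below ≤-refl)) (cong suc (all y (λ i<y → below (≤-trans i<y (n≤1+n _)))))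
      where
      all : ∀ m → (∀ {i} → i < m → P i) → count P m ≡ m
      all zero    _ = refl
      all (suc m) h = trans (count-yes (h ≤-refl)) (cong suc (all m (λ i<m → h (≤-trans i<m (n≤1+n _)))))
    count-initial {y} below above {suc n} y≤n | inj₁ y<n =
      trans (count-no (λ p → <⇒≱ (above p) (s≤s⁻¹ y<n))) (count-initial below above (s≤s⁻¹ y<n))

  -- Induction on m, each time deleting the point j m from Q.
  count-embedding : ∀ {P : ℕ → Set} (j : ℕ → ℕ) m {n} {Q : ℕ → Set} →
    (∀ i → i < m → P i → Q (j i) × j i < n) →
    (∀ i k → i < m → k < m → P i → P k → j i ≡ j k → i ≡ k) →
    count P m ≤ count Q n
  count-embedding j zero    to inj = z≤n
  count-embedding {P} j (suc m) {n} {Q} to inj with em {P m}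
  ... | no ¬p = count-embedding j m (λ i i<m → to i (m<n⇒m<1+n i<m))
                  (λ i k i<m k<m → inj i k (m<n⇒m<1+n i<m) (m<n⇒m<1+n k<m))
  ... | yes p = ≤-trans (s≤s (count-embedding j m {n} {λ q → Q q × q ≢ j m}
      (λ i i<m pi → let q , ji<n = to i (m<n⇒m<1+n i<m) pi in
         (q , λ eq → <⇒≢ i<m (inj i m (m<n⇒m<1+n i<m) ≤-refl pi p eq)) , ji<n)
      (λ i k i<m k<m → inj i k (m<n⇒m<1+n i<m) (m<n⇒m<1+n k<m))))
      (delete n (proj₁ (to m ≤-refl p)) (proj₂ (to m ≤-refl p)))
    where
    Q′ : ℕ → Set
    Q′ q = Q q × q ≢ j m
    ignore : ∀ n → n ≤ j m → count Q′ n ≡ count Q n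
    ignore zero    _ = refl
    ignore (suc n) n<jm with em {Q′ n} | em {Q n}
    ... | yes _ | yes _ = cong suc (ignore n (<⇒≤ n<jm))
    ... | no _  | no _  = ignore n (<⇒≤ n<jm)
    ... | yes (q , _) | no ¬q = contradiction q ¬q
    ... | no ¬q′ | yes q = contradiction (q , <⇒≢ n<jm) ¬q′
    delete : ∀ n → Q (j m) → j m < n → count Q′ n < count Q n
    delete (suc n) q jm<n with m<1+n⇒m<n∨m≡n jm<n
    ... | inj₂ refl = ≤-reflexive (trans
            (cong suc (trans (count-no {Q′} {j m} (λ (_ , ne) → ne refl)) (ignore n ≤-refl)))
            (sym (count-yes {Q} {j m} q)))
    ... | inj₁ jm<n′ with em {Q′ n} | em {Q n}
    ...   | yes _ | yes _ = s≤s (delete n q jm<n′)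
    ...   | no _  | no _  = delete n q jm<n′
    ...   | no _  | yes _ = m<n⇒m<1+n (delete n q jm<n′)
    ...   | yes (q , _) | no ¬q = contradiction q ¬q

  image-bound : ∀ (j : ℕ → ℕ) n → ∃[ b ] ∀ i → i < n → j i < b
  image-bound j zero    = 0 , λ _ ()
  image-bound j (suc n) = let b , below = image-bound j n in suc (j n) ⊔ b , λ i i<1+n →
    [ (λ i<n → ≤-trans (below i i<n) (m≤n⊔m (suc (j n)) b))
    , (λ { refl → m≤m⊔n (suc (j i)) b }) ]′ (m<1+n⇒m<n∨m≡n i<1+n)

  Eventually : (ℕ → Set) → Set
  Eventually P = ∃[ s ] ∀ t → s ≤ t → P t

  module _ {P Q : ℕ → Set} where

    Eventually-map : (∀ t → P t → Q t) → Eventually P → Eventually Q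
    Eventually-map f (s , p) = s , λ t s≤t → f t (p t s≤t)

    Eventually-× : Eventually P → Eventually Q → Eventually (λ t → P t × Q t)
    Eventually-× (s , p) (s′ , q) = s ⊔ s′ , λ t s≤t →
      p t (≤-trans (m≤m⊔n s s′) s≤t) , q t (≤-trans (m≤n⊔m s s′) s≤t)

  Eventually-∀< : ∀ {P : ℕ → ℕ → Set} n → (∀ i → i < n → Eventually (P i)) →
                  Eventually (λ t → ∀ i → i < n → P i t)
  Eventually-∀< zero    _ = 0 , λ _ _ _ ()
  Eventually-∀< {P} (suc n) h = Eventually-map
    (λ { t (all , p) i i<1+n → [ all i , (λ { refl → p }) ]′ (m<1+n⇒m<n∨m≡n i<1+n) })
    (Eventually-× (Eventually-∀< n (λ i i<n → h i (m<n⇒m<1+n i<n))) (h n ≤-refl))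

  Eventually-Fin : ∀ {n} {P : Fin n → ℕ → Set} → (∀ i → Eventually (P i)) →
                   Eventually (λ t → ∀ i → P i t)
  Eventually-Fin {zero}  _ = 0 , λ _ _ ()
  Eventually-Fin {suc n} h = Eventually-map
    (λ { t (p , all) zero → p ; t (p , all) (suc i) → all i })
    (Eventually-× (h zero) (Eventually-Fin (h ∘ suc)))

  InfinitelyOften : (ℕ → Set) → Set
  InfinitelyOften P = ∀ s → ∃[ t ] (s ≤ t × P t)

  ¬InfinitelyOften : ∀ {P} → ¬ InfinitelyOften P → Eventually (λ t → ¬ P t)
  ¬InfinitelyOften ¬io = let s , ¬∃ = ¬∀⇒∃¬ ¬io in s , λ t s≤t p → ¬∃ (t , s≤t , p)

  -- Classes of functions closed under primitive recursion

  -- Arities are carried by contexts xs : Vec ℕ n; a binder adds a variable at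
  -- the head, so the i-th variable is head (tailⁱ xs).

  record Componentwise (𝒞 : ∀ {n} → (Vec ℕ n → ℕ) → Set) {m n} (Gs : Vec ℕ n → Vec ℕ m) : Set where
    constructor componentwise
    field component : ∀ i → 𝒞 (λ xs → lookup (Gs xs) i)
  open Componentwise public

  -- Primitive recursive functions and limit computable functions both satisfy these conditions, so
  -- the closure lemmas in the record serve for both.
  record PRClosed (𝒞 : ∀ {n} → (Vec ℕ n → ℕ) → Set) : Set₁ where
    field
      ext : ∀ {n} {F G : Vec ℕ n → ℕ} → (∀ xs → F xs ≡ G xs) → 𝒞 F → 𝒞 G
      zero-closed : ∀ {n} → 𝒞 {n} (λ _ → 0)
      suc-closed  : ∀ {n} {F : Vec ℕ n → ℕ} → 𝒞 F → 𝒞 (λ xs → suc (F xs))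
      proj-closed : ∀ {n} (i : Fin n) → 𝒞 (λ xs → lookup xs i)
      comp-closed : ∀ {m n} {F : Vec ℕ m → ℕ} {Gs : Vec ℕ n → Vec ℕ m} → 𝒞 F →
                    Componentwise 𝒞 Gs → 𝒞 (λ xs → F (Gs xs))
      natrec-closed : ∀ {n} {F H : Vec ℕ n → ℕ} {G : ℕ → ℕ → Vec ℕ n → ℕ} → 𝒞 F →
                      𝒞 (λ v → G (head v) (head (tail v)) (tail (tail v))) → 𝒞 H →
                      𝒞 (λ xs → natrec (F xs) (λ k r → G k r xs) (H xs))

    -- The predicate is arbitrary and `χ` comes from excluded middle; algorithmic content enters
    -- only through membership of `χ` in `𝒞`.
    Decides : ∀ {n} → (Vec ℕ n → Set) → Set
    Decides P = 𝒞 (λ xs → χ (P xs))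

    []-closed : ∀ {n} → Componentwise 𝒞 {n = n} (λ _ → [])
    []-closed = componentwise λ ()

    infixr 5 _∷-closed_
    _∷-closed_ : ∀ {m n} {F : Vec ℕ n → ℕ} {Gs : Vec ℕ n → Vec ℕ m} → 𝒞 F →
                 Componentwise 𝒞 Gs → Componentwise 𝒞 (λ xs → F xs ∷ Gs xs)
    f ∷-closed gs = componentwise λ { zero → f ; (suc i) → component gs i }

    id-closed : ∀ {n} → Componentwise 𝒞 {n} id
    id-closed = componentwise proj-closed

    tail-closed : ∀ {m n} {Gs : Vec ℕ n → Vec ℕ (suc m)} → Componentwise 𝒞 Gs →
                  Componentwise 𝒞 (λ xs → tail (Gs xs))
    tail-closed {Gs = Gs} gs = componentwise λ i → ext (λ xs → lookup-tail (Gs xs)) (component gs (suc i))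
      where
      lookup-tail : ∀ {m} {i : Fin m} (xs : Vec ℕ (suc m)) → lookup xs (suc i) ≡ lookup (tail xs) i
      lookup-tail (_ ∷ _) = refl

    weaken : ∀ {n} {F : Vec ℕ n → ℕ} → 𝒞 F → 𝒞 (λ v → F (tail v))
    weaken f = comp-closed f (tail-closed id-closed)

    var0 : ∀ {n} → 𝒞 {suc n} head
    var0 = ext (λ { (_ ∷ _) → refl }) (proj-closed zero)
    var1 : ∀ {n} → 𝒞 {2 + n} (λ v → head (tail v))
    var1 = weaken var0
    var2 : ∀ {n} → 𝒞 {3 + n} (λ v → head (tail (tail v)))
    var2 = weaken var1
    var3 : ∀ {n} → 𝒞 {4 + n} (λ v → head (tail (tail (tail v))))
    var3 = weaken var2
    var4 : ∀ {n} → 𝒞 {5 + n} (λ v → head (tail (tail (tail (tail v)))))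
    var4 = weaken var3

    Closed₁ : (ℕ → ℕ) → Set
    Closed₁ f = 𝒞 {1} (λ v → f (head v))
    Closed₂ : (ℕ → ℕ → ℕ) → Set
    Closed₂ f = 𝒞 {2} (λ v → f (head v) (head (tail v)))
    Decides₁ : (ℕ → Set) → Set
    Decides₁ P = Decides {1} (λ v → P (head v))
    Decides₂ : (ℕ → ℕ → Set) → Set
    Decides₂ P = Decides {2} (λ v → P (head v) (head (tail v)))
    Decides₃ : (ℕ → ℕ → ℕ → Set) → Set
    Decides₃ P = Decides {3} (λ v → P (head v) (head (tail v)) (head (tail (tail v))))

    module _ {n} {F : Vec ℕ n → ℕ} where
      app₁ : ∀ f → Closed₁ f → 𝒞 F → 𝒞 (λ xs → f (F xs))
      app₁ _ f F = comp-closed f (F ∷-closed []-closed)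
      dec₁ : ∀ P → Decides₁ P → 𝒞 F → Decides (λ xs → P (F xs))
      dec₁ _ P F = comp-closed P (F ∷-closed []-closed)

    module _ {n} {F G : Vec ℕ n → ℕ} where
      app₂ : ∀ f → Closed₂ f → 𝒞 F → 𝒞 G → 𝒞 (λ xs → f (F xs) (G xs))
      app₂ _ f F G = comp-closed f (F ∷-closed G ∷-closed []-closed)
      dec₂ : ∀ P → Decides₂ P → 𝒞 F → 𝒞 G → Decides (λ xs → P (F xs) (G xs))
      dec₂ _ P F G = comp-closed P (F ∷-closed G ∷-closed []-closed)
      dec₃ : ∀ P {H} → Decides₃ P → 𝒞 F → 𝒞 G → 𝒞 H → Decides (λ xs → P (F xs) (G xs) (H xs))
      dec₃ _ P F G H = comp-closed P (F ∷-closed G ∷-closed H ∷-closed []-closed)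

    const-closed : ∀ {n} m → 𝒞 {n} (λ _ → m)
    const-closed zero    = zero-closed
    const-closed (suc m) = suc-closed (const-closed m)

    module _ {n} {F : Vec ℕ n → ℕ} where

      pred-closed : 𝒞 F → 𝒞 (λ xs → pred (F xs))
      pred-closed f = ext (λ xs → eq (F xs)) (natrec-closed zero-closed var0 f)
        where
        eq : ∀ a → natrec 0 (λ k _ → k) a ≡ pred a
        eq zero    = refl
        eq (suc a) = refl

    module _ {n} {F G : Vec ℕ n → ℕ} where

      +-closed : 𝒞 F → 𝒞 G → 𝒞 (λ xs → F xs + G xs)
      +-closed f g = ext (λ xs → eq (F xs)) (natrec-closed g (suc-closed var1) f)
        where
        eq : ∀ {b} a → natrec b (λ _ r → suc r) a ≡ a + b
        eq zero    = refl
        eq (suc a) = cong suc (eq a)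

      fold-closed : ∀ {g} → Closed₁ g → 𝒞 F → 𝒞 G → 𝒞 (λ xs → fold (F xs) g (G xs))
      fold-closed {g} cg f n = ext (λ xs → eq (G xs)) (natrec-closed f (app₁ g cg var1) n)
        where
        eq : ∀ {b} a → natrec b (λ _ r → g r) a ≡ fold b g a
        eq zero    = refl
        eq (suc a) = cong g (eq a)

    module _ {n} {F G : Vec ℕ n → ℕ} where

      ∸-closed : 𝒞 F → 𝒞 G → 𝒞 (λ xs → F xs ∸ G xs)
      ∸-closed f g = ext (λ xs → eq (F xs) (G xs)) (natrec-closed f (pred-closed var1) g)
        where
        eq : ∀ a b → natrec a (λ _ r → pred r) b ≡ a ∸ b
        eq a zero    = refl
        eq a (suc b) = trans (cong pred (eq a b)) (pred[m∸n]≡m∸[1+n] a b)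

      ite-closed : ∀ {P} → Decides P → 𝒞 F → 𝒞 G → 𝒞 (λ xs → ite (P xs) (F xs) (G xs))
      ite-closed {P} p f g = ext eq (natrec-closed g (weaken (weaken f)) p)
        where
        eq : ∀ xs → natrec (G xs) (λ _ _ → F xs) (χ (P xs)) ≡ ite (P xs) (F xs) (G xs)
        eq xs with em {P xs}
        ... | yes _ = refl
        ... | no  _ = refl

    module _ {n} {P : Vec ℕ n → Set} where

      ¬-decides : Decides P → Decides (λ xs → ¬ P xs)
      ¬-decides p = ext eq (ite-closed p zero-closed (suc-closed zero-closed))
        where
        eq : ∀ xs → ite (P xs) 0 1 ≡ χ (¬ P xs)
        eq xs with em {P xs}
        ... | yes p = sym (ite-no (λ ¬p → ¬p p))
        ... | no ¬p = sym (ite-yes ¬p)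

    module _ {n} {P Q : Vec ℕ n → Set} where

      Decides-⇔ : (∀ xs → P xs → Q xs) → (∀ xs → Q xs → P xs) → Decides P → Decides Q
      Decides-⇔ to from = ext (λ xs → χ-⇔ (to xs) (from xs))

      ×-decides : Decides P → Decides Q → Decides (λ xs → P xs × Q xs)
      ×-decides p q = ext eq (ite-closed p q zero-closed)
        where
        eq : ∀ xs → ite (P xs) (χ (Q xs)) 0 ≡ χ (P xs × Q xs)
        eq xs with em {P xs}
        ... | yes p = χ-⇔ (p ,_) proj₂
        ... | no ¬p = sym (ite-no (¬p ∘ proj₁))

    module _ {n} {P Q : Vec ℕ n → Set} where

      →-decides : Decides P → Decides Q → Decides (λ xs → P xs → Q xs)
      →-decides p q = Decides-⇔
        (λ xs h p → byContradiction (λ ¬q → h (p , ¬q))) (λ xs h (p , ¬q) → ¬q (h p))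
        (¬-decides (×-decides p (¬-decides q)))

      ⊎-decides : Decides P → Decides Q → Decides (λ xs → P xs ⊎ Q xs)
      ⊎-decides p q = Decides-⇔
        (λ xs h → byContradiction (λ ¬⊎ → h (¬⊎ ∘ inj₁ , ¬⊎ ∘ inj₂)))
        (λ { xs (inj₁ p) (¬p , _) → ¬p p ; xs (inj₂ q) (_ , ¬q) → ¬q q })
        (¬-decides (×-decides (¬-decides p) (¬-decides q)))

    module _ {n} {F G : Vec ℕ n → ℕ} where

      ≤-decides : 𝒞 F → 𝒞 G → Decides (λ xs → F xs ≤ G xs)
      ≤-decides f g = ext (λ xs → eq (F xs) (G xs))
        (natrec-closed (const-closed 1) zero-closed (∸-closed f g))
        where
        eq : ∀ a b → natrec 1 (λ _ _ → 0) (a ∸ b) ≡ χ (a ≤ b)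
        eq a b with a ∸ b in e
        ... | zero  = sym (ite-yes (m∸n≡0⇒m≤n e))
        ... | suc _ = sym (ite-no (λ a≤b → 0≢1+n (trans (sym (m≤n⇒m∸n≡0 a≤b)) e)))

    module _ {n} {F G : Vec ℕ n → ℕ} where

      <-decides : 𝒞 F → 𝒞 G → Decides (λ xs → F xs < G xs)
      <-decides f g = ≤-decides (suc-closed f) g

      ≡-decides : 𝒞 F → 𝒞 G → Decides (λ xs → F xs ≡ G xs)
      ≡-decides f g = Decides-⇔ (λ xs (p , q) → ≤-antisym p q)
        (λ xs eq → ≤-reflexive eq , ≤-reflexive (sym eq))
        (×-decides (≤-decides f g) (≤-decides g f))

    module _ {n} {F : Vec ℕ n → ℕ} {P : ℕ → Vec ℕ n → Set} where

      ∀<-decides : Decides (λ v → P (head v) (tail v)) → 𝒞 F →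
                   Decides (λ xs → ∀ i → i < F xs → P i xs)
      ∀<-decides p f = ext (λ xs → eq xs (F xs))
        (natrec-closed (const-closed 1)
           (ite-closed (comp-closed p (var0 ∷-closed tail-closed (tail-closed id-closed))) var1 zero-closed) f)
        where
        eq : ∀ xs m → natrec 1 (λ k r → ite (P k xs) r 0) m ≡ χ (∀ i → i < m → P i xs)
        eq xs zero    = sym (ite-yes (λ _ ()))
        eq xs (suc m) with em {P m xs}
        ... | no ¬p = sym (ite-no (λ h → ¬p (h m ≤-refl)))
        ... | yes p = trans (eq xs m) (χ-⇔
          (λ h i i<1+m → [ h i , (λ { refl → p }) ]′ (m<1+n⇒m<n∨m≡n i<1+m))
          (λ h i i<m → h i (m<n⇒m<1+n i<m)))

      count-closed : Decides (λ v → P (head v) (tail v)) → 𝒞 F →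
                     𝒞 (λ xs → count (λ i → P i xs) (F xs))
      count-closed p f = natrec-closed zero-closed
        (ite-closed (comp-closed p (var0 ∷-closed tail-closed (tail-closed id-closed))) (suc-closed var1) var1) f

    module _ {n} {F : Vec ℕ n → ℕ} {P : ℕ → Vec ℕ n → Set} where

      ∃<-decides : Decides (λ v → P (head v) (tail v)) → 𝒞 F →
                   Decides (λ xs → ∃[ i ] (i < F xs × P i xs))
      ∃<-decides p f = Decides-⇔
        (λ xs h → byContradiction (λ ¬∃ → h (λ i i<F p → ¬∃ (i , i<F , p))))
        (λ xs (i , i<F , p) h → h i i<F p)
        (¬-decides (∀<-decides (¬-decides p) f))

    -- With a majorant in `𝒞` the value can be searched for: `g xs` is the number of `i` such that
    -- no `k ≤ i` is the value.
    bounded-graph : ∀ {n} {g F : Vec ℕ n → ℕ} → (∀ xs → g xs ≤ F xs) → 𝒞 F →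
                    Decides (λ v → g (tail v) ≡ head v) → 𝒞 g
    bounded-graph {n} {g} {F} g≤F f graph = ext
      (λ xs → count-initial
        (λ i<g k k<1+i g≡k → <⇒≢ (≤-trans k<1+i i<g) (sym g≡k))
        (λ {i} h → ≰⇒> (λ g≤i → h (g xs) (s≤s g≤i) refl))
        (g≤F xs))
      (count-closed {P = λ i xs → ∀ k → k < suc i → g xs ≢ k}
        (∀<-decides (¬-decides (comp-closed graph (var0 ∷-closed tail-closed (tail-closed id-closed))))
                    (suc-closed var0))
        f)

  -- Cantor pairing

  opaque
    triangle : ℕ → ℕ
    triangle zero    = 0
    triangle (suc n) = suc n + triangle n

    ⟪_,_⟫ : ℕ → ℕ → ℕ
    ⟪ a , b ⟫ = b + triangle (a + b)

    private
      triangle-mono : ∀ {m n} → m ≤ n → triangle m ≤ triangle n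
      triangle-mono z≤n       = z≤n
      triangle-mono (s≤s m≤n) = +-mono-≤ (s≤s m≤n) (triangle-mono m≤n)

      n≤triangle : ∀ n → n ≤ triangle n
      n≤triangle zero    = z≤n
      n≤triangle (suc n) = m≤m+n (suc n) (triangle n)

      diagonal-< : ∀ {a b c d} → a + b < c + d → ⟪ a , b ⟫ < ⟪ c , d ⟫
      diagonal-< {a} {b} {c} {d} lt = ≤-trans (+-monoˡ-≤ (triangle (a + b)) (s≤s (m≤n+m b a)))
        (≤-trans (triangle-mono lt) (m≤n+m (triangle (c + d)) d))

      ⟪⟫-surjective : ∀ n → ∃[ a ] ∃[ b ] ⟪ a , b ⟫ ≡ n
      ⟪⟫-surjective zero = 0 , 0 , refl
      ⟪⟫-surjective (suc n) with ⟪⟫-surjective n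
      -- The next code lies on the same diagonal, or at the start of the next diagonal if this one
      -- ends with `a = 0`.
      ... | suc a , b , eq = a , suc b ,
        trans (cong (λ s → suc b + triangle s) (+-suc a b)) (cong suc eq)
      ... | zero  , b , eq = suc b , 0 ,
        trans (cong triangle (+-identityʳ (suc b))) (cong suc eq)

      ⟪⟫-injective : ∀ {a b c d} → ⟪ a , b ⟫ ≡ ⟪ c , d ⟫ → a ≡ c × b ≡ d
      ⟪⟫-injective {a} {b} {c} {d} eq with <-cmp (a + b) (c + d)
      ... | tri< lt _ _ = contradiction eq (<⇒≢ (diagonal-< {a} {b} {c} {d} lt))
      ... | tri> _ _ gt = contradiction (sym eq) (<⇒≢ (diagonal-< {c} {d} {a} {b} gt))
      ... | tri≈ _ s≡ _ = +-cancelʳ-≡ b a c (trans s≡ (cong (c +_) (sym b≡d))) , b≡d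
        where
        b≡d : b ≡ d
        b≡d = +-cancelʳ-≡ (triangle (a + b)) b d (trans eq (cong (λ s → d + triangle s) (sym s≡)))

    -- The projections are read off from the surjectivity proof; that they are primitive recursive
    -- is recovered from their graphs by `bounded-graph`.
    fst : ℕ → ℕ
    fst n = proj₁ (⟪⟫-surjective n)

    snd : ℕ → ℕ
    snd n = proj₁ (proj₂ (⟪⟫-surjective n))

    ⟪fst,snd⟫ : ∀ n → ⟪ fst n , snd n ⟫ ≡ n
    ⟪fst,snd⟫ n = proj₂ (proj₂ (⟪⟫-surjective n))

    fst-⟪⟫ : ∀ a b → fst ⟪ a , b ⟫ ≡ a
    fst-⟪⟫ a b = proj₁ (⟪⟫-injective {fst ⟪ a , b ⟫} {snd ⟪ a , b ⟫} {a} {b} (⟪fst,snd⟫ ⟪ a , b ⟫))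

    snd-⟪⟫ : ∀ a b → snd ⟪ a , b ⟫ ≡ b
    snd-⟪⟫ a b = proj₂ (⟪⟫-injective {fst ⟪ a , b ⟫} {snd ⟪ a , b ⟫} {a} {b} (⟪fst,snd⟫ ⟪ a , b ⟫))

    fst≤ : ∀ n → fst n ≤ n
    fst≤ n = ≤-trans (≤-trans (m≤m+n (fst n) (snd n)) (n≤triangle _))
             (≤-trans (m≤n+m _ (snd n)) (≤-reflexive (⟪fst,snd⟫ n)))

    snd≤ : ∀ n → snd n ≤ n
    snd≤ n = ≤-trans (m≤m+n (snd n) _) (≤-reflexive (⟪fst,snd⟫ n))

  ⟪⟫-injectiveˡ : ∀ {a b c d} → ⟪ a , b ⟫ ≡ ⟪ c , d ⟫ → a ≡ c
  ⟪⟫-injectiveˡ eq = trans (sym (fst-⟪⟫ _ _)) (trans (cong fst eq) (fst-⟪⟫ _ _))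

  ⟪⟫-injectiveʳ : ∀ {a b c d} → ⟪ a , b ⟫ ≡ ⟪ c , d ⟫ → b ≡ d
  ⟪⟫-injectiveʳ eq = trans (sym (snd-⟪⟫ _ _)) (trans (cong snd eq) (snd-⟪⟫ _ _))

  module Pairing {𝒞 : ∀ {n} → (Vec ℕ n → ℕ) → Set} (closed : PRClosed 𝒞) where
    open PRClosed closed

    opaque
      unfolding ⟪_,_⟫

      pair-closed : ∀ {n} {F G : Vec ℕ n → ℕ} → 𝒞 F → 𝒞 G → 𝒞 (λ xs → ⟪ F xs , G xs ⟫)
      pair-closed f g = +-closed g (app₁ triangle triangle-closed (+-closed f g))
        where
        triangle≡ : ∀ n → natrec 0 (λ k r → suc k + r) n ≡ triangle n
        triangle≡ zero    = refl
        triangle≡ (suc n) = cong (suc n +_) (triangle≡ n)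
        triangle-closed : Closed₁ triangle
        triangle-closed = ext (λ v → triangle≡ (head v))
          (natrec-closed zero-closed (+-closed (suc-closed var0) var1) var0)

    fst-closed : ∀ {n} {F : Vec ℕ n → ℕ} → 𝒞 F → 𝒞 (λ xs → fst (F xs))
    fst-closed = app₁ fst (bounded-graph (λ v → fst≤ (head v)) var0 (Decides-⇔
      (λ { (a ∷ n ∷ []) (b , _ , eq) → trans (cong fst (sym eq)) (fst-⟪⟫ a b) })
      (λ { (a ∷ n ∷ []) refl → snd n , s≤s (snd≤ n) , ⟪fst,snd⟫ n })
      (∃<-decides {P = λ b v → ⟪ head v , b ⟫ ≡ head (tail v)}
        (≡-decides (pair-closed var1 var0) var2) (suc-closed var1))))

    snd-closed : ∀ {n} {F : Vec ℕ n → ℕ} → 𝒞 F → 𝒞 (λ xs → snd (F xs))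
    snd-closed = app₁ snd (bounded-graph (λ v → snd≤ (head v)) var0 (Decides-⇔
      (λ { (b ∷ n ∷ []) (a , _ , eq) → trans (cong snd (sym eq)) (snd-⟪⟫ a b) })
      (λ { (b ∷ n ∷ []) refl → fst n , s≤s (fst≤ n) , ⟪fst,snd⟫ n })
      (∃<-decides {P = λ a v → ⟪ a , head v ⟫ ≡ head (tail v)}
        (≡-decides (pair-closed var0 var1) var2) (suc-closed var1))))

  -- Primitive recursive and limit computable functions relative to an oracle

  record IsPR {os : List ℕ} (X : Oracle os) {n} (F : Vec ℕ n → ℕ) : Set where
    constructor isPR
    field
      program : PR os n
      correct : ∀ xs → eval X program xs ≡ F xs
  open IsPR public

  isPR-closed : ∀ {os} (X : Oracle os) → PRClosed (IsPR X)
  isPR-closed {os} X = record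
    { ext           = λ F≗G f → isPR (program f) λ xs → trans (correct f xs) (F≗G xs)
    ; zero-closed   = isPR (comp zer []) λ _ → refl
    ; suc-closed    = λ f → isPR (comp suc (program f ∷ [])) λ xs → cong suc (correct f xs)
    ; proj-closed   = λ i → isPR (proj i) λ _ → refl
    ; comp-closed   = λ {_} {_} {F} {Gs} f gs →
        isPR (comp (program f) (tabulate (λ i → program (component gs i)))) λ xs →
          trans (correct f _) (cong F
            (eval*-tabulate xs (λ i → program (component gs i)) (Gs xs) (λ i → correct (component gs i) xs)))
    ; natrec-closed = natrec-PR
    }
    where
    eval*-tabulate : ∀ {m n} (xs : Vec ℕ n) (Ψ : Fin m → PR os n) (ys : Vec ℕ m) →
                     (∀ i → eval X (Ψ i) xs ≡ lookup ys i) → eval* X (tabulate Ψ) xs ≡ ys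
    eval*-tabulate xs Ψ []       eq = refl
    eval*-tabulate xs Ψ (y ∷ ys) eq = cong₂ _∷_ (eq zero) (eval*-tabulate xs (Ψ ∘ suc) ys (eq ∘ suc))

    eval*-proj : ∀ {n} (xs : Vec ℕ n) → eval* X (tabulate proj) xs ≡ xs
    eval*-proj xs = eval*-tabulate xs proj xs (λ _ → refl)

    natrec-PR : ∀ {n} {F H : Vec ℕ n → ℕ} {G : ℕ → ℕ → Vec ℕ n → ℕ} → IsPR X F →
                IsPR X (λ v → G (head v) (head (tail v)) (tail (tail v))) → IsPR X H →
                IsPR X (λ xs → natrec (F xs) (λ k r → G k r xs) (H xs))
    natrec-PR {n} {F} {H} {G} f g h = isPR (comp (prec (program f) (program g)) (program h ∷ tabulate proj)) λ xs →
      trans (cong₂ (λ m ys → eval X (prec (program f) (program g)) (m ∷ ys)) (correct h xs) (eval*-proj xs))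
            (loop (H xs) xs)
      where
      loop : ∀ m xs → eval X (prec (program f) (program g)) (m ∷ xs) ≡ natrec (F xs) (λ k r → G k r xs) m
      loop zero    xs = correct f xs
      loop (suc m) xs = trans (correct g _) (cong (λ r → G m r xs) (loop m xs))

  oracle-PR : ∀ {n os} {X : Oracle os} (i : n ∈ os) → IsPR X (All-lookup X i)
  oracle-PR i = isPR (orac i) λ _ → refl

  module _ {os : List ℕ} (X : Oracle os) where
    mutual
      toRec : ∀ {n} → PR os n → Rec os n
      toRec zer         = zer
      toRec suc         = suc
      toRec (proj i)    = proj i
      toRec (orac i)    = orac i
      toRec (comp f gs) = comp (toRec f) (toRec* gs)
      toRec (prec f g)  = prec (toRec f) (toRec g)

      toRec* : ∀ {m n} → Vec (PR os n) m → Vec (Rec os n) m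
      toRec* []       = []
      toRec* (g ∷ gs) = toRec g ∷ toRec* gs

    mutual
      toRec-converges : ∀ {n} (Ψ : PR os n) xs → Converges X (toRec Ψ) xs (eval X Ψ xs)
      toRec-converges zer         []           = zer
      toRec-converges suc         (x ∷ [])     = suc
      toRec-converges (proj i)    xs           = proj
      toRec-converges (orac i)    xs           = orac
      toRec-converges (comp f gs) xs           = comp (toRec*-converges gs xs) (toRec-converges f _)
      toRec-converges (prec f g)  (zero ∷ xs)  = prec₀ (toRec-converges f xs)
      toRec-converges (prec f g)  (suc n ∷ xs) = precₛ (toRec-converges (prec f g) (n ∷ xs)) (toRec-converges g _)

      toRec*-converges : ∀ {m n} (Ψs : Vec (PR os n) m) xs → Converges* X (toRec* Ψs) xs (eval* X Ψs xs)
      toRec*-converges []       xs = []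
      toRec*-converges (Ψ ∷ Ψs) xs = toRec-converges Ψ xs ∷ toRec*-converges Ψs xs

  decides⇒computable : ∀ {os} {X : Oracle os} {k} {P : Vec ℕ k → Set} →
    PRClosed.Decides (isPR-closed X) P → ComputableRel X (λ xs → does (em {P xs}))
  decides⇒computable {X = X} p = toRec X (program p) , λ xs →
    subst (Converges X _ xs) (correct p xs) (toRec-converges X (program p) xs)

  -- Limit computability in the sense of the limit lemma, with approximations
  -- that are primitive recursive in X.

  record Limit {os : List ℕ} (X : Oracle os) {n} (F : Vec ℕ n → ℕ) : Set where
    constructor limit
    field
      approx    : ℕ → Vec ℕ n → ℕ
      approx-PR : IsPR X (λ v → approx (head v) (tail v))
      converges : ∀ xs → Eventually (λ s → approx s xs ≡ F xs)
  open Limit public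

  module _ {os} {X : Oracle os} where
    private open module PR-X = PRClosed (isPR-closed X)

    PR⇒Limit : ∀ {n} {F : Vec ℕ n → ℕ} → IsPR X F → Limit X F
    PR⇒Limit {F = F} f = limit (λ _ → F) (weaken f) (λ _ → 0 , λ _ _ → refl)

    -- All ingredients are approximated at the same stage. An evaluation consults finitely many
    -- values, each of them final from some stage on, so beyond the largest of these stages the
    -- whole evaluation is right.
    limit-closed : PRClosed (Limit X)
    limit-closed = record
      { ext           = λ F≗G f → limit (approx f) (approx-PR f) λ xs →
          Eventually-map (λ s eq → trans eq (F≗G xs)) (converges f xs)
      ; zero-closed   = PR⇒Limit PR-X.zero-closed
      ; suc-closed    = λ f → limit (λ s xs → suc (approx f s xs)) (suc-closed (approx-PR f)) λ xs →
          Eventually-map (λ s → cong suc) (converges f xs)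
      ; proj-closed   = λ i → PR⇒Limit (PR-X.proj-closed i)
      ; comp-closed   = comp-limit
      ; natrec-closed = natrec-limit
      }
      where
      comp-limit : ∀ {m n} {F : Vec ℕ m → ℕ} {Gs : Vec ℕ n → Vec ℕ m} → Limit X F →
                   Componentwise (Limit X) Gs → Limit X (λ xs → F (Gs xs))
      comp-limit {m} {n} {F} {Gs} f gs = limit (λ s xs → approx f s (g s xs))
        (comp-closed (approx-PR f) (var0 ∷-closed componentwise λ i →
          ext (λ v → sym (lookup∘tabulate _ i)) (approx-PR (component gs i))))
        (λ xs → Eventually-map (λ s (g≡ , f≡) → trans (cong (approx f s) (g≡Gs s xs g≡)) f≡)
          (Eventually-× (Eventually-Fin (λ i → converges (component gs i) xs)) (converges f (Gs xs))))
        where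
        g : ℕ → Vec ℕ n → Vec ℕ m
        g s xs = tabulate (λ i → approx (component gs i) s xs)
        tabulate≡ : ∀ {m} (h : Fin m → ℕ) (ys : Vec ℕ m) → (∀ i → h i ≡ lookup ys i) → tabulate h ≡ ys
        tabulate≡ h []       eq = refl
        tabulate≡ h (y ∷ ys) eq = cong₂ _∷_ (eq zero) (tabulate≡ (h ∘ suc) ys (eq ∘ suc))
        g≡Gs : ∀ s xs → (∀ i → approx (component gs i) s xs ≡ lookup (Gs xs) i) → g s xs ≡ Gs xs
        g≡Gs s xs = tabulate≡ _ (Gs xs)

      natrec-limit : ∀ {n} {F H : Vec ℕ n → ℕ} {G : ℕ → ℕ → Vec ℕ n → ℕ} → Limit X F →
                     Limit X (λ v → G (head v) (head (tail v)) (tail (tail v))) → Limit X H →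
                     Limit X (λ xs → natrec (F xs) (λ k r → G k r xs) (H xs))
      natrec-limit {n} {F} {H} {G} f g h = limit (λ s xs → loop s xs (approx h s xs))
        (natrec-closed (approx-PR f)
          (comp-closed (approx-PR g)
            (var2 ∷-closed var0 ∷-closed var1 ∷-closed tail-closed (tail-closed (tail-closed id-closed))))
          (approx-PR h))
        (λ xs → Eventually-map (λ s (h≡ , eq) → trans (cong (loop s xs) h≡) eq)
          (Eventually-× (converges h xs) (loop-converges xs (H xs))))
        where
        loop : ℕ → Vec ℕ n → ℕ → ℕ
        loop s xs = natrec (approx f s xs) (λ k r → approx g s (k ∷ r ∷ xs))
        loop-converges : ∀ xs m → Eventually (λ s → loop s xs m ≡ natrec (F xs) (λ k r → G k r xs) m)
        loop-converges xs zero    = converges f xs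
        loop-converges xs (suc m) = Eventually-map
          (λ s (ih , g≡) → trans (cong (λ r → approx g s (m ∷ r ∷ xs)) ih) g≡)
          (Eventually-× (loop-converges xs m) (converges g (m ∷ _ ∷ xs)))

    private open module Lim = PRClosed limit-closed using () renaming (Decides to LimitDecides)

    -- Unbounded search, with a witness known to exist. Stage `s` searches below `s` in the
    -- stage-`s` approximation of `P`; once `s` has reached `g xs` and the approximations at the
    -- finitely many `i ≤ g xs` are final, the result is `g xs`.
    minimum-limit : ∀ {n} {P : ℕ → Vec ℕ n → Set} {g : Vec ℕ n → ℕ} →
      LimitDecides (λ v → P (head v) (tail v)) →
      (∀ xs → P (g xs) xs) → (∀ xs i → i < g xs → ¬ P i xs) → Limit X g
    minimum-limit {n} {P} {g} p holds minimal = limit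
      (λ s xs → count (λ j → ∀ i → i < suc j → approx p s (i ∷ xs) ≢ 1) s)
      (count-closed (∀<-decides (¬-decides (≡-decides
        (comp-closed (approx-PR p) (var2 ∷-closed var0 ∷-closed tail-closed (tail-closed (tail-closed id-closed))))
        (const-closed 1))) (suc-closed var0)) var0)
      λ xs → Eventually-map
        (λ s (g≤s , p≡) → count-initial
          (λ j<g i i≤j p≡1 → minimal xs i (≤-trans i≤j j<g)
            (χ-true (trans (sym (p≡ i (m<n⇒m<1+n (≤-trans i≤j j<g)))) p≡1)))
          (λ {j} h → ≰⇒> λ g≤j → h (g xs) (s≤s g≤j) (trans (p≡ (g xs) ≤-refl) (ite-yes (holds xs))))
          g≤s)
        (Eventually-× (g xs , λ _ le → le)
          (Eventually-∀< (suc (g xs)) (λ i _ → converges p (i ∷ xs))))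

    -- Searching below the stage changes its answer at most once, when the first witness appears.
    ∃-limit : ∀ {n} {P : ℕ → Vec ℕ n → Set} →
      PR-X.Decides (λ v → P (head v) (tail v)) → LimitDecides (λ xs → ∃[ i ] P i xs)
    ∃-limit {n} {P} p = limit (λ s xs → χ (∃[ i ] (i < s × P i xs)))
      (∃<-decides (comp-closed p (var0 ∷-closed tail-closed (tail-closed id-closed))) var0)
      λ xs → by-cases xs em
      where
      by-cases : ∀ xs → Dec (∃[ i ] P i xs) →
                 Eventually (λ s → χ (∃[ i ] (i < s × P i xs)) ≡ χ (∃[ i ] P i xs))
      by-cases xs (yes (i , q)) = suc i , λ s i<s → χ-⇔ (λ (i , _ , q) → i , q) (λ _ → i , i<s , q)
      by-cases xs (no ¬∃)       = 0 , λ s _ → χ-⇔ (λ (i , _ , q) → i , q) (λ ∃P → contradiction ∃P ¬∃)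

    -- One direction of the limit lemma: the value is `y` iff the approximation is `y` from some
    -- stage on, which is Σ⁰₂, iff it is `y` at arbitrarily late stages, which is Π⁰₂.
    limit⇒Δ⁰₂ : ∀ {f} → Limit X {1} (λ v → f (head v)) → Δ⁰-function 2 X f
    limit⇒Δ⁰₂ {f} l =
        ((λ v → does (em {Σ-matrix v})) ,
         decides⇒computable {P = Σ-matrix} (→-decides (≤-decides var0 var1) stage-decides) ,
         λ xs → mk⇔ (graph⇒Σ xs) (Σ⇒graph xs))
      , ((λ v → does (em {Π-matrix v})) ,
         decides⇒computable {P = Π-matrix} (×-decides (≤-decides var0 var1) stage-decides) ,
         λ xs → mk⇔ (graph⇒Π xs) (Π⇒graph xs))
      where
      Σ-matrix Π-matrix : Vec ℕ 4 → Set
      Σ-matrix v = head v ≤ head (tail v) →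
        approx l (head (tail v)) (head (tail (tail v)) ∷ []) ≡ head (tail (tail (tail v)))
      Π-matrix v = head v ≤ head (tail v) ×
        approx l (head (tail v)) (head (tail (tail v)) ∷ []) ≡ head (tail (tail (tail v)))
      stage-decides : PR-X.Decides {4} (λ v →
        approx l (head (tail v)) (head (tail (tail v)) ∷ []) ≡ head (tail (tail (tail v))))
      stage-decides = ≡-decides (comp-closed (approx-PR l) (var1 ∷-closed var2 ∷-closed []-closed)) var3
      T-does : ∀ {P} → P → T (does (em {P}))
      T-does {P} p with em {P}
      ... | yes _ = tt
      ... | no ¬p = ¬p p
      does-T : ∀ {P} → T (does (em {P})) → P
      does-T {P} t with em {P}
      ... | yes p = p

      graph⇒Σ : ∀ xs → Graph f xs → ∃-prefix 2 (λ v → does (em {Σ-matrix v})) xs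
      graph⇒Σ (x ∷ y ∷ []) refl = let s , eq = converges l (x ∷ []) in
        s , λ t → T-does (eq t)
      Σ⇒graph : ∀ xs → ∃-prefix 2 (λ v → does (em {Σ-matrix v})) xs → Graph f xs
      Σ⇒graph (x ∷ y ∷ []) (t , h) = let s , eq = converges l (x ∷ []) in
        trans (sym (eq (s ⊔ t) (m≤m⊔n s t)))
              (does-T {Σ-matrix (t ∷ s ⊔ t ∷ x ∷ y ∷ [])} (h (s ⊔ t)) (m≤n⊔m s t))
      graph⇒Π : ∀ xs → Graph f xs → ∀-prefix 2 (λ v → does (em {Π-matrix v})) xs
      graph⇒Π (x ∷ y ∷ []) refl t = let s , eq = converges l (x ∷ []) in
        s ⊔ t , T-does (m≤n⊔m s t , eq (s ⊔ t) (m≤m⊔n s t))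
      Π⇒graph : ∀ xs → ∀-prefix 2 (λ v → does (em {Π-matrix v})) xs → Graph f xs
      Π⇒graph (x ∷ y ∷ []) h =
        let t , eq = converges l (x ∷ [])
            s , q = h t
            t≤s , φ≡y = does-T {Π-matrix (t ∷ s ∷ x ∷ y ∷ [])} q
        in trans (sym (eq s t≤s)) φ≡y

  -- Orbits of injection structures

  infix 4 _∼[_]_
  _∼[_]_ : ℕ → UnaryStructure → ℕ → Set
  x ∼[ f ] y = ∃[ a ] ∃[ b ] fold x f a ≡ fold y f b

  Periodic : UnaryStructure → ℕ → ℕ → Set
  Periodic f x k = fold x f (suc k) ≡ x × (∀ j → j < k → fold x f (suc j) ≢ x)

  Infinite : UnaryStructure → ℕ → Set
  Infinite f x = ∀ k → fold x f (suc k) ≢ x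

  Initial : UnaryStructure → ℕ → Set
  Initial f y = ∀ z → f z ≢ y

  Omega : UnaryStructure → ℕ → Set
  Omega f x = ∃[ y ] (Initial f y × ∃[ n ] fold y f n ≡ x)

  -- Type 0 is a ℤ-orbit, type 1 an ω-orbit and type 2 + k a cycle of length
  -- 1 + k.
  HasType : UnaryStructure → ℕ → ℕ → Set
  HasType f x 0             = Infinite f x × ¬ Omega f x
  HasType f x 1             = Omega f x
  HasType f x (suc (suc k)) = Periodic f x k

  -- An injection on the orbits of type `τ`, given on elements. The map is unrelated to the
  -- structure and may send one orbit to several: reflecting equivalence is enough to compare
  -- numbers of orbits.
  record Embedding (A B : UnaryStructure) (τ : ℕ) : Set where
    field
      map      : ℕ → ℕ
      hasType  : ∀ x → HasType A x τ → HasType B (map x) τ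
      reflects : ∀ x y → HasType A x τ → HasType A y τ → map x ∼[ B ] map y → x ∼[ A ] y

  record InfinitelyMany (f : UnaryStructure) (τ : ℕ) : Set where
    field
      element  : ℕ → ℕ
      hasType  : ∀ n → HasType f (element n) τ
      distinct : ∀ m n → element m ∼[ f ] element n → m ≡ n

  infinitelyMany⇒embedding : ∀ {A B τ} → InfinitelyMany B τ → Embedding A B τ
  infinitelyMany⇒embedding {A} many = record
    { map      = element
    ; hasType  = λ x _ → hasType x
    ; reflects = λ x y _ _ r → subst (x ∼[ A ]_) (distinct x y r) (0 , 0 , refl)
    } where open InfinitelyMany many

  fold-comm : ∀ {f : ℕ → ℕ} {x} m n → fold (fold x f m) f n ≡ fold (fold x f n) f m
  fold-comm {f} {x} m n =
    trans (sym (fold-+ x f n)) (trans (cong (fold x f) (+-comm n m)) (fold-+ x f m))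

  fold-suc : ∀ (f : ℕ → ℕ) x n → fold (f x) f n ≡ f (fold x f n)
  fold-suc f x n = fold-comm {f} {x} 1 n

  module Orbits (f : UnaryStructure) (f-injective : InjectionStructure f) where

    fold-injective : ∀ n {x y} → fold x f n ≡ fold y f n → x ≡ y
    fold-injective zero    eq = eq
    fold-injective (suc n) eq = fold-injective n (f-injective eq)

    fold-cancel : ∀ m {n x y} → fold x f (m + n) ≡ fold y f m → fold x f n ≡ y
    fold-cancel m {n} {x} eq = fold-injective m (trans (sym (fold-+ x f m)) eq)

    ∼-refl : ∀ {x} → x ∼[ f ] x
    ∼-refl = 0 , 0 , refl

    ∼-sym : ∀ {x y} → x ∼[ f ] y → y ∼[ f ] x
    ∼-sym (a , b , eq) = b , a , sym eq

    ∼-trans : ∀ {x y z} → x ∼[ f ] y → y ∼[ f ] z → x ∼[ f ] z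
    ∼-trans {x} {y} {z} (a , b , p) (c , d , q) = c + a , b + d , (begin
      fold x f (c + a)          ≡⟨ fold-+ x f c ⟩
      fold (fold x f a) f c     ≡⟨ cong (λ u → fold u f c) p ⟩
      fold (fold y f b) f c     ≡⟨ fold-comm b c ⟩
      fold (fold y f c) f b     ≡⟨ cong (λ u → fold u f b) q ⟩
      fold (fold z f d) f b     ≡⟨ fold-+ z f b ⟨
      fold z f (b + d)          ∎)
      where open ≡-Reasoning

    ∼-step : ∀ {x} → x ∼[ f ] f x
    ∼-step = 1 , 0 , refl

    ∼-fold : ∀ {x} n → x ∼[ f ] fold x f n
    ∼-fold n = n , 0 , refl

    invariant : {P : ℕ → Set} → (∀ x → P x → P (f x)) → (∀ x → P (f x) → P x) →
                ∀ {x y} → x ∼[ f ] y → P x → P y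
    invariant {P} forward backward {x} {y} (a , b , eq) p = back b (subst P eq (forth a))
      where
      forth : ∀ n → P (fold x f n)
      forth zero    = p
      forth (suc n) = forward _ (forth n)
      back : ∀ n → P (fold y f n) → P y
      back zero    q = q
      back (suc n) q = back n (backward _ q)

    fixed-invariant : ∀ n {x y} → x ∼[ f ] y → fold x f n ≡ x → fold y f n ≡ y
    fixed-invariant n = invariant {λ x → fold x f n ≡ x}
      (λ x eq → trans (fold-suc f x n) (cong f eq))
      (λ x eq → f-injective (trans (sym (fold-suc f x n)) eq))

    infinite-invariant : ∀ {x y} → x ∼[ f ] y → Infinite f x → Infinite f y
    infinite-invariant x∼y inf k eq = inf k (fixed-invariant (suc k) (∼-sym x∼y) eq)

    omega-invariant : ∀ {x y} → x ∼[ f ] y → Omega f x → Omega f y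
    omega-invariant = invariant {Omega f}
      (λ { x (y , init , n , eq) → y , init , suc n , cong f eq })
      (λ { x (y , init , zero  , eq) → contradiction (sym eq) (init x)
         ; x (y , init , suc n , eq) → y , init , n , f-injective eq })

    periodic-invariant : ∀ {x y k} → x ∼[ f ] y → Periodic f x k → Periodic f y k
    periodic-invariant {k = k} x∼y (eq , minimal) = fixed-invariant (suc k) x∼y eq ,
      λ j j<k eq′ → minimal j j<k (fixed-invariant (suc j) (∼-sym x∼y) eq′)

    type-invariant : ∀ τ {x y} → x ∼[ f ] y → HasType f x τ → HasType f y τ
    type-invariant 0 x∼y (inf , ¬ω)   = infinite-invariant x∼y inf , ¬ω ∘ omega-invariant (∼-sym x∼y)
    type-invariant 1 x∼y ω            = omega-invariant x∼y ω
    type-invariant (suc (suc k)) x∼y  = periodic-invariant x∼y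

    omega⇒infinite : ∀ {x} → Omega f x → Infinite f x
    omega⇒infinite (y , init , n , eq) k eq′ =
      init _ (fixed-invariant (suc k) (∼-sym (n , 0 , eq)) eq′)

    periodic⇒¬infinite : ∀ {x k} → Periodic f x k → ¬ Infinite f x
    periodic⇒¬infinite {k = k} (eq , _) inf = inf k eq

    period-unique : ∀ {x k l} → Periodic f x k → Periodic f x l → k ≡ l
    period-unique {k = k} {l} (p , minₖ) (q , minₗ) with <-cmp k l
    ... | tri< k<l _ _ = contradiction p (minₗ k k<l)
    ... | tri≈ _ k≡l _ = k≡l
    ... | tri> _ _ l<k = contradiction q (minₖ l l<k)

    type-unique : ∀ σ τ {x} → HasType f x σ → HasType f x τ → σ ≡ τ
    type-unique 0 0 _ _ = refl
    type-unique 0 1 (_ , ¬ω) ω = contradiction ω ¬ω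
    type-unique 1 0 ω (_ , ¬ω) = contradiction ω ¬ω
    type-unique 1 1 _ _ = refl
    type-unique 0 (suc (suc k)) (inf , _) p = contradiction inf (periodic⇒¬infinite p)
    type-unique (suc (suc k)) 0 p (inf , _) = contradiction inf (periodic⇒¬infinite p)
    type-unique 1 (suc (suc k)) ω p = contradiction (omega⇒infinite ω) (periodic⇒¬infinite p)
    type-unique (suc (suc k)) 1 p ω = contradiction (omega⇒infinite ω) (periodic⇒¬infinite p)
    type-unique (suc (suc k)) (suc (suc l)) p q = cong (λ k → suc (suc k)) (period-unique p q)

    opaque
      hasSomeType : ∀ x → ∃[ τ ] HasType f x τ
      hasSomeType x with em {Omega f x}
      ... | yes ω = 1 , ω
      ... | no ¬ω with em {Infinite f x}
      ...   | yes inf = 0 , inf , ¬ω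
      ...   | no ¬inf = let k , eq , minimal = least (map₂ byContradiction (¬∀⇒∃¬ ¬inf)) in
                        suc (suc k) , eq , minimal

    type : ℕ → ℕ
    type x = proj₁ (hasSomeType x)

    type-correct : ∀ x → HasType f x (type x)
    type-correct x = proj₂ (hasSomeType x)

    type≡ : ∀ {x τ} → HasType f x τ → type x ≡ τ
    type≡ {x} {τ} p = type-unique (type x) τ (type-correct x) p

    type-∼ : ∀ {x y} → x ∼[ f ] y → type x ≡ type y
    type-∼ {x} {y} x∼y = sym (type≡ (type-invariant (type x) x∼y (type-correct x)))

    -- An isomorphism must preserve the initial point of an ω-orbit, so positions are measured from
    -- there; in other orbits every point may be the origin, and the least one is chosen.
    Representative : ℕ → Set
    Representative r = (Omega f r → Initial f r) × (¬ Omega f r → ∀ s → s < r → ¬ s ∼[ f ] r)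

    initial-unique : ∀ {r s} → Initial f r → Initial f s → r ∼[ f ] s → r ≡ s
    initial-unique {r} {s} r-init s-init (a , b , eq) = go a b eq
      where
      go : ∀ a b → fold r f a ≡ fold s f b → r ≡ s
      go zero    zero    eq = eq
      go zero    (suc b) eq = contradiction (sym eq) (r-init _)
      go (suc a) zero    eq = contradiction eq (s-init _)
      go (suc a) (suc b) eq = go a b (f-injective eq)

    representative-unique : ∀ {r s} → Representative r → Representative s → r ∼[ f ] s → r ≡ s
    representative-unique {r} {s} (init-r , least-r) (init-s , least-s) r∼s with em {Omega f r}
    ... | yes ω = initial-unique (init-r ω) (init-s (omega-invariant r∼s ω)) r∼s
    ... | no ¬ω with <-cmp r s
    ...   | tri< r<s _ _ = contradiction r∼s (least-s (¬ω ∘ omega-invariant (∼-sym r∼s)) r r<s)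
    ...   | tri≈ _ r≡s _ = r≡s
    ...   | tri> _ _ s<r = contradiction (∼-sym r∼s) (least-r ¬ω s s<r)

    opaque
      hasRepresentative : ∀ x → ∃[ r ] (Representative r × r ∼[ f ] x)
      hasRepresentative x with em {Omega f x}
      ... | yes ω@(y , init , n , eq) = y ,
        ((λ _ → init) , λ ¬ω → contradiction (omega-invariant (∼-sym (n , 0 , eq)) ω) ¬ω) , (n , 0 , eq)
      ... | no ¬ω = let r , r∼x , minimal = least (x , ∼-refl) in r ,
        ((λ ω → contradiction (omega-invariant r∼x ω) ¬ω) ,
         λ _ s s<r s∼r → minimal s s<r (∼-trans s∼r r∼x)) , r∼x

    rep : ℕ → ℕ
    rep x = proj₁ (hasRepresentative x)

    rep-representative : ∀ x → Representative (rep x)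
    rep-representative x = proj₁ (proj₂ (hasRepresentative x))

    rep-∼ : ∀ x → rep x ∼[ f ] x
    rep-∼ x = proj₂ (proj₂ (hasRepresentative x))

    rep-cong : ∀ {x y} → x ∼[ f ] y → rep x ≡ rep y
    rep-cong {x} {y} x∼y = representative-unique (rep-representative x) (rep-representative y)
      (∼-trans (rep-∼ x) (∼-trans x∼y (∼-sym (rep-∼ y))))

    rep≡ : ∀ {r x} → Representative r → r ∼[ f ] x → rep x ≡ r
    rep≡ {r} {x} r-rep r∼x = representative-unique (rep-representative x) r-rep (∼-trans (rep-∼ x) (∼-sym r∼x))

    rep-reflects : ∀ {x y} → rep x ≡ rep y → x ∼[ f ] y
    rep-reflects {x} {y} eq = ∼-trans (∼-sym (rep-∼ x)) (subst (_∼[ f ] y) (sym eq) (rep-∼ y))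

    type-rep : ∀ x → type (rep x) ≡ type x
    type-rep x = type-∼ (rep-∼ x)

    RepresentativeOfType : ℕ → ℕ → Set
    RepresentativeOfType τ r = Representative r × type r ≡ τ

    index : ℕ → ℕ
    index x = count (RepresentativeOfType (type x)) (rep x)

    index-∼ : ∀ {x y} → x ∼[ f ] y → index x ≡ index y
    index-∼ x∼y = cong₂ (λ τ r → count (RepresentativeOfType τ) r) (type-∼ x∼y) (rep-cong x∼y)

    index-injective : ∀ {x y} → type x ≡ type y → index x ≡ index y → rep x ≡ rep y
    index-injective {x} {y} τ≡ i≡ = count-injective {RepresentativeOfType (type x)}
      (rep-representative x , type-rep x) (rep-representative y , trans (type-rep y) (sym τ≡))
      (trans i≡ (cong (λ τ → count (RepresentativeOfType τ) (rep y)) (sym τ≡)))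

    -- Taking predecessors can only stop at an initial point, which would make the orbit an ω-orbit.
    non-omega-ancestor : ∀ {x} → ¬ Omega f x → ∀ n → ∃[ y ] fold y f n ≡ x
    non-omega-ancestor {x} ¬ω zero    = x , refl
    non-omega-ancestor {x} ¬ω (suc n) =
      let y , eq   = non-omega-ancestor ¬ω n
          z , ¬fz≢y = ¬∀⇒∃¬ (λ init → ¬ω (y , init , n , eq))
      in  z , trans (sym (fold-suc f z n)) (trans (cong (λ u → fold u f n) (byContradiction ¬fz≢y)) eq)

  -- Matching orbits and the classification of injection structures

  module _ {A B : UnaryStructure} (A-injective : InjectionStructure A) (B-injective : InjectionStructure B) where
    private
      module A = Orbits A A-injective
      module B = Orbits B B-injective

    -- In an infinite orbit no positive iterate fixes a point. On a cycle the period is subtracted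
    -- from `n` until `0` remains; a positive remainder below the period would contradict its
    -- minimality.
    fixed-transfer : ∀ τ {x y} → HasType A x τ → HasType B y τ → ∀ n → fold x A n ≡ x → fold y B n ≡ y
    fixed-transfer τ p q zero _ = refl
    fixed-transfer 0 p q (suc n) eq = contradiction eq (proj₁ p n)
    fixed-transfer 1 p q (suc n) eq = contradiction eq (A.omega⇒infinite p n)
    fixed-transfer (suc (suc k)) {x} {y} p@(eqx , minimal) q@(eqy , _) = <-rec _ λ n rec eq → go n rec eq
      where
      go : ∀ n → (∀ {m} → m < n → fold x A m ≡ x → fold y B m ≡ y) → fold x A n ≡ x → fold y B n ≡ y
      go zero    _   _ = refl
      go (suc n) rec eq with k ≤? n
      ... | no k≰n = contradiction eq (minimal n (≰⇒> k≰n))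
      ... | yes k≤n = trans (cong (fold y B) (sym n∸k)) (trans (fold-+ y B (n ∸ k))
            (trans (cong (λ u → fold u B (n ∸ k)) eqy)
                   (rec (s≤s (m∸n≤m n k)) (trans (cong (λ u → fold u A (n ∸ k)) (sym eqx))
                     (trans (sym (fold-+ x A (n ∸ k))) (trans (cong (fold x A) n∸k) eq))))))
        where
        n∸k : n ∸ k + suc k ≡ suc n
        n∸k = trans (+-suc (n ∸ k) k) (cong suc (m∸n+n≡m k≤n))

    fold-transfer : ∀ τ {x y} → HasType A x τ → HasType B y τ →
                    ∀ m n → fold x A m ≡ fold x A n → fold y B m ≡ fold y B n
    fold-transfer τ {x} {y} p q m n eq with ≤-total m n
    ... | inj₁ m≤n = sym (go m n m≤n (sym eq))
      where
      go : ∀ m n → m ≤ n → fold x A n ≡ fold x A m → fold y B n ≡ fold y B m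
      go m n m≤n eq = trans (cong (fold y B) (sym (m+[n∸m]≡n m≤n))) (trans (fold-+ y B m)
        (cong (λ u → fold u B m) (fixed-transfer τ p q (n ∸ m)
          (A.fold-cancel m (trans (cong (fold x A) (m+[n∸m]≡n m≤n)) eq)))))
    ... | inj₂ n≤m = trans (cong (fold y B) (sym (m+[n∸m]≡n n≤m))) (trans (fold-+ y B n)
        (cong (λ u → fold u B n) (fixed-transfer τ p q (m ∸ n)
          (A.fold-cancel n (trans (cong (fold x A) (m+[n∸m]≡n n≤m)) eq)))))

    -- The pair a, b replaces the integer position of x and y in their orbits.
    Corresponds : ℕ → ℕ → ℕ → ℕ → Set
    Corresponds a b x y = A.type x ≡ B.type y × A.index x ≡ B.index y ×
                          fold (A.rep x) A a ≡ fold x A b × fold (B.rep y) B a ≡ fold y B b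

    Match : ℕ → ℕ → Set
    Match x y = ∃[ a ] ∃[ b ] Corresponds a b x y

    private
      rep-types : ∀ {x y} → A.type x ≡ B.type y →
                  HasType A (A.rep x) (A.type x) × HasType B (B.rep y) (A.type x)
      rep-types {x} {y} τ≡ = subst (HasType A (A.rep x)) (A.type-rep x) (A.type-correct (A.rep x)) ,
        subst (HasType B (B.rep y)) (trans (B.type-rep y) (sym τ≡)) (B.type-correct (B.rep y))

    -- The pair locating `x` relative to its representative is unique only up to a common shift and,
    -- on a cycle, up to the period. Two such pairs give a coincidence between iterates of
    -- `A.rep x`, which `fold-transfer` carries over to `B.rep y`.
    match-any : ∀ {x y c d} → Match x y → fold (A.rep x) A c ≡ fold x A d → Corresponds c d x y
    match-any {x} {y} {c} {d} (a , b , τ≡ , i≡ , p , q) p′ = τ≡ , i≡ , p′ ,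
      B.fold-injective b (begin
        fold (fold r′ B c) B b ≡⟨ fold-+ r′ B b ⟨
        fold r′ B (b + c)      ≡⟨ fold-transfer (A.type x) (proj₁ types) (proj₂ types) (b + c) (d + a) (begin
          fold r A (b + c)         ≡⟨ fold-+ r A b ⟩
          fold (fold r A c) A b    ≡⟨ cong (λ u → fold u A b) p′ ⟩
          fold (fold x A d) A b    ≡⟨ fold-comm d b ⟩
          fold (fold x A b) A d    ≡⟨ cong (λ u → fold u A d) p ⟨
          fold (fold r A a) A d    ≡⟨ fold-+ r A d ⟨
          fold r A (d + a)         ∎) ⟩
        fold r′ B (d + a)      ≡⟨ fold-+ r′ B d ⟩
        fold (fold r′ B a) B d ≡⟨ cong (λ u → fold u B d) q ⟩
        fold (fold y B b) B d  ≡⟨ fold-comm b d ⟩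
        fold (fold y B d) B b  ∎)
      where
      open ≡-Reasoning
      r  = A.rep x
      r′ = B.rep y
      types = rep-types {x} {y} τ≡

    match-functional : ∀ {x y y′} → Match x y → Match x y′ → y ≡ y′
    match-functional {x} {y} {y′} (a , b , τ≡ , i≡ , p , q) m =
      let τ≡′ , i≡′ , _ , q′ = match-any {c = a} {d = b} m p in
      B.fold-injective b (trans (sym q) (trans
        (cong (λ r → fold r B a) (B.index-injective (trans (sym τ≡) τ≡′) (trans (sym i≡) i≡′))) q′))

    match-step : ∀ {x y} → Match x y → Match (A x) (B y)
    match-step {x} {y} (a , b , τ≡ , i≡ , p , q) = suc a , b ,
      trans (sym (A.type-∼ A.∼-step)) (trans τ≡ (B.type-∼ B.∼-step)) ,
      trans (sym (A.index-∼ A.∼-step)) (trans i≡ (B.index-∼ B.∼-step)) ,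
      trans (cong (λ r → A (fold r A a)) (sym (A.rep-cong A.∼-step))) (trans (cong A p) (sym (fold-suc A x b))) ,
      trans (cong (λ r → B (fold r B a)) (sym (B.rep-cong B.∼-step))) (trans (cong B q) (sym (fold-suc B y b)))

    -- Up to and including `A.rep x` there are `suc (A.index x)` representatives of this type. The
    -- embedding injects them into the representatives of `B`, so `B` has enough of them to reach
    -- this index.
    match-representative : ∀ x → Embedding A B (A.type x) →
      ∃[ s ] (B.Representative s × B.type s ≡ A.type x × B.index s ≡ A.index x)
    match-representative x emb =
      let s , (s-rep , τ≡) , c≡ = count-attained {B.RepresentativeOfType τ} (A.index x) bound
            (≤-trans (count-< {A.RepresentativeOfType τ} {A.rep x} {suc (A.rep x)} ≤-refl
                (A.rep-representative x , A.type-rep x))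
              (count-embedding (λ r → B.rep (map r)) (suc (A.rep x))
                (λ i i<m (i-rep , τi) → (B.rep-representative _ ,
                   trans (B.type-rep (map i)) (B.type≡ (hasType i (typed τi)))) , below i i<m)
                (λ i k _ _ (i-rep , τi) (k-rep , τk) eq → A.representative-unique i-rep k-rep
                   (reflects i k (typed τi) (typed τk) (B.rep-reflects eq)))))
      in s , s-rep , τ≡ , trans (cong₂ (λ τ r → count (B.RepresentativeOfType τ) r) τ≡ (B.rep≡ s-rep B.∼-refl)) c≡
      where
      open Embedding emb
      τ = A.type x
      bound = proj₁ (image-bound (λ r → B.rep (map r)) (suc (A.rep x)))
      below = proj₂ (image-bound (λ r → B.rep (map r)) (suc (A.rep x)))
      typed : ∀ {i} → A.type i ≡ τ → HasType A i τ
      typed {i} eq = subst (HasType A i) eq (A.type-correct i)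

    opaque
      match-total : (∀ τ → Embedding A B τ) → ∀ x → ∃[ y ] Match x y
      match-total embed x =
        let s , s-rep , τ≡ , i≡ = match-representative x (embed (A.type x))
            a , b , eq = A.rep-∼ x
        in locate s s-rep τ≡ i≡ a b eq (≤-<-connex b a)
        where
        locate : ∀ s → B.Representative s → B.type s ≡ A.type x → B.index s ≡ A.index x →
                 ∀ a b → fold (A.rep x) A a ≡ fold x A b → b ≤ a ⊎ a < b → ∃[ y ] Match x y
        locate s s-rep τ≡ i≡ a b eq (inj₁ b≤a) = fold s B (a ∸ b) , a ∸ b , 0 ,
            trans (sym τ≡) (B.type-∼ (B.∼-fold (a ∸ b))) ,
            trans (sym i≡) (B.index-∼ (B.∼-fold (a ∸ b))) ,
            A.fold-cancel b (trans (cong (fold (A.rep x) A) (m+[n∸m]≡n b≤a)) eq) ,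
            cong (λ r → fold r B (a ∸ b)) (B.rep≡ s-rep (B.∼-fold (a ∸ b)))
        -- Here `x` comes strictly before its representative, which is therefore not initial. So
        -- neither orbit is an ω-orbit, and `s` has ancestors of every order.
        locate s s-rep τ≡ i≡ a b eq (inj₂ a<b) = y , 0 , suc n ,
            trans (sym τ≡) (B.type-∼ s∼y) , trans (sym i≡) (B.index-∼ s∼y) , x→r ,
            trans (B.rep≡ s-rep s∼y) (sym y→s)
          where
          n : ℕ
          n = pred (b ∸ a)
          b≡ : a + suc n ≡ b
          b≡ = trans (+-suc a n) (trans (cong (λ k → suc (a + k)) (pred[m∸n]≡m∸[1+n] b a)) (m+[n∸m]≡n a<b))
          x→r : A.rep x ≡ fold x A (suc n)
          x→r = sym (A.fold-cancel a (trans (cong (fold x A) b≡) (sym eq)))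
          ¬Ωr : ¬ Omega A (A.rep x)
          ¬Ωr ω = proj₁ (A.rep-representative x) ω _ (sym x→r)
          ¬Ωs : ¬ Omega B s
          ¬Ωs ω = ¬Ωr (subst (HasType A (A.rep x)) (trans (A.type-rep x) (trans (sym τ≡) (B.type≡ {τ = 1} ω)))
                             (A.type-correct (A.rep x)))
          y : ℕ
          y = proj₁ (B.non-omega-ancestor ¬Ωs (suc n))
          y→s : fold y B (suc n) ≡ s
          y→s = proj₂ (B.non-omega-ancestor ¬Ωs (suc n))
          s∼y : s ∼[ B ] y
          s∼y = 0 , suc n , sym y→s

  module _ {A B : UnaryStructure} {A-injective : InjectionStructure A} {B-injective : InjectionStructure B} where

    match-sym : ∀ {x y} → Match A-injective B-injective x y → Match B-injective A-injective y x
    match-sym (a , b , τ≡ , i≡ , p , q) = a , b , sym τ≡ , sym i≡ , q , p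

  module _ {A B : UnaryStructure} (A-injective : InjectionStructure A) (B-injective : InjectionStructure B)
           (A→B : ∀ τ → Embedding A B τ) (B→A : ∀ τ → Embedding B A τ) where

    -- The two families of embeddings may be unrelated, but `Match` is functional in both
    -- directions, so the maps obtained from them are inverse to each other.
    classification : A ≅ B
    classification = record
      { bijection = mk↔ₛ′ (λ x → proj₁ (forth x)) (λ y → proj₁ (back y))
          (λ y → match-functional A-injective B-injective (proj₂ (forth _)) (match-sym {A = B} (proj₂ (back y))))
          (λ x → match-functional B-injective A-injective (proj₂ (back _)) (match-sym {A = A} (proj₂ (forth x))))
      ; homo = λ x → match-functional A-injective B-injective (proj₂ (forth (A x)))
          (match-step A-injective B-injective (proj₂ (forth x)))
      }
      where
      forth = match-total A-injective B-injective A→B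
      back  = match-total B-injective A-injective B→A

    classification-match : ∀ x → Match A-injective B-injective x (to classification x)
    classification-match x = proj₂ (match-total A-injective B-injective A→B x)

  -- Transport along isomorphisms

  module Transport {A B : UnaryStructure} (θ : A ≅ B) where
    from∘to : ∀ x → from θ (to θ x) ≡ x
    from∘to = Inverse.strictlyInverseʳ (_≅_.bijection θ)

    to∘from : ∀ y → to θ (from θ y) ≡ y
    to∘from = Inverse.strictlyInverseˡ (_≅_.bijection θ)

    to-injective : ∀ {x y} → to θ x ≡ to θ y → x ≡ y
    to-injective eq = trans (sym (from∘to _)) (trans (cong (from θ) eq) (from∘to _))

    to-fold : ∀ n x → to θ (fold x A n) ≡ fold (to θ x) B n
    to-fold zero    x = refl
    to-fold (suc n) x = trans (_≅_.homo θ (fold x A n)) (cong B (to-fold n x))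

    ∼-reflects : ∀ {x y} → to θ x ∼[ B ] to θ y → x ∼[ A ] y
    ∼-reflects {x} {y} (a , b , eq) = a , b , to-injective (trans (to-fold a x) (trans eq (sym (to-fold b y))))

    ∼-preserves : ∀ {x y} → x ∼[ A ] y → to θ x ∼[ B ] to θ y
    ∼-preserves {x} {y} (a , b , eq) = a , b , trans (sym (to-fold a x)) (trans (cong (to θ) eq) (to-fold b y))

    infinite-preserves : ∀ {x} → Infinite A x → Infinite B (to θ x)
    infinite-preserves inf k eq = inf k (to-injective (trans (to-fold (suc k) _) eq))

  ≅-sym : ∀ {A B} → A ≅ B → B ≅ A
  ≅-sym {A} {B} θ = record
    { bijection = mk↔ₛ′ (from θ) (to θ) from∘to to∘from
    ; homo = λ y → to-injective (trans (to∘from _) (sym (trans (_≅_.homo θ _) (cong B (to∘from y)))))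
    }
    where open Transport θ

  ≅-trans : ∀ {A B C} → A ≅ B → B ≅ C → A ≅ C
  ≅-trans {A} {B} {C} θ η = record
    { bijection = mk↔ₛ′ (to η ∘ to θ) (from θ ∘ from η)
        (λ z → trans (cong (to η) (T.to∘from _)) (E.to∘from z))
        (λ x → trans (cong (from θ) (E.from∘to _)) (T.from∘to x))
    ; homo = λ x → trans (cong (to η) (_≅_.homo θ x)) (_≅_.homo η _)
    }
    where module T = Transport θ
          module E = Transport η

  ≅-injective : ∀ {A B} → A ≅ B → InjectionStructure A → InjectionStructure B
  ≅-injective {A} {B} θ A-injective {x} {y} eq = to-injective (A-injective
    (trans (sym (homo x)) (trans (cong (from θ) eq) (homo y))))
    where open Transport (≅-sym θ)
          open _≅_ (≅-sym θ) using (homo)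

  omega-preserves : ∀ {A B} (θ : A ≅ B) {x} → Omega A x → Omega B (to θ x)
  omega-preserves {A} {B} θ {x} (y , init , n , eq) = to θ y ,
    (λ z eq′ → init (from θ z) (trans (sym (Transport.from∘to θ _)) (trans (cong (from θ)
       (trans (_≅_.homo θ _) (trans (cong B (Transport.to∘from θ z)) eq′))) (Transport.from∘to θ y)))) ,
    n , trans (sym (Transport.to-fold θ n y)) (cong (to θ) eq)

  type-preserves : ∀ {A B} (θ : A ≅ B) τ {x} → HasType A x τ → HasType B (to θ x) τ
  type-preserves {A} {B} θ 0 {x} (inf , ¬ω) = infinite-preserves inf ,
    λ ω → ¬ω (subst (Omega A) (from∘to x) (omega-preserves (≅-sym θ) ω))
    where open Transport θ
  type-preserves θ 1 ω = omega-preserves θ ω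
  type-preserves {B = B} θ (suc (suc k)) {x} (eq , minimal) =
    trans (sym (to-fold (suc k) x)) (cong (to θ) eq) ,
    λ j j<k eq′ → minimal j j<k (to-injective (trans (to-fold (suc j) x) eq′))
    where open Transport θ

  ≅⇒embedding : ∀ {A B} → A ≅ B → ∀ τ → Embedding A B τ
  ≅⇒embedding θ τ = record
    { map      = to θ
    ; hasType  = λ x → type-preserves θ τ {x}
    ; reflects = λ x y _ _ → Transport.∼-reflects θ {x} {y}
    }

  -- Punctual structures and atomic diagrams under an oracle

  mutual
    lift : ∀ {os n} → PR [] n → PR os n
    lift zer         = zer
    lift suc         = suc
    lift (proj i)    = proj i
    lift (comp f gs) = comp (lift f) (lift* gs)
    lift (prec f g)  = prec (lift f) (lift g)

    lift* : ∀ {os m n} → Vec (PR [] n) m → Vec (PR os n) m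
    lift* []       = []
    lift* (g ∷ gs) = lift g ∷ lift* gs

  module _ {os} (X : Oracle os) where
    mutual
      eval-lift : ∀ {n} (Ψ : PR [] n) xs → eval X (lift Ψ) xs ≡ eval [] Ψ xs
      eval-lift zer         _            = refl
      eval-lift suc         (x ∷ [])     = refl
      eval-lift (proj i)    xs           = refl
      eval-lift (comp f gs) xs           = trans (eval-lift f _) (cong (eval [] f) (eval-lift* gs xs))
      eval-lift (prec f g)  (zero  ∷ xs) = eval-lift f xs
      eval-lift (prec f g)  (suc n ∷ xs) = trans (eval-lift g _)
        (cong (λ r → eval [] g (n ∷ r ∷ xs)) (eval-lift (prec f g) (n ∷ xs)))

      eval-lift* : ∀ {m n} (Ψs : Vec (PR [] n) m) xs → eval* X (lift* Ψs) xs ≡ eval* [] Ψs xs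
      eval-lift* []       xs = refl
      eval-lift* (Ψ ∷ Ψs) xs = cong₂ _∷_ (eval-lift Ψ xs) (eval-lift* Ψs xs)

    punctual⇒isPR : ∀ {f} → Punctual f → PRClosed.Closed₁ (isPR-closed X) f
    punctual⇒isPR (Ψ , Ψ≡f) = isPR (lift Ψ) λ { (x ∷ []) → trans (eval-lift Ψ (x ∷ [])) (Ψ≡f x) }

  DiagramHolds : UnaryStructure → Vec ℕ 4 → Set
  DiagramHolds f v = fold (head (tail v)) f (head v) ≡ fold (head (tail (tail (tail v)))) f (head (tail (tail v)))

  diagram≡χ : ∀ f v → All-lookup (atomicDiagram f) (here refl) v ≡ χ (DiagramHolds f v)
  diagram≡χ f (i ∷ a ∷ j ∷ b ∷ []) = χ-≡ᵇ (fold a f i) (fold b f j)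
    where
    χ-≡ᵇ : ∀ m n → (if m ≡ᵇ n then 1 else 0) ≡ χ (m ≡ n)
    χ-≡ᵇ m n with m ≡ᵇ n in eq
    ... | true  = sym (ite-yes (≡ᵇ⇒≡ m n (subst T (sym eq) tt)))
    ... | false = sym (ite-no (λ m≡n → subst T eq (≡⇒≡ᵇ m n m≡n)))

  punctual⇒diagram-decides : ∀ {os} (X : Oracle os) {f} → Punctual f →
                             PRClosed.Decides (isPR-closed X) (DiagramHolds f)
  punctual⇒diagram-decides X p = ≡-decides (fold-closed f-PR var1 var0) (fold-closed f-PR var3 var2)
    where
    open PRClosed (isPR-closed X)
    f-PR = punctual⇒isPR X p

  -- Orbit types and Δ⁰₂-categoricity

  BoundedlyMany : UnaryStructure → ℕ → Set
  BoundedlyMany f τ = ∃[ m ] ∀ x → HasType f x τ → ∃[ y ] (y < m × HasType f y τ × y ∼[ f ] x)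

  module _ {f : UnaryStructure} (f-injective : InjectionStructure f) (τ : ℕ) where
    open Orbits f f-injective

    private
      New : ℕ → ℕ → Set
      New m x = HasType f x τ × (∀ y → y < m → HasType f y τ → ¬ y ∼[ f ] x)

    alwaysNew⇒infinitelyMany : (∀ m → ∃[ x ] New m x) → InfinitelyMany f τ
    alwaysNew⇒infinitelyMany new = record
      { element  = λ n → elt (bound n)
      ; hasType  = λ n → proj₁ (elt-new (bound n))
      ; distinct = distinct
      }
      where
      elt : ℕ → ℕ
      elt m = proj₁ (new m)
      elt-new : ∀ m → New m (elt m)
      elt-new m = proj₂ (new m)
      bound : ℕ → ℕ
      bound zero    = 0
      bound (suc n) = suc (elt (bound n)) ⊔ bound n
      below : ∀ {m n} → m < n → elt (bound m) < bound n
      below {m} {suc n} m<1+n with m<1+n⇒m<n∨m≡n m<1+n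
      ... | inj₁ m<n  = ≤-trans (below m<n) (m≤n⊔m (suc (elt (bound n))) (bound n))
      ... | inj₂ refl = m≤m⊔n (suc (elt (bound n))) (bound n)
      later : ∀ {m n} → m < n → ¬ elt (bound m) ∼[ f ] elt (bound n)
      later {m} {n} m<n = proj₂ (elt-new (bound n)) _ (below m<n) (proj₁ (elt-new (bound m)))
      distinct : ∀ m n → elt (bound m) ∼[ f ] elt (bound n) → m ≡ n
      distinct m n r with <-cmp m n
      ... | tri< m<n _ _ = contradiction r (later m<n)
      ... | tri≈ _ m≡n _ = m≡n
      ... | tri> _ _ n<m = contradiction (∼-sym r) (later n<m)

    infinitelyMany-or-boundedlyMany : InfinitelyMany f τ ⊎ BoundedlyMany f τ
    infinitelyMany-or-boundedlyMany with em {∀ m → ∃[ x ] New m x}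
    ... | yes new = inj₁ (alwaysNew⇒infinitelyMany new)
    ... | no ¬new = let m , ¬∃ = ¬∀⇒∃¬ ¬new in inj₂ (m , λ x p →
      byContradiction λ ¬y → ¬∃ (x , p , λ y y<m q y∼x → ¬y (y , y<m , q , y∼x)))

  boundedlyMany-transport : ∀ {A B} → A ≅ B → ∀ τ → BoundedlyMany A τ → BoundedlyMany B τ
  boundedlyMany-transport {A} {B} θ τ (m , covers) = let b , below = image-bound (to θ) m in b , λ x p →
      let y , y<m , q , y∼ = covers (from θ x) (type-preserves (≅-sym θ) τ p)
      in  to θ y , below y y<m , type-preserves θ τ q ,
          subst (to θ y ∼[ B ]_) (to∘from x) (∼-preserves y∼)
    where
    open Transport θ

  module LimitOrbits {os} {X : Oracle os} {f : UnaryStructure} (f-injective : InjectionStructure f)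
    (diagram : PRClosed.Decides (isPR-closed X) {4} (DiagramHolds f)) where

    open Orbits f f-injective
    private
      module P = PRClosed (isPR-closed X)
      module Pair = Pairing (isPR-closed X)
    open PRClosed (limit-closed {X = X})

    fold≡-decides : ∀ {n} {F G H K : Vec ℕ n → ℕ} → IsPR X F → IsPR X G → IsPR X H → IsPR X K →
                    P.Decides (λ xs → fold (G xs) f (F xs) ≡ fold (K xs) f (H xs))
    fold≡-decides F G H K = P.comp-closed diagram (F P.∷-closed G P.∷-closed H P.∷-closed K P.∷-closed P.[]-closed)

    -- The oracle only answers equations. The value `f x` is found by searching through all `y`,
    -- without a bound, which a limit computation can do.
    f-limit : Closed₁ f
    f-limit = minimum-limit {P = λ y v → f (head v) ≡ y}
      (PR⇒Limit (fold≡-decides (P.const-closed 1) P.var1 (P.const-closed 0) P.var0))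
      (λ _ → refl) (λ v i i<fx eq → <⇒≢ i<fx (sym eq))

    fold-limit : ∀ {n} {F G : Vec ℕ n → ℕ} → Limit X F → Limit X G → Limit X (λ xs → fold (F xs) f (G xs))
    fold-limit = fold-closed f-limit

    initial-limit : Decides₁ (Initial f)
    initial-limit = Decides-⇔ {P = λ v → ¬ (∃[ z ] f z ≡ head v)}
      (λ v h z eq → h (z , eq)) (λ v h (z , eq) → h z eq)
      (¬-decides (∃-limit {P = λ z v → f z ≡ head v}
        (fold≡-decides (P.const-closed 1) P.var0 (P.const-closed 0) P.var1)))

    infinite-limit : Decides₁ (Infinite f)
    infinite-limit = Decides-⇔ {P = λ v → ¬ (∃[ k ] fold (head v) f (suc k) ≡ head v)}
      (λ v h k eq → h (k , eq)) (λ v h (k , eq) → h k eq)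
      (¬-decides (∃-limit {P = λ k v → fold (head v) f (suc k) ≡ head v}
        (fold≡-decides (P.suc-closed P.var0) P.var1 (P.const-closed 0) P.var1)))

    ∼-limit : Decides₂ (_∼[ f ]_)
    ∼-limit = Decides-⇔
      {P = λ v → ∃[ c ] fold (head v) f (fst c) ≡ fold (head (tail v)) f (snd c)}
      (λ v (c , eq) → fst c , snd c , eq)
      (λ v (a , b , eq) → ⟪ a , b ⟫ , trans (cong (fold (head v) f) (fst-⟪⟫ a b))
         (trans eq (cong (fold (head (tail v)) f) (sym (snd-⟪⟫ a b)))))
      (∃-limit {P = λ c v → fold (head v) f (fst c) ≡ fold (head (tail v)) f (snd c)}
        (fold≡-decides (Pair.fst-closed P.var0) P.var1 (Pair.snd-closed P.var0) P.var2))

    periodic-limit : Decides₂ (Periodic f)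
    periodic-limit = ×-decides (≡-decides (fold-limit var0 (suc-closed var1)) var0)
      (∀<-decides {P = λ j v → fold (head v) f (suc j) ≢ head v}
        (¬-decides (≡-decides (fold-limit var1 (suc-closed var0)) var1)) var1)

    -- The finitely many representatives in the bound are hard-wired into the
    -- program, so nothing has to be computed about them.
    boundedlyMany⇒limit : ∀ {τ} → BoundedlyMany f τ → Decides₁ (λ x → HasType f x τ)
    boundedlyMany⇒limit {τ} (m , covers) = Decides-⇔ {P = λ v → Covered m (head v)}
      (λ v (y , _ , p , y∼x) → type-invariant τ y∼x p) (λ v → covers (head v)) (covered m)
      where
      Covered : ℕ → ℕ → Set
      Covered m x = ∃[ y ] (y < m × HasType f y τ × y ∼[ f ] x)
      covered : ∀ m → Decides₁ (Covered m)
      covered zero    = Decides-⇔ {P = λ _ → 1 ≡ 0} (λ _ ()) (λ _ ()) (≡-decides (const-closed 1) (const-closed 0))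
      covered (suc m) with em {HasType f m τ}
      ... | yes p = Decides-⇔ {P = λ v → Covered m (head v) ⊎ m ∼[ f ] head v}
            (λ v → [ (λ (y , y<m , q) → y , m<n⇒m<1+n y<m , q) , (λ r → m , ≤-refl , p , r) ]′)
            (λ v (y , y<1+m , q , r) →
               [ (λ y<m → inj₁ (y , y<m , q , r)) , (λ { refl → inj₂ r }) ]′ (m<1+n⇒m<n∨m≡n y<1+m))
            (⊎-decides (covered m) (dec₂ (_∼[ f ]_) ∼-limit (const-closed m) var0))
      ... | no ¬p = Decides-⇔ {P = λ v → Covered m (head v)}
            (λ v (y , y<m , q) → y , m<n⇒m<1+n y<m , q)
            (λ v (y , y<1+m , q , r) →
               [ (λ y<m → y , y<m , q , r) , (λ { refl → contradiction q ¬p }) ]′ (m<1+n⇒m<n∨m≡n y<1+m))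
            (covered m)

    -- Infinite orbits are ω-orbits or ℤ-orbits, and infinity of the orbit is Π⁰₁ in the diagram,
    -- hence limit decidable.
    ℤ-limit⇒omega-limit : Decides₁ (λ x → HasType f x 0) → Decides₁ (Omega f)
    ℤ-limit⇒omega-limit z = Decides-⇔ {P = λ v → Infinite f (head v) × ¬ HasType f (head v) 0}
      (λ v (inf , ¬z) → byContradiction λ ¬ω → ¬z (inf , ¬ω))
      (λ v ω → omega⇒infinite ω , λ (_ , ¬ω) → ¬ω ω)
      (×-decides infinite-limit (¬-decides z))

    module _ (omega-limit : Decides₁ (Omega f)) where

      hasType-limit : Decides₂ (λ τ x → HasType f x τ)
      hasType-limit = Decides-⇔ {P = λ v → Cases (head v) (head (tail v))}
        (λ v → cases⇒ (head v)) (λ v → ⇒cases (head v))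
        (⊎-decides (×-decides (≡-decides var0 (const-closed 0))
                              (×-decides (dec₁ (Infinite f) infinite-limit var1)
                                         (¬-decides (dec₁ (Omega f) omega-limit var1))))
        (⊎-decides (×-decides (≡-decides var0 (const-closed 1)) (dec₁ (Omega f) omega-limit var1))
                   (×-decides (≤-decides (const-closed 2) var0)
                              (dec₂ (Periodic f) periodic-limit var1 (∸-closed var0 (const-closed 2))))))
        where
        Cases : ℕ → ℕ → Set
        Cases τ x = (τ ≡ 0 × HasType f x 0) ⊎ (τ ≡ 1 × Omega f x) ⊎ (2 ≤ τ × Periodic f x (τ ∸ 2))
        cases⇒ : ∀ τ {x} → Cases τ x → HasType f x τ
        cases⇒ τ (inj₁ (refl , p))        = p
        cases⇒ τ (inj₂ (inj₁ (refl , p))) = p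
        cases⇒ (suc (suc k)) (inj₂ (inj₂ (_ , p))) = p
        cases⇒ 1 (inj₂ (inj₂ (s≤s () , _)))
        ⇒cases : ∀ τ {x} → HasType f x τ → Cases τ x
        ⇒cases 0 p             = inj₁ (refl , p)
        ⇒cases 1 p             = inj₂ (inj₁ (refl , p))
        ⇒cases (suc (suc k)) p = inj₂ (inj₂ (s≤s (s≤s z≤n) , p))

      type-limit : Closed₁ type
      type-limit = minimum-limit {P = λ τ v → HasType f (head v) τ} hasType-limit
        (λ v → type-correct (head v)) (λ v τ τ<type p → <⇒≢ τ<type (sym (type≡ p)))

      representative-limit : Decides₁ Representative
      representative-limit = ×-decides (→-decides omega-limit initial-limit)
        (→-decides (¬-decides omega-limit)
          (∀<-decides {P = λ s v → ¬ s ∼[ f ] head v} (¬-decides ∼-limit) var0))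

      rep-limit : Closed₁ rep
      rep-limit = minimum-limit {P = λ r v → Representative r × r ∼[ f ] head v}
        (×-decides (dec₁ Representative representative-limit var0) ∼-limit)
        (λ v → rep-representative (head v) , rep-∼ (head v))
        (λ v r r<rep (r-rep , r∼x) → <⇒≢ r<rep (sym (rep≡ r-rep r∼x)))

      index-limit : Closed₁ index
      index-limit = count-closed {P = λ r v → RepresentativeOfType (type (head v)) r}
        (×-decides (dec₁ Representative representative-limit var0)
                   (≡-decides (app₁ type type-limit var0) (app₁ type type-limit var1)))
        rep-limit

  module _ {os} {X : Oracle os} {A B : UnaryStructure}
    (A-injective : InjectionStructure A) (B-injective : InjectionStructure B)
    (A-diagram : PRClosed.Decides (isPR-closed X) {4} (DiagramHolds A))
    (B-diagram : PRClosed.Decides (isPR-closed X) {4} (DiagramHolds B))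
    (A-omega : PRClosed.Decides₁ (limit-closed {X = X}) (Omega A))
    (B-omega : PRClosed.Decides₁ (limit-closed {X = X}) (Omega B))
    where
    private
      module A = Orbits A A-injective
      module B = Orbits B B-injective
      module LA = LimitOrbits {X = X} A-injective A-diagram
      module LB = LimitOrbits {X = X} B-injective B-diagram
    open PRClosed (limit-closed {X = X})
    open Pairing (limit-closed {X = X})

    private
      Offset : ℕ → ℕ → Set
      Offset x c = fold (A.rep x) A (fst c) ≡ fold x A (snd c)

      hasOffset : ∀ x → ∃[ c ] Offset x c
      hasOffset x = let a , b , eq = A.rep-∼ x in ⟪ a , b ⟫ ,
        trans (cong (fold (A.rep x) A) (fst-⟪⟫ a b)) (trans eq (cong (fold x A) (sym (snd-⟪⟫ a b))))

      offset : ℕ → ℕ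
      offset x = proj₁ (least (hasOffset x))

      offset-limit : Closed₁ offset
      offset-limit = minimum-limit {P = λ c v → Offset (head v) c}
        (≡-decides (LA.fold-limit (app₁ A.rep (LA.rep-limit A-omega) var1) (fst-closed var0))
                   (LA.fold-limit var1 (snd-closed var0)))
        (λ v → proj₁ (proj₂ (least (hasOffset (head v)))))
        (λ v → proj₂ (proj₂ (least (hasOffset (head v)))))

    -- Asking for some common position would put an unbounded quantifier before a limit decidable
    -- condition. Instead the least position `offset x` is computed in `A` alone; by `match-any` it
    -- also serves for the image, so that a single search for `y` remains.
    classification-limit : (A→B : ∀ τ → Embedding A B τ) (B→A : ∀ τ → Embedding B A τ) →
                           Closed₁ (to (classification A-injective B-injective A→B B→A))
    classification-limit A→B B→A = minimum-limit
      {P = λ y v → Corresponds A-injective B-injective (fst (offset (head v))) (snd (offset (head v))) (head v) y}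
      (×-decides (≡-decides (app₁ A.type (LA.type-limit A-omega) var1) (app₁ B.type (LB.type-limit B-omega) var0))
      (×-decides (≡-decides (app₁ A.index (LA.index-limit A-omega) var1) (app₁ B.index (LB.index-limit B-omega) var0))
      (×-decides (≡-decides (LA.fold-limit (app₁ A.rep (LA.rep-limit A-omega) var1) a) (LA.fold-limit var1 b))
                 (≡-decides (LB.fold-limit (app₁ B.rep (LB.rep-limit B-omega) var0) a) (LB.fold-limit var0 b)))))
      (λ v → match-any A-injective B-injective {c = fst (offset (head v))} {d = snd (offset (head v))}
         (classification-match A-injective B-injective A→B B→A (head v))
         (proj₁ (proj₂ (least (hasOffset (head v))))))
      (λ v y y<h corr → <⇒≢ y<h (match-functional A-injective B-injective {head v}
         (fst (offset (head v)) , snd (offset (head v)) , corr)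
         (classification-match A-injective B-injective A→B B→A (head v))))
      where
      a = fst-closed (app₁ offset offset-limit (var1 {0}))
      b = snd-closed (app₁ offset offset-limit (var1 {0}))

  module _ {A : UnaryStructure} (A-punctual : Punctual A) (A-injective : InjectionStructure A) where

    -- The diagram of `B` is the oracle, that of the punctual `A` is primitive recursive in any
    -- oracle, and boundedness passes from `A` to `B` along `θ`.
    boundedlyMany⇒Δ⁰₂-categorical : ∀ τ → τ ≡ 0 ⊎ τ ≡ 1 → BoundedlyMany A τ → RelativelyΔ⁰-categorical 2 A
    boundedlyMany⇒Δ⁰₂-categorical τ τ≤1 bounded B θ =
      classification A-injective B-injective (≅⇒embedding θ) (≅⇒embedding (≅-sym θ)) ,
      limit⇒Δ⁰₂ (classification-limit A-injective B-injective A-diagram B-diagram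
        (omega A-injective A-diagram bounded)
        (omega B-injective B-diagram (boundedlyMany-transport θ τ bounded))
        (≅⇒embedding θ) (≅⇒embedding (≅-sym θ)))
      where
      X = atomicDiagram B
      B-injective : InjectionStructure B
      B-injective = ≅-injective θ A-injective
      open PRClosed (isPR-closed X)
      A-diagram : Decides {4} (DiagramHolds A)
      A-diagram = punctual⇒diagram-decides X A-punctual
      B-diagram : Decides {4} (DiagramHolds B)
      B-diagram = ext (diagram≡χ B) (oracle-PR (here refl))
      omega : ∀ {f} (f-injective : InjectionStructure f) →
        Decides {4} (DiagramHolds f) →
        BoundedlyMany f τ → PRClosed.Decides₁ (limit-closed {X = X}) (Omega f)
      omega f-injective diagram bounded = [
          (λ { refl → ℤ-limit⇒omega-limit (boundedlyMany⇒limit {0} bounded) }) ,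
          (λ { refl → boundedlyMany⇒limit {1} bounded }) ]′ τ≤1
        where open LimitOrbits {X = X} f-injective diagram

    ¬Δ⁰₂-categorical⇒infinitelyMany : ¬ RelativelyΔ⁰-categorical 2 A → ∀ τ → τ ≡ 0 ⊎ τ ≡ 1 → InfinitelyMany A τ
    ¬Δ⁰₂-categorical⇒infinitelyMany ¬cat τ τ≤1 with infinitelyMany-or-boundedlyMany A-injective τ
    ... | inj₁ many    = many
    ... | inj₂ bounded = contradiction (boundedlyMany⇒Δ⁰₂-categorical τ τ≤1 bounded) ¬cat

  -- Δ⁰₃ isomorphisms to punctual copies

  module _ {os : List ℕ} {X : Oracle os} (σ : ∀ {n} → n ∈ os → Rec [] n)
           (σ-converges : ∀ {n} (i : n ∈ os) xs → Converges [] (σ i) xs (All-lookup X i xs)) where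
    mutual
      substRec : ∀ {n} → Rec os n → Rec [] n
      substRec zer         = zer
      substRec suc         = suc
      substRec (proj i)    = proj i
      substRec (orac i)    = σ i
      substRec (comp f gs) = comp (substRec f) (substRec* gs)
      substRec (prec f g)  = prec (substRec f) (substRec g)
      substRec (mu f)      = mu (substRec f)

      substRec* : ∀ {m n} → Vec (Rec os n) m → Vec (Rec [] n) m
      substRec* []       = []
      substRec* (g ∷ gs) = substRec g ∷ substRec* gs

    mutual
      substRec-converges : ∀ {n} {e : Rec os n} {xs z} → Converges X e xs z → Converges [] (substRec e) xs z
      substRec-converges zer           = zer
      substRec-converges suc           = suc
      substRec-converges proj          = proj
      substRec-converges (orac {i = i}) = σ-converges i _
      substRec-converges (comp cs c)   = comp (substRec*-converges cs) (substRec-converges c)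
      substRec-converges (prec₀ c)     = prec₀ (substRec-converges c)
      substRec-converges (precₛ c d)   = precₛ (substRec-converges c) (substRec-converges d)
      substRec-converges (mu c below)  = mu (substRec-converges c)
        λ z z<y → let k , d = below z z<y in k , substRec-converges d

      substRec*-converges : ∀ {m n} {es : Vec (Rec os n) m} {xs ys} →
                            Converges* X es xs ys → Converges* [] (substRec* es) xs ys
      substRec*-converges []       = []
      substRec*-converges (c ∷ cs) = substRec-converges c ∷ substRec*-converges cs

    computable-substitute : ∀ {k} {R : Vec ℕ k → Bool} → ComputableRel X R → ComputableRel [] R
    computable-substitute (e , c) = substRec e , λ xs → substRec-converges (c xs)

    Δ⁰-substitute : ∀ {n k} {P : Vec ℕ k → Set} → Δ⁰ n X P → Δ⁰ n [] P
    Δ⁰-substitute ((R , c , R⇔) , (S , d , S⇔)) =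
      (R , computable-substitute c , R⇔) , (S , computable-substitute d , S⇔)

  -- The diagram of a punctual structure is computable, so a program for it replaces the oracle
  -- calls.
  punctual-Δ⁰ : ∀ {B n k} {P : Vec ℕ k → Set} → Punctual B → Δ⁰ n (atomicDiagram B) P → Δ⁰ n [] P
  punctual-Δ⁰ {B} p = Δ⁰-substitute
    (λ { (here refl) → toRec [] (program diagram) })
    (λ { (here refl) xs → subst (Converges [] _ xs) (trans (correct diagram xs) (sym (diagram≡χ B xs)))
                                 (toRec-converges [] (program diagram) xs) })
    where diagram = punctual⇒diagram-decides [] p

  Δ⁰₃-swap : ∀ {f g} → (∀ x y → f x ≡ y → g y ≡ x) → (∀ x y → g y ≡ x → f x ≡ y) →
             Δ⁰-function 3 [] f → Δ⁰-function 3 [] g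
  Δ⁰₃-swap {f} {g} f⇒g g⇒f ((R , c , R⇔) , (S , d , S⇔)) =
      (swap R , swap-computable c , λ { (x ∷ y ∷ []) →
        mk⇔ (λ eq → Equivalence.to (R⇔ (y ∷ x ∷ [])) (g⇒f y x eq))
            (λ h → f⇒g y x (Equivalence.from (R⇔ (y ∷ x ∷ [])) h)) })
    , (swap S , swap-computable d , λ { (x ∷ y ∷ []) →
        mk⇔ (λ eq → Equivalence.to (S⇔ (y ∷ x ∷ [])) (g⇒f y x eq))
            (λ h → f⇒g y x (Equivalence.from (S⇔ (y ∷ x ∷ [])) h)) })
    where
    swap : (Vec ℕ 5 → Bool) → Vec ℕ 5 → Bool
    swap R (a ∷ b ∷ c ∷ x ∷ y ∷ []) = R (a ∷ b ∷ c ∷ y ∷ x ∷ [])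
    swap-computable : ∀ {R} → ComputableRel [] R → ComputableRel [] (swap R)
    swap-computable (e , c) =
      comp e (proj zero ∷ proj (suc zero) ∷ proj (suc (suc zero)) ∷
              proj (suc (suc (suc (suc zero)))) ∷ proj (suc (suc (suc zero))) ∷ []) ,
      λ { xs@(_ ∷ _ ∷ _ ∷ _ ∷ _ ∷ []) → comp (proj ∷ proj ∷ proj ∷ proj ∷ proj ∷ []) (c _) }

  cone⊆PRCatSpec : ∀ A → RelativelyΔ⁰-categorical 3 A → ∀ {d} → ConeΔ⁰ 3 d → PRCatSpec A d
  cone⊆PRCatSpec A categorical cone B B-punctual A≅B =
    let h , Δ-to = categorical B A≅B
        Δ-to₀ = punctual-Δ⁰ {n = 3} B-punctual Δ-to
        open Transport h
    in  h , cone (to h) Δ-to₀ , cone (from h) (Δ⁰₃-swap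
          (λ x y eq → trans (cong (from h) (sym eq)) (from∘to x))
          (λ x y eq → trans (cong (to h) (sym eq)) (to∘from y)) Δ-to₀)

  -- Step-bounded evaluation of partial recursive functions

  -- A partial result is 0 when undefined and suc z when its value is z.
  bind : ℕ → (ℕ → ℕ) → ℕ
  bind r k = natrec 0 (λ y _ → k y) r

  mutual
    -- run e t is e with every unbounded search cut off at t.
    run : ∀ {n} → Rec [] n → ℕ → Vec ℕ n → ℕ
    run zer         t xs       = 1
    run suc         t xs       = suc (suc (head xs))
    run (proj i)    t xs       = suc (lookup xs i)
    run (comp f gs) t xs       = bind* gs t xs (run f t (values gs t xs))
    run (prec f g)  t xs       =
      natrec (run f t (tail xs)) (λ k r → bind r (λ y → run g t (k ∷ y ∷ tail xs))) (head xs)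
    run (mu f)      t xs       = let y = search f t xs in ite (run f t (y ∷ xs) ≡ 1) (suc y) 0

    -- `1 < run f t (i ∷ xs)` says that a nonzero value has been found. The search stops at the
    -- first `i` with value zero or undefined, or at `t`; `run` then accepts only the code `1` of
    -- the value zero.
    search : ∀ {n} → Rec [] (suc n) → ℕ → Vec ℕ n → ℕ
    search f t xs = count (λ j → ∀ i → i < suc j → 1 < run f t (i ∷ xs)) t

    -- An undefined argument becomes `0` here; `bind*` discards the result in that case.
    values : ∀ {m n} → Vec (Rec [] n) m → ℕ → Vec ℕ n → Vec ℕ m
    values []       t xs = []
    values (g ∷ gs) t xs = pred (run g t xs) ∷ values gs t xs

    bind* : ∀ {m n} → Vec (Rec [] n) m → ℕ → Vec ℕ n → ℕ → ℕ
    bind* []       t xs k = k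
    bind* (g ∷ gs) t xs k = bind (run g t xs) (λ _ → bind* gs t xs k)

  module _ where
    open PRClosed (isPR-closed [])

    mutual
      run-PR : ∀ {n} (e : Rec [] n) → IsPR [] (λ v → run e (head v) (tail v))
      run-PR zer         = const-closed 1
      run-PR suc         = suc-closed (suc-closed var1)
      run-PR (proj i)    = suc-closed (component (tail-closed id-closed) i)
      run-PR (comp f gs) = bind*-PR gs (comp-closed (run-PR f) (var0 ∷-closed values-PR gs))
      run-PR (prec f g)  = natrec-closed
        (comp-closed (run-PR f) (var0 ∷-closed tail-closed (tail-closed id-closed)))
        (natrec-closed zero-closed (comp-closed (run-PR g) (var4 ∷-closed var2 ∷-closed var0 ∷-closed
           tail-closed (tail-closed (tail-closed (tail-closed (tail-closed (tail-closed id-closed))))))) var1)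
        var1
      run-PR (mu f)      = ite-closed
        (≡-decides (comp-closed (run-PR f) (var0 ∷-closed search-PR f ∷-closed tail-closed id-closed)) (const-closed 1))
        (suc-closed (search-PR f)) zero-closed

      search-PR : ∀ {n} (f : Rec [] (suc n)) → IsPR [] (λ v → search f (head v) (tail v))
      search-PR f = count-closed {P = λ j v → ∀ i → i < suc j → 1 < run f (head v) (i ∷ tail v)}
        (∀<-decides {P = λ i v → 1 < run f (head (tail v)) (i ∷ tail (tail v))}
          (<-decides (const-closed 1) (comp-closed (run-PR f)
            (var2 ∷-closed var0 ∷-closed tail-closed (tail-closed (tail-closed id-closed)))))
          (suc-closed var0))
        var0

      values-PR : ∀ {m n} (gs : Vec (Rec [] n) m) → Componentwise (IsPR []) (λ v → values gs (head v) (tail v))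
      values-PR []       = []-closed
      values-PR (g ∷ gs) = pred-closed (run-PR g) ∷-closed values-PR gs

      bind*-PR : ∀ {m n} (gs : Vec (Rec [] n) m) {K : Vec ℕ (suc n) → ℕ} → IsPR [] K →
                 IsPR [] (λ v → bind* gs (head v) (tail v) (K v))
      bind*-PR []       k = k
      bind*-PR (g ∷ gs) k = natrec-closed zero-closed (weaken (weaken (bind*-PR gs k))) (run-PR g)

  mutual
    run-complete : ∀ {n} {e : Rec [] n} {xs z} → Converges [] e xs z → Eventually (λ t → run e t xs ≡ suc z)
    run-complete zer  = 0 , λ _ _ → refl
    run-complete suc  = 0 , λ _ _ → refl
    run-complete proj = 0 , λ _ _ → refl
    run-complete (comp {f = f} {gs = gs} {xs = xs} {z = z} cs c) = Eventually-map
      (λ t (vs , fz) → trans (proj₂ vs (run f t (values gs t xs))) (trans (cong (run f t) (proj₁ vs)) fz))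
      (Eventually-× (run*-complete cs) (run-complete c))
    run-complete (prec₀ c) = run-complete c
    run-complete (precₛ {g = g} {k = k} {xs = xs} c d) = Eventually-map
      (λ t (r , s) → trans (cong (λ r → bind r (λ y → run g t (k ∷ y ∷ xs))) r) s)
      (Eventually-× (run-complete c) (run-complete d))
    run-complete (mu {f = f} {xs = xs} {y = y} c below) = Eventually-map
      (λ t (y≤t , fy , fz) →
        let y≡ = count-initial {λ j → ∀ i → i < suc j → 1 < run f t (i ∷ xs)} {y}
                   (λ j<y i i≤j → fz i (≤-trans i≤j j<y))
                   (λ {j} h → ≰⇒> λ y≤j → <⇒≢ (h y (s≤s y≤j)) (sym fy)) y≤t
        in trans (cong (λ y → ite (run f t (y ∷ xs) ≡ 1) (suc y) 0) y≡) (ite-yes fy))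
      (Eventually-× {Q = λ t → run f t (y ∷ xs) ≡ 1 × ∀ i → i < y → 1 < run f t (i ∷ xs)} (y , λ _ y≤t → y≤t)
        (Eventually-× (run-complete c) (Eventually-∀< y λ i i<y →
          let k , d = below i i<y in
          Eventually-map (λ t eq → subst (1 <_) (sym eq) (s≤s (s≤s z≤n))) (run-complete d))))

    run*-complete : ∀ {m n} {gs : Vec (Rec [] n) m} {xs ys} → Converges* [] gs xs ys →
                    Eventually (λ t → values gs t xs ≡ ys × ∀ k → bind* gs t xs k ≡ k)
    run*-complete []       = 0 , λ _ _ → refl , λ _ → refl
    run*-complete {gs = g ∷ gs} {xs} (c ∷ cs) = Eventually-map
      (λ t (r , vs , ks) → cong₂ _∷_ (cong pred r) vs ,
         λ k → trans (cong (λ r → bind r (λ _ → bind* gs t xs k)) r) (ks k))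
      (Eventually-× (run-complete c) (run*-complete cs))

  bind-cases : ∀ {r k z} → r ≡ 0 ⊎ (∃[ y ] (r ≡ suc y × (k y ≡ 0 ⊎ k y ≡ suc z))) → bind r k ≡ 0 ⊎ bind r k ≡ suc z
  bind-cases (inj₁ refl)           = inj₁ refl
  bind-cases (inj₂ (y , refl , h)) = h

  mutual
    -- Cutting off a search can lose a value but not change it. For `mu`, accepting a number before
    -- `y` would mean a zero where the value is positive, and accepting one after `y` would mean
    -- that the zero at `y` was passed as nonzero.
    run-sound : ∀ {n} {e : Rec [] n} {xs z} → Converges [] e xs z → ∀ t → run e t xs ≡ 0 ⊎ run e t xs ≡ suc z
    run-sound zer  t = inj₂ refl
    run-sound suc  t = inj₂ refl
    run-sound proj t = inj₂ refl
    run-sound (comp {f = f} {gs = gs} {xs = xs} cs c) t with run*-sound cs t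
    ... | inj₁ undef      = inj₁ (undef (run f t (values gs t xs)))
    ... | inj₂ (vs , ks)  = subst (λ r → r ≡ 0 ⊎ r ≡ suc _)
      (sym (trans (ks (run f t (values gs t xs))) (cong (run f t) vs))) (run-sound c t)
    run-sound (prec₀ c) t = run-sound c t
    run-sound (precₛ {g = g} {k = k} {xs = xs} c d) t = bind-cases {k = λ y → run g t (k ∷ y ∷ xs)}
      ([ inj₁ , (λ r → inj₂ (_ , r , run-sound d t)) ]′ (run-sound c t))
    run-sound (mu {f = f} {xs = xs} {y = y} c below) t = found em
      where
      y′ = search f t xs
      found : Dec (run f t (y′ ∷ xs) ≡ 1) → run (mu f) t xs ≡ 0 ⊎ run (mu f) t xs ≡ suc y
      found (no ≢1)  = inj₁ (ite-no ≢1)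
      found (yes ≡1) with <-cmp y′ y
      ... | tri≈ _ eq _  = inj₂ (trans (ite-yes ≡1) (cong suc eq))
      ... | tri< lt _ _ = let k , d = below y′ lt in
            [ (λ ≡0 → contradiction (trans (sym ≡0) ≡1) 0≢1+n)
            , (λ ≡k → contradiction (trans (sym ≡1) ≡k) (λ ())) ]′ (run-sound d t)
      ... | tri> _ _ y<y′ =
            [ (λ ≡0 → contradiction (subst (1 <_) ≡0 1<) (λ ()))
            , (λ ≡k → contradiction (subst (1 <_) ≡k 1<) (λ { (s≤s ()) })) ]′ (run-sound c t)
        where
        1< : 1 < run f t (y ∷ xs)
        1< = let m , passed , y≡ = count-attained {λ j → ∀ i → i < suc j → 1 < run f t (i ∷ xs)} y t y<y′ in
             passed y (s≤s (subst (_≤ m) y≡ (count≤ m)))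
          where
          count≤ : ∀ {P} n → count P n ≤ n
          count≤ zero = z≤n
          count≤ {P} (suc n) with em {P n}
          ... | yes _ = s≤s (count≤ n)
          ... | no _  = m≤n⇒m≤1+n (count≤ n)

    run*-sound : ∀ {m n} {gs : Vec (Rec [] n) m} {xs ys} → Converges* [] gs xs ys → ∀ t →
                 (∀ k → bind* gs t xs k ≡ 0) ⊎ (values gs t xs ≡ ys × ∀ k → bind* gs t xs k ≡ k)
    run*-sound [] t = inj₂ (refl , λ _ → refl)
    run*-sound {gs = g ∷ gs} {xs} (c ∷ cs) t with run-sound c t | run*-sound cs t
    ... | inj₁ ≡0 | _ = inj₁ λ k → cong (λ r → bind r (λ _ → bind* gs t xs k)) ≡0
    ... | inj₂ r  | inj₁ undef = inj₁ λ k → trans (cong (λ r → bind r (λ _ → bind* gs t xs k)) r) (undef k)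
    ... | inj₂ r  | inj₂ (vs , ks) = inj₂ (cong₂ _∷_ (cong pred r) vs ,
          λ k → trans (cong (λ r → bind r (λ _ → bind* gs t xs k)) r) (ks k))

  -- Copies of A with prescribed ℤ-orbits

  -- The copy of A attached to a set E of events: the element ⟪ c , 0 ⟫ is sent to
  -- ⟪ c′ , 0 ⟫ when c is linked to c′ and starts the sequence ⟪ c , 1 ⟫, ⟪ c , 2 ⟫, …
  -- otherwise.  The points c = ⟪ 0 , ⟪ x , k ⟫ ⟫ with x in a cycle of A of length
  -- 1 + k reproduce this cycle, and ⟪ suc s , t ⟫ with E s t is linked to
  -- ⟪ suc s , t′ ⟫ for the last event t′ < t of s.  So the s-th chain has type ℤ
  -- if E s occurs infinitely often, and all other infinite orbits have type ω.

  module Model (A : UnaryStructure) (A-injective : InjectionStructure A) (E : ℕ → ℕ → Set) where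
    private module A = Orbits A A-injective

    opaque
      -- One more than the last event of `s` before `t`, and `0` if there is none.
      last : ℕ → ℕ → ℕ
      last s = natrec 0 (λ t r → ite (E s t) (suc t) r)

      last-≤ : ∀ s t → last s t ≤ t
      last-≤ s zero    = z≤n
      last-≤ s (suc t) with em {E s t}
      ... | yes _ = ≤-refl
      ... | no _  = m≤n⇒m≤1+n (last-≤ s t)

      last-> : ∀ {s u t} → E s u → u < t → u < last s t
      last-> {s} {u} {suc t} e u<1+t with em {E s t} | m<1+n⇒m<n∨m≡n u<1+t
      ... | yes _ | _         = u<1+t
      ... | no _  | inj₁ u<t  = last-> e u<t
      ... | no ¬e | inj₂ refl = contradiction e ¬e

      last-sound : ∀ {s t t′} → last s t ≡ suc t′ → E s t′
      last-sound {s} {suc t} eq with em {E s t}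
      ... | yes e = subst (E s) (cong pred eq) e
      ... | no _  = last-sound {s} {t} eq

      last-closed : ∀ {𝒞 : ∀ {n} → (Vec ℕ n → ℕ) → Set} (closed : PRClosed 𝒞) →
                    PRClosed.Decides₂ closed E → PRClosed.Closed₂ closed last
      last-closed closed e = natrec-closed zero-closed (ite-closed (dec₂ E e var2 var0) (suc-closed var0) var1) var1
        where open PRClosed closed

    last-zero : ∀ {s t u} → last s t ≡ 0 → u < t → ¬ E s u
    last-zero eq u<t e = contradiction (subst (_ <_) eq (last-> e u<t)) λ ()

    last-below : ∀ {s t t′} → last s t ≡ suc t′ → t′ < t
    last-below {s} {t} eq = subst (_≤ t) eq (last-≤ s t)

    last-injective : ∀ {s t u} → E s t → E s u → last s t ≡ last s u → t ≡ u
    last-injective {s} {t} {u} p q eq with <-cmp t u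
    ... | tri< t<u _ _ = contradiction (subst (t <_) (sym eq) (last-> p t<u)) (≤⇒≯ (last-≤ s t))
    ... | tri≈ _ t≡u _ = t≡u
    ... | tri> _ _ u<t = contradiction (subst (u <_) eq (last-> q u<t)) (≤⇒≯ (last-≤ s u))

    private
      -- A link to `c′` is returned as `suc c′`; `0` means that there is no link.
      cycleLink chainLink : ℕ → ℕ → ℕ
      cycleLink x k = ite (Periodic A x k) (suc ⟪ 0 , ⟪ A x , k ⟫ ⟫) 0
      chainLink s t = ite (E s t × 0 < last s t) (suc ⟪ suc s , pred (last s t) ⟫) 0

      linkTo : ℕ → ℕ
      linkTo c = ite (fst c ≡ 0) (cycleLink (fst (snd c)) (snd (snd c))) (chainLink (pred (fst c)) (snd c))

    opaque
      -- New events are put in front of a chain: they link to the preceding event, so images depend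
      -- only on the past and stay primitive recursive, while a last event would be an initial
      -- point. When `⟪ c , 0 ⟫` is linked, the sequence from `⟪ c , 1 ⟫` is cut off and becomes an
      -- ω-orbit of its own.
      model : UnaryStructure
      model e = ite (snd e ≡ 0 × 0 < linkTo (fst e)) ⟪ pred (linkTo (fst e)) , 0 ⟫ ⟪ fst e , suc (snd e) ⟫

      model-closed : ∀ {𝒞 : ∀ {n} → (Vec ℕ n → ℕ) → Set} (closed : PRClosed 𝒞) →
                     PRClosed.Closed₁ closed A → PRClosed.Decides₂ closed E → PRClosed.Closed₁ closed model
      model-closed closed a e = ite-closed
          (×-decides (≡-decides (snd-closed var0) (const-closed 0))
                      (<-decides (const-closed 0) (app₁ linkTo linkTo-closed (fst-closed var0))))
          (pair-closed (pred-closed (app₁ linkTo linkTo-closed (fst-closed var0))) zero-closed)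
          (pair-closed (fst-closed var0) (suc-closed (snd-closed var0)))
        where
        open PRClosed closed
        open Pairing closed
        periodic-decides : Decides₂ (Periodic A)
        periodic-decides = ×-decides (≡-decides (fold-closed {g = A} a var0 (suc-closed var1)) var0)
          (∀<-decides {P = λ j v → fold (head v) A (suc j) ≢ head v}
            (¬-decides (≡-decides (fold-closed {g = A} a var1 (suc-closed var0)) var1)) var1)
        cycleLink-closed : Closed₂ cycleLink
        cycleLink-closed = ite-closed periodic-decides
          (suc-closed (pair-closed zero-closed (pair-closed (app₁ A a var0) var1))) zero-closed
        chainLink-closed : Closed₂ chainLink
        chainLink-closed = ite-closed (×-decides e (<-decides zero-closed (last-closed closed e)))
          (suc-closed (pair-closed (suc-closed var0) (pred-closed (last-closed closed e)))) zero-closed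
        linkTo-closed : Closed₁ linkTo
        linkTo-closed = ite-closed (≡-decides (fst-closed var0) zero-closed)
          (app₂ cycleLink cycleLink-closed (fst-closed (snd-closed var0)) (snd-closed (snd-closed var0)))
          (app₂ chainLink chainLink-closed (pred-closed (fst-closed var0)) (snd-closed var0))

    data Link : ℕ → ℕ → Set where
      cycle : ∀ {x k} → Periodic A x k → Link ⟪ 0 , ⟪ x , k ⟫ ⟫ ⟪ 0 , ⟪ A x , k ⟫ ⟫
      chain : ∀ {s t t′} → E s t → last s t ≡ suc t′ → Link ⟪ suc s , t ⟫ ⟪ suc s , t′ ⟫

    private
      cycleLink≡ : ∀ q → linkTo ⟪ 0 , q ⟫ ≡ cycleLink (fst q) (snd q)
      cycleLink≡ q = trans (ite-yes (fst-⟪⟫ 0 q)) (cong (λ q → cycleLink (fst q) (snd q)) (snd-⟪⟫ 0 q))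

      chainLink≡ : ∀ s t → linkTo ⟪ suc s , t ⟫ ≡ chainLink s t
      chainLink≡ s t = trans (ite-no (λ eq → contradiction (trans (sym eq) (fst-⟪⟫ (suc s) t)) 0≢1+n))
        (cong₂ (λ n t → chainLink (pred n) t) (fst-⟪⟫ (suc s) t) (snd-⟪⟫ (suc s) t))

      link⇒linkTo : ∀ {c c′} → Link c c′ → linkTo c ≡ suc c′
      link⇒linkTo (cycle {x} {k} p) = trans (cycleLink≡ ⟪ x , k ⟫)
        (trans (cong₂ cycleLink (fst-⟪⟫ x k) (snd-⟪⟫ x k)) (ite-yes p))
      link⇒linkTo (chain {s} {t} e eq) = trans (chainLink≡ s t)
        (trans (ite-yes (e , subst (0 <_) (sym eq) (s≤s z≤n))) (cong (λ l → suc ⟪ suc s , pred l ⟫) eq))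

      linkTo-view : ∀ c → linkTo c ≡ 0 ⊎ ∃[ c′ ] Link c c′
      linkTo-view c = subst (λ c → linkTo c ≡ 0 ⊎ ∃[ c′ ] Link c c′) (⟪fst,snd⟫ c) (by-tag (fst c) (snd c))
        where
        cycle-view : ∀ x k → Dec (Periodic A x k) → linkTo ⟪ 0 , ⟪ x , k ⟫ ⟫ ≡ 0 ⊎ ∃[ c′ ] Link ⟪ 0 , ⟪ x , k ⟫ ⟫ c′
        cycle-view x k (yes p) = inj₂ (_ , cycle p)
        cycle-view x k (no ¬p) = inj₁ (trans (cycleLink≡ ⟪ x , k ⟫)
          (trans (cong₂ cycleLink (fst-⟪⟫ x k) (snd-⟪⟫ x k)) (ite-no ¬p)))
        chain-view : ∀ s t → Dec (E s t × 0 < last s t) → linkTo ⟪ suc s , t ⟫ ≡ 0 ⊎ ∃[ c′ ] Link ⟪ suc s , t ⟫ c′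
        chain-view s t (yes (e , 0<last)) = inj₂ (_ , chain {t′ = pred (last s t)} e
          (sym (suc-pred (last s t) {{>-nonZero 0<last}})))
        chain-view s t (no ¬p) = inj₁ (trans (chainLink≡ s t) (ite-no ¬p))
        by-tag : ∀ a b → linkTo ⟪ a , b ⟫ ≡ 0 ⊎ ∃[ c′ ] Link ⟪ a , b ⟫ c′
        by-tag zero b = subst (λ q → linkTo ⟪ 0 , q ⟫ ≡ 0 ⊎ ∃[ c′ ] Link ⟪ 0 , q ⟫ c′) (⟪fst,snd⟫ b)
          (cycle-view (fst b) (snd b) em)
        by-tag (suc s) t = chain-view s t em

    data Element : ℕ → Set where
      linked   : ∀ {c c′} → Link c c′ → Element ⟪ c , 0 ⟫
      unlinked : ∀ {c} → (∀ c′ → ¬ Link c c′) → Element ⟪ c , 0 ⟫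
      beyond   : ∀ c m → Element ⟪ c , suc m ⟫

    element : ∀ e → Element e
    element e = subst Element (⟪fst,snd⟫ e) (view (fst e) (snd e))
      where
      view : ∀ c m → Element ⟪ c , m ⟫
      view c (suc m) = beyond c m
      view c zero with linkTo-view c
      ... | inj₁ ≡0      = unlinked λ c′ l → contradiction (trans (sym ≡0) (link⇒linkTo l)) 0≢1+n
      ... | inj₂ (_ , l) = linked l

    opaque
      unfolding model

      model-linked : ∀ {c c′} → Link c c′ → model ⟪ c , 0 ⟫ ≡ ⟪ c′ , 0 ⟫
      model-linked {c} {c′} l = trans
        (ite-yes (snd-⟪⟫ c 0 , subst (0 <_) (sym eq) (s≤s z≤n)))
        (cong (λ n → ⟪ pred n , 0 ⟫) eq)
        where
        eq : linkTo (fst ⟪ c , 0 ⟫) ≡ suc c′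
        eq = trans (cong linkTo (fst-⟪⟫ c 0)) (link⇒linkTo l)

      model-unlinked : ∀ {c} → (∀ c′ → ¬ Link c c′) → model ⟪ c , 0 ⟫ ≡ ⟪ c , 1 ⟫
      model-unlinked {c} ¬l = trans
        (ite-no (λ (_ , 0<) → contradiction (subst (0 <_) (trans (cong linkTo (fst-⟪⟫ c 0)) linkTo≡0) 0<) λ ()))
        (cong₂ (λ a b → ⟪ a , suc b ⟫) (fst-⟪⟫ c 0) (snd-⟪⟫ c 0))
        where
        linkTo≡0 : linkTo c ≡ 0
        linkTo≡0 = [ id , (λ (c′ , l) → contradiction l (¬l c′)) ]′ (linkTo-view c)

      model-beyond : ∀ c m → model ⟪ c , suc m ⟫ ≡ ⟪ c , suc (suc m) ⟫
      model-beyond c m = trans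
        (ite-no (λ (eq , _) → contradiction (trans (sym eq) (snd-⟪⟫ c (suc m))) 0≢1+n))
        (cong₂ (λ a b → ⟪ a , suc b ⟫) (fst-⟪⟫ c (suc m)) (snd-⟪⟫ c (suc m)))

    link-injective : ∀ {b c b′ c′} → Link b b′ → Link c c′ → b′ ≡ c′ → b ≡ c
    link-injective (cycle {x} {k} p) (cycle {y} {l} q) eq =
      cong₂ (λ x k → ⟪ 0 , ⟪ x , k ⟫ ⟫) (A-injective (⟪⟫-injectiveˡ (⟪⟫-injectiveʳ eq)))
                                     (⟪⟫-injectiveʳ (⟪⟫-injectiveʳ eq))
    link-injective (cycle p) (chain e l) eq = contradiction (⟪⟫-injectiveˡ eq) 0≢1+n
    link-injective (chain e l) (cycle p) eq = contradiction (sym (⟪⟫-injectiveˡ eq)) 0≢1+n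
    link-injective (chain {s} {t} e l) (chain {s′} {u} e′ l′) eq with suc-injective (⟪⟫-injectiveˡ eq)
    ... | refl = cong ⟪ suc s ,_⟫ (last-injective e e′ (trans l (trans (cong suc (⟪⟫-injectiveʳ eq)) (sym l′))))

    -- The second coordinate of the value alone decides which clause of `model` produced it.
    -- Injectivity and the recognition of initial points thus become case distinctions.
    data Predecessor : ℕ → ℕ → ℕ → Set where
      linked   : ∀ {c c′} → Link c c′ → Predecessor ⟪ c , 0 ⟫ c′ 0
      unlinked : ∀ {c} → (∀ c′ → ¬ Link c c′) → Predecessor ⟪ c , 0 ⟫ c 1
      beyond   : ∀ {c m} → Predecessor ⟪ c , suc m ⟫ c (suc (suc m))

    private
      cast : ∀ {e a b c d} → ⟪ a , b ⟫ ≡ ⟪ c , d ⟫ → Predecessor e a b → Predecessor e c d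
      cast {e} eq = subst₂ (Predecessor e) (⟪⟫-injectiveˡ eq) (⟪⟫-injectiveʳ eq)

    predecessor : ∀ {e c m} → model e ≡ ⟪ c , m ⟫ → Predecessor e c m
    predecessor {e} {c} {m} eq with element e
    ... | linked {c₀} {c′} l = cast (trans (sym (model-linked l)) eq) (linked l)
    ... | unlinked ¬l = cast (trans (sym (model-unlinked ¬l)) eq) (unlinked ¬l)
    ... | beyond c₀ m₀ = cast (trans (sym (model-beyond c₀ m₀)) eq) beyond

    predecessor-unique : ∀ {e e′ c m} → Predecessor e c m → Predecessor e′ c m → e ≡ e′
    predecessor-unique (linked l)   (linked l′) = cong ⟪_, 0 ⟫ (link-injective l l′ refl)
    predecessor-unique (unlinked _) (unlinked _) = refl
    predecessor-unique beyond       beyond       = refl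

    model-injective : InjectionStructure model
    model-injective {x} {y} eq = predecessor-unique
      (predecessor (trans eq (sym (⟪fst,snd⟫ (model y))))) (predecessor (sym (⟪fst,snd⟫ (model y))))

    private module M = Orbits model model-injective

    fold-beyond : ∀ c m n → fold ⟪ c , suc m ⟫ model n ≡ ⟪ c , suc (n + m) ⟫
    fold-beyond c m zero    = refl
    fold-beyond c m (suc n) = trans (cong model (fold-beyond c m n)) (model-beyond c (n + m))

    beyond-infinite : ∀ {c m} → Infinite model ⟪ c , suc m ⟫
    beyond-infinite {c} {m} k eq = m≢1+n+m m
      (sym (suc-injective (⟪⟫-injectiveʳ (trans (sym (fold-beyond c m (suc k))) eq))))

    unlinked-infinite : ∀ {c} → (∀ c′ → ¬ Link c c′) → Infinite model ⟪ c , 0 ⟫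
    unlinked-infinite {c} ¬l = M.infinite-invariant (M.∼-sym M.∼-step)
      (subst (Infinite model) (sym (model-unlinked ¬l)) beyond-infinite)

    module _ {s : ℕ} where
      private
        -- Along a chain the event stage falls at links and otherwise `m` grows. This lexicographic
        -- progress excludes a return to the starting point.
        Later : ℕ → ℕ → ℕ → Set
        Later t m e = ∃[ t′ ] ∃[ m′ ] (e ≡ ⟪ ⟪ suc s , t′ ⟫ , m′ ⟫ × (t′ < t ⊎ (t′ ≡ t × m < m′)))

        later-trans : ∀ {t m t′ m′ e} → t′ < t ⊎ (t′ ≡ t × m < m′) → Later t′ m′ e → Later t m e
        later-trans h (u , n , eq , k) = u , n , eq , lex h k
          where
          lex : ∀ {t m t′ m′ u n} → t′ < t ⊎ (t′ ≡ t × m < m′) → u < t′ ⊎ (u ≡ t′ × m′ < n) → u < t ⊎ (u ≡ t × m < n)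
          lex (inj₁ a)          (inj₁ b)          = inj₁ (<-trans b a)
          lex (inj₁ a)          (inj₂ (refl , _)) = inj₁ a
          lex (inj₂ (refl , _)) (inj₁ b)          = inj₁ b
          lex (inj₂ (refl , a)) (inj₂ (refl , b)) = inj₂ (refl , <-trans a b)

        later-step : ∀ {e} t m → e ≡ ⟪ ⟪ suc s , t ⟫ , m ⟫ → Later t m (model e)
        later-step {e} t m eq with element e
        ... | linked (cycle p) = contradiction (⟪⟫-injectiveˡ (⟪⟫-injectiveˡ eq)) 0≢1+n
        ... | linked l@(chain {s′} {u} {t′} e≡ last≡) = t′ , 0 ,
              trans (model-linked l) (cong (λ s → ⟪ ⟪ s , t′ ⟫ , 0 ⟫) (⟪⟫-injectiveˡ (⟪⟫-injectiveˡ eq))) ,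
              inj₁ (subst (t′ <_) (⟪⟫-injectiveʳ (⟪⟫-injectiveˡ eq)) (last-below last≡))
        ... | unlinked ¬l = t , 1 , trans (model-unlinked ¬l) (cong ⟪_, 1 ⟫ (⟪⟫-injectiveˡ eq)) ,
              inj₂ (refl , subst (_< 1) (⟪⟫-injectiveʳ eq) (s≤s z≤n))
        ... | beyond c n = t , suc (suc n) , trans (model-beyond c n) (cong ⟪_, suc (suc n) ⟫ (⟪⟫-injectiveˡ eq)) ,
              inj₂ (refl , subst (_< suc (suc n)) (⟪⟫-injectiveʳ eq) ≤-refl)

        later-fold : ∀ t m n → Later t m (fold ⟪ ⟪ suc s , t ⟫ , m ⟫ model (suc n))
        later-fold t m zero    = later-step t m refl
        later-fold t m (suc n) = let t′ , m′ , eq , h = later-fold t m n in later-trans h (later-step t′ m′ eq)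

      chain-infinite : ∀ {t m} → Infinite model ⟪ ⟪ suc s , t ⟫ , m ⟫
      chain-infinite {t} {m} k eq with later-fold t m k
      ... | t′ , m′ , eq′ , inj₁ t′<t = <⇒≢ t′<t (⟪⟫-injectiveʳ (⟪⟫-injectiveˡ (trans (sym eq′) eq)))
      ... | t′ , m′ , eq′ , inj₂ (_ , m<m′) = <⇒≢ m<m′ (⟪⟫-injectiveʳ (trans (sym eq) eq′))

      chain-fold : ∀ t m n → ∃[ t′ ] ∃[ m′ ] fold ⟪ ⟪ suc s , t ⟫ , m ⟫ model n ≡ ⟪ ⟪ suc s , t′ ⟫ , m′ ⟫
      chain-fold t m zero    = t , m , refl
      chain-fold t m (suc n) = let t′ , m′ , eq , _ = later-fold t m n in t′ , m′ , eq

    onCycle : ℕ → ℕ → ℕ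
    onCycle x k = ⟪ ⟪ 0 , ⟪ x , k ⟫ ⟫ , 0 ⟫

    onCycle-injective : ∀ {x y k l} → onCycle x k ≡ onCycle y l → x ≡ y
    onCycle-injective eq = ⟪⟫-injectiveˡ (⟪⟫-injectiveʳ (⟪⟫-injectiveˡ eq))

    fold-onCycle : ∀ {x k} → Periodic A x k → ∀ n → fold (onCycle x k) model n ≡ onCycle (fold x A n) k
    fold-onCycle p zero    = refl
    fold-onCycle p (suc n) = trans (cong model (fold-onCycle p n))
      (model-linked (cycle (A.periodic-invariant (A.∼-fold n) p)))

    onCycle-periodic : ∀ {x k} → Periodic A x k → Periodic model (onCycle x k) k
    onCycle-periodic {x} {k} p@(eq , minimal) = trans (fold-onCycle p (suc k)) (cong (λ x → onCycle x k) eq) ,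
      λ j j<k eq′ → minimal j j<k (onCycle-injective (trans (sym (fold-onCycle p (suc j))) eq′))

    onCycle-reflects : ∀ {x y k l} → Periodic A x k → Periodic A y l →
                       onCycle x k ∼[ model ] onCycle y l → x ∼[ A ] y
    onCycle-reflects p q (a , b , eq) =
      a , b , onCycle-injective (trans (sym (fold-onCycle p a)) (trans eq (fold-onCycle q b)))

    periodic⇒onCycle : ∀ {e k} → Periodic model e k → ∃[ x ] (e ≡ onCycle x k × Periodic A x k)
    periodic⇒onCycle {e} {k} p with element e
    ... | unlinked ¬l          = contradiction (unlinked-infinite ¬l) (M.periodic⇒¬infinite p)
    ... | beyond c m           = contradiction beyond-infinite (M.periodic⇒¬infinite p)
    ... | linked (chain _ _)   = contradiction chain-infinite (M.periodic⇒¬infinite p)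
    ... | linked (cycle {x} q) with M.period-unique (onCycle-periodic q) p
    ...   | refl = x , refl , q

    A→model-cycles : ∀ k → Embedding A model (suc (suc k))
    A→model-cycles k = record
      { map      = λ x → onCycle x k
      ; hasType  = λ x → onCycle-periodic
      ; reflects = λ x y → onCycle-reflects
      }

    model→A-cycles : ∀ k → Embedding model A (suc (suc k))
    model→A-cycles k = record
      { map      = λ e → fst (snd (fst e))
      ; hasType  = λ e p → let x , eq , q = periodic⇒onCycle p in
          subst (λ x → Periodic A x k) (sym (decode eq)) q
      ; reflects = λ e e′ p p′ r →
          let x , eq , q = periodic⇒onCycle p
              x′ , eq′ , q′ = periodic⇒onCycle p′
              a , b , path = subst₂ (_∼[ A ]_) (decode eq) (decode eq′) r
          in  a , b , (begin
            fold e model a               ≡⟨ cong (λ e → fold e model a) eq ⟩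
            fold (onCycle x k) model a   ≡⟨ fold-onCycle q a ⟩
            onCycle (fold x A a) k       ≡⟨ cong (λ x → onCycle x k) path ⟩
            onCycle (fold x′ A b) k      ≡⟨ fold-onCycle q′ b ⟨
            fold (onCycle x′ k) model b  ≡⟨ cong (λ e → fold e model b) eq′ ⟨
            fold e′ model b              ∎)
      }
      where
      open ≡-Reasoning
      decode : ∀ {e x} → e ≡ onCycle x k → fst (snd (fst e)) ≡ x
      decode {x = x} refl = trans (cong (λ c → fst (snd c)) (fst-⟪⟫ _ 0)) (trans (cong fst (snd-⟪⟫ 0 _)) (fst-⟪⟫ x k))

    -- If `n` is a fixed point of `A`, then `point n` is linked and `⟪ point n , 1 ⟫` is initial.
    -- Otherwise `point n` is neither source nor target of a link, and `⟪ point n , 0 ⟫` is initial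
    -- with successor `⟪ point n , 1 ⟫`. This is independent of `E`.
    infinitelyManyω : InfinitelyMany model 1
    infinitelyManyω = record
      { element  = λ n → ⟪ point n , 1 ⟫
      ; hasType  = λ n → hasType n em
      ; distinct = λ m n (a , b , eq) → ⟪⟫-injectiveˡ (⟪⟫-injectiveʳ (⟪⟫-injectiveˡ
          (trans (sym (fold-beyond (point m) 0 a)) (trans eq (fold-beyond (point n) 0 b)))))
      }
      where
      point : ℕ → ℕ
      point n = ⟪ 0 , ⟪ n , 0 ⟫ ⟫
      ¬linked : ∀ {n} → ¬ Periodic A n 0 → ∀ {c c′} → Link c c′ → c ≢ point n × c′ ≢ point n
      ¬linked ¬p (cycle p) = (λ eq → absurd eq p) , (λ eq → absurd eq (A.periodic-invariant A.∼-step p))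
        where
        absurd : ∀ {x k} → ⟪ 0 , ⟪ x , k ⟫ ⟫ ≡ point _ → ¬ Periodic A x k
        absurd eq p = ¬p (subst₂ (Periodic A) (⟪⟫-injectiveˡ (⟪⟫-injectiveʳ eq)) (⟪⟫-injectiveʳ (⟪⟫-injectiveʳ eq)) p)
      ¬linked ¬p (chain _ _) = (λ eq → contradiction (sym (⟪⟫-injectiveˡ eq)) 0≢1+n) ,
                               (λ eq → contradiction (sym (⟪⟫-injectiveˡ eq)) 0≢1+n)
      hasType : ∀ n → Dec (Periodic A n 0) → Omega model ⟪ point n , 1 ⟫
      hasType n (yes p) = ⟪ point n , 1 ⟫ , (λ z eq → initial (predecessor eq)) , 0 , refl
        where
        initial : ∀ {z} → ¬ Predecessor z (point n) 1
        initial (unlinked ¬l) = ¬l _ (cycle p)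
      hasType n (no ¬p) = ⟪ point n , 0 ⟫ , (λ z eq → initial (predecessor eq)) , 1 ,
                          model-unlinked (λ c′ l → proj₁ (¬linked ¬p l) refl)
        where
        initial : ∀ {z} → ¬ Predecessor z (point n) 0
        initial (linked l) = proj₂ (¬linked ¬p l) refl

    nextEvent : ∀ {s t} → InfinitelyOften (E s) → E s t → ∃[ t′ ] (E s t′ × last s t′ ≡ suc t)
    nextEvent {s} {t} io e =
      let t′ , (t<t′ , e′) , minimal = least (io (suc t)) in t′ , e′ , next t<t′ minimal (last s t′) refl
      where
      next : ∀ {t′} → t < t′ → (∀ u → u < t′ → ¬ (suc t ≤ u × E s u)) → ∀ l → last s t′ ≡ l → last s t′ ≡ suc t
      next t<t′ minimal zero    eq = contradiction e (last-zero eq t<t′)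
      next t<t′ minimal (suc u) eq with m≤n⇒m<n∨m≡n (subst (t <_) eq (last-> e t<t′))
      ... | inj₂ refl = eq
      ... | inj₁ 1+t<1+u = contradiction (s≤s⁻¹ 1+t<1+u , last-sound eq) (minimal u (last-below eq))

    module _ {s : ℕ} (io : InfinitelyOften (E s)) where
      private
        -- The orbit of the chain `s`: its events and the sequence following the first of them. It
        -- is closed under predecessors and has no initial point, since each event is the target of
        -- a link from the next one.
        data OnLine : ℕ → ℕ → Set where
          event : ∀ {t} → E s t → OnLine ⟪ suc s , t ⟫ 0
          first : ∀ {t m} → E s t → last s t ≡ 0 → OnLine ⟪ suc s , t ⟫ (suc m)

        Line : ℕ → Set
        Line e = ∃[ c ] ∃[ m ] (e ≡ ⟪ c , m ⟫ × OnLine c m)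

        link-source : ∀ {c c′ t} → Link c c′ → c′ ≡ ⟪ suc s , t ⟫ → OnLine c 0
        link-source (cycle _) eq = contradiction (⟪⟫-injectiveˡ eq) 0≢1+n
        link-source (chain {s′} e _) eq with suc-injective (⟪⟫-injectiveˡ eq)
        ... | refl = event e

        line-backward : ∀ {e c m} → OnLine c m → Predecessor e c m → Line e
        line-backward (event _)     (linked l)   = _ , _ , refl , link-source l refl
        line-backward (first e _)   (unlinked _) = _ , _ , refl , event e
        line-backward (first e eq)  beyond       = _ , _ , refl , first e eq

        line-predecessor : ∀ {c m} → OnLine c m → ¬ Initial model ⟪ c , m ⟫
        line-predecessor (event e) init = let t′ , e′ , eq = nextEvent io e in init _ (model-linked (chain e′ eq))
        line-predecessor (first {m = zero} e eq) init = init _ (model-unlinked (λ c′ l → absurd l refl))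
          where
          absurd : ∀ {c c′} → Link c c′ → c ≢ ⟪ suc s , _ ⟫
          absurd (cycle _) eq′ = contradiction (⟪⟫-injectiveˡ eq′) 0≢1+n
          absurd (chain _ l) eq′ with suc-injective (⟪⟫-injectiveˡ eq′) | ⟪⟫-injectiveʳ eq′
          ... | refl | refl = contradiction (trans (sym eq) l) 0≢1+n
        line-predecessor (first {m = suc m} e eq) init = init _ (model-beyond _ m)

        line-¬omega : ∀ {e} → Line e → ¬ Omega model e
        line-¬omega {e} line (y , init , n , eq) = initial n line eq
          where
          initial : ∀ n {e} → Line e → ¬ fold y model n ≡ e
          initial zero    (c , m , refl , on) refl = line-predecessor on init
          initial (suc n) (c , m , refl , on) eq   = initial n (line-backward on (predecessor eq)) refl

      event-ℤ : ∀ {t} → E s t → HasType model ⟪ ⟪ suc s , t ⟫ , 0 ⟫ 0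
      event-ℤ e = chain-infinite , line-¬omega (_ , _ , refl , event e)

    infinitelyManyℤ : (S : ℕ → ℕ) → (∀ m n → S m ≡ S n → m ≡ n) → (∀ n → InfinitelyOften (E (S n))) →
                      InfinitelyMany model 0
    infinitelyManyℤ S S-injective io = record
      { element  = λ n → ⟪ ⟪ suc (S n) , proj₁ (io n 0) ⟫ , 0 ⟫
      ; hasType  = λ n → event-ℤ (io n) (proj₂ (proj₂ (io n 0)))
      ; distinct = λ m n (a , b , eq) →
          let _ , _ , eq₁ = chain-fold _ 0 a
              _ , _ , eq₂ = chain-fold _ 0 b
          in  S-injective m n (suc-injective (⟪⟫-injectiveˡ (⟪⟫-injectiveˡ (trans (sym eq₁) (trans eq eq₂)))))
      }

    chainOf : ℕ → ℕ
    chainOf e = pred (fst (fst e))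

    ℤ-predecessor : ∀ {e} → HasType model e 0 → ∃[ y ] model y ≡ e
    ℤ-predecessor (_ , ¬ω) = M.non-omega-ancestor ¬ω 1

    ℤ-step : ∀ {c} → HasType model ⟪ c , 0 ⟫ 0 → ∃[ s ] ∃[ t ] ∃[ t′ ]
             (c ≡ ⟪ suc s , t ⟫ × E s t × t < t′ × HasType model ⟪ ⟪ suc s , t′ ⟫ , 0 ⟫ 0)
    ℤ-step {c} z = let y , eq = ℤ-predecessor z in
                   step (predecessor eq) (M.type-invariant 0 (0 , 1 , sym eq) z)
      where
      step : ∀ {y} → Predecessor y c 0 → HasType model y 0 → ∃[ s ] ∃[ t ] ∃[ t′ ]
             (c ≡ ⟪ suc s , t ⟫ × E s t × t < t′ × HasType model ⟪ ⟪ suc s , t′ ⟫ , 0 ⟫ 0)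
      step (linked (cycle p))          z′ = contradiction (proj₁ z′) (M.periodic⇒¬infinite (onCycle-periodic p))
      step (linked (chain {s} {t′} {t} e eq)) z′ = s , t , t′ , refl , last-sound eq , last-below eq , z′

    ℤ-descend : ∀ c m → HasType model ⟪ c , m ⟫ 0 → HasType model ⟪ c , 0 ⟫ 0 × ⟪ c , 0 ⟫ ∼[ model ] ⟪ c , m ⟫
    ℤ-descend c zero    z = z , M.∼-refl
    ℤ-descend c (suc m) z = let y , eq = ℤ-predecessor z in
      step (predecessor eq) (M.type-invariant 0 (0 , 1 , sym eq) z) (1 , 0 , eq)
      where
      step : ∀ {y} → Predecessor y c (suc m) → HasType model y 0 → y ∼[ model ] ⟪ c , suc m ⟫ →
             HasType model ⟪ c , 0 ⟫ 0 × ⟪ c , 0 ⟫ ∼[ model ] ⟪ c , suc m ⟫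
      step (unlinked _)      z′ r = z′ , r
      step (beyond {m = m′}) z′ r = let z₀ , r₀ = ℤ-descend c (suc m′) z′ in z₀ , M.∼-trans r₀ r

    private
      ℤ-event : ∀ {e} → HasType model e 0 → ∃[ s ] ∃[ t ]
                (E s t × chainOf e ≡ s × HasType model ⟪ ⟪ suc s , t ⟫ , 0 ⟫ 0 × ⟪ ⟪ suc s , t ⟫ , 0 ⟫ ∼[ model ] e)
      ℤ-event {e} z =
        let c = fst e
            m = snd e
            z₀ , r = ℤ-descend c m (subst (λ e → HasType model e 0) (sym (⟪fst,snd⟫ e)) z)
            s , t , _ , eq , ev , _ = ℤ-step z₀
        in  s , t , ev ,
            trans (cong (λ c → pred (fst c)) eq) (cong pred (fst-⟪⟫ (suc s) t)) ,
            subst (λ c → HasType model ⟪ c , 0 ⟫ 0) eq z₀ ,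
            subst₂ (λ c e → ⟪ c , 0 ⟫ ∼[ model ] e) eq (⟪fst,snd⟫ e) r

      first-event : ∀ s t → E s t →
        ∃[ u ] (E s u × last s u ≡ 0 × ⟪ ⟪ suc s , t ⟫ , 0 ⟫ ∼[ model ] ⟪ ⟪ suc s , u ⟫ , 0 ⟫)
      first-event s = <-rec _ λ t rec e → step t rec e (last s t) refl
        where
        Goal : ℕ → Set
        Goal t = ∃[ u ] (E s u × last s u ≡ 0 × ⟪ ⟪ suc s , t ⟫ , 0 ⟫ ∼[ model ] ⟪ ⟪ suc s , u ⟫ , 0 ⟫)
        step : ∀ t → (∀ {t′} → t′ < t → E s t′ → Goal t′) → E s t → ∀ l → last s t ≡ l → Goal t
        step t rec e zero     eq = t , e , eq , M.∼-refl
        step t rec e (suc t′) eq = let u , e′ , eq′ , r = rec (last-below eq) (last-sound eq) in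
          u , e′ , eq′ , M.∼-trans (1 , 0 , model-linked (chain e eq)) r

      first-event-unique : ∀ {s t u} → E s t → E s u → last s t ≡ 0 → last s u ≡ 0 → t ≡ u
      first-event-unique {s} {t} {u} e e′ eq eq′ with <-cmp t u
      ... | tri< t<u _ _ = contradiction e (last-zero eq′ t<u)
      ... | tri≈ _ t≡u _ = t≡u
      ... | tri> _ _ u<t = contradiction e′ (last-zero eq u<t)

    -- In a ℤ-orbit every event has a predecessor, which must be a later event of the same chain in
    -- an orbit of the same type; iterating this passes every bound.
    ℤ-chain : ∀ {e} → HasType model e 0 → InfinitelyOften (E (chainOf e))
    ℤ-chain {e} z n =
      let s , t , _ , s≡ , z′ , _ = ℤ-event z
          u , n≤u , ev , _ = later s z′ n
      in  u , n≤u , subst (λ s → E s u) (sym s≡) ev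
      where
      restep : ∀ {s t} → HasType model ⟪ ⟪ suc s , t ⟫ , 0 ⟫ 0 →
               ∃[ t′ ] (E s t × t < t′ × HasType model ⟪ ⟪ suc s , t′ ⟫ , 0 ⟫ 0)
      restep z with ℤ-step z
      ... | s′ , t , t′ , eq , ev , t<t′ , z′ with suc-injective (⟪⟫-injectiveˡ eq) | ⟪⟫-injectiveʳ eq
      ...   | refl | refl = t′ , ev , t<t′ , z′
      later : ∀ s {t} → HasType model ⟪ ⟪ suc s , t ⟫ , 0 ⟫ 0 → ∀ n →
              ∃[ u ] (n ≤ u × E s u × HasType model ⟪ ⟪ suc s , u ⟫ , 0 ⟫ 0)
      later s {t} z zero    = t , z≤n , proj₁ (proj₂ (restep z)) , z
      later s     z (suc n) =
        let u , n≤u , _ , zᵤ = later s z n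
            t , _ , u<t , zₜ = restep zᵤ
        in  t , ≤-trans (s≤s n≤u) u<t , proj₁ (proj₂ (restep zₜ)) , zₜ

    -- Both orbits pass through the first event of the common chain.
    ℤ-chain-injective : ∀ {e e′} → HasType model e 0 → HasType model e′ 0 → chainOf e ≡ chainOf e′ → e ∼[ model ] e′
    ℤ-chain-injective {e} {e′} z z′ eq = join (ℤ-event z) (ℤ-event z′)
      where
      Event : ℕ → Set
      Event e = ∃[ s ] ∃[ t ]
        (E s t × chainOf e ≡ s × HasType model ⟪ ⟪ suc s , t ⟫ , 0 ⟫ 0 × ⟪ ⟪ suc s , t ⟫ , 0 ⟫ ∼[ model ] e)
      join : Event e → Event e′ → e ∼[ model ] e′
      join (s , t , ev , s≡ , _ , r) (s′ , t′ , ev′ , s′≡ , _ , r′) with trans (sym s≡) (trans eq s′≡)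
      ... | refl with first-event s t ev | first-event s t′ ev′
      ...   | u , e₁ , l₁ , r₁ | u′ , e₂ , l₂ , r₂ with first-event-unique e₁ e₂ l₁ l₂
      ...     | refl = M.∼-trans (M.∼-sym r) (M.∼-trans r₁ (M.∼-trans (M.∼-sym r₂) r′))

    A≅model : InfinitelyMany A 0 → InfinitelyMany A 1 → InfinitelyMany model 0 → A ≅ model
    A≅model A-ℤ A-ω model-ℤ = classification A-injective model-injective
      (λ { 0 → infinitelyMany⇒embedding model-ℤ
         ; 1 → infinitelyMany⇒embedding infinitelyManyω
         ; (suc (suc k)) → A→model-cycles k })
      (λ { 0 → infinitelyMany⇒embedding A-ℤ
         ; 1 → infinitelyMany⇒embedding A-ω
         ; (suc (suc k)) → model→A-cycles k })

  -- Coding a Δ⁰₃ function into ℤ-orbits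

  -- Turns a Π₂ condition ∀ u. Q u, with P u t a stagewise approximation of Q u,
  -- into the condition that an event occurs infinitely often.
  module Events (P : ℕ → ℕ → Set) where
    -- The number of events so far. The next event waits for a stage at which all conditions up to
    -- this number are confirmed at once.
    progress : ℕ → ℕ
    progress = natrec 0 (λ t r → ite (∀ u → u < suc r → P u t) (suc r) r)

    Event : ℕ → Set
    Event t = ∀ u → u < suc (progress t) → P u t

    progress-event : ∀ {t} → Event t → progress (suc t) ≡ suc (progress t)
    progress-event e = ite-yes e

    progress-no-event : ∀ {t} → ¬ Event t → progress (suc t) ≡ progress t
    progress-no-event ¬e = ite-no ¬e

    progress-mono : ∀ {s t} → s ≤ t → progress s ≤ progress t
    progress-mono {s} {zero}  z≤n = ≤-refl
    progress-mono {s} {suc t} s≤t with m≤n⇒m<n∨m≡n s≤t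
    ... | inj₂ refl = ≤-refl
    ... | inj₁ s<t  = ≤-trans (progress-mono (s≤s⁻¹ s<t)) (step em)
      where
      step : Dec (Event t) → progress t ≤ progress (suc t)
      step (yes e) = ≤-trans (n≤1+n _) (≤-reflexive (sym (progress-event e)))
      step (no ¬e) = ≤-reflexive (sym (progress-no-event ¬e))

    progress-unbounded : InfinitelyOften Event → ∀ n → ∃[ t ] n ≤ progress t
    progress-unbounded io zero    = 0 , z≤n
    progress-unbounded io (suc n) =
      let s , n≤s = progress-unbounded io n
          t , s≤t , e = io s
      in  suc t , ≤-trans (s≤s (≤-trans n≤s (progress-mono s≤t))) (≤-reflexive (sym (progress-event e)))

    module _ {Q : ℕ → Set} where

      infinitelyOften⇒∀ : (∀ u t → P u t → Q u) → InfinitelyOften Event → ∀ u → Q u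
      infinitelyOften⇒∀ sound io u =
        let s , u≤s = progress-unbounded io u
            t , s≤t , e = io s
        in  sound u t (e u (s≤s (≤-trans u≤s (progress-mono s≤t))))

      -- Without events from stage `s` on, the progress would be constant; the finitely many
      -- conditions up to it are all confirmed at some later stage, which would be an event.
      ∀⇒infinitelyOften : (∀ u → Q u → Eventually (P u)) → (∀ u → Q u) → InfinitelyOften Event
      ∀⇒infinitelyOften complete q s = byContradiction λ ¬∃ →
        let stays : ∀ t → s ≤ t → progress t ≡ progress s
            stays = constant (λ t s≤t e → ¬∃ (t , s≤t , e))
            t , h = Eventually-∀< (suc (progress s)) (λ u _ → complete u (q u))
            s⊔t   = s ⊔ t
        in  ¬∃ (s⊔t , m≤m⊔n s t , λ u u< →
              h s⊔t (m≤n⊔m s t) u (subst (λ r → u < suc r) (stays s⊔t (m≤m⊔n s t)) u<))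
        where
        constant : (∀ t → s ≤ t → ¬ Event t) → ∀ t → s ≤ t → progress t ≡ progress s
        constant none zero    z≤n = refl
        constant none (suc t) s≤t with m≤n⇒m<n∨m≡n s≤t
        ... | inj₂ refl = refl
        ... | inj₁ s<t  = trans (progress-no-event (none t (s≤s⁻¹ s<t))) (constant none t (s≤s⁻¹ s<t))

  -- Guess n w k says that w is the least number whose events occur infinitely
  -- often and that k is the stage from which smaller numbers have no events.
  module Guesses (Ev : ℕ → ℕ → ℕ → Set) where
    Quiet : ℕ → ℕ → ℕ → Set
    Quiet n w t = ∀ w′ → w′ < w → ¬ Ev n w′ t

    Guess : ℕ → ℕ → ℕ → ℕ → Set
    Guess n w k t = Ev n w t × (∀ t′ → t′ < suc t → k ≤ t′ → Quiet n w t′) ×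
                    (k ≡ 0 ⊎ ∃[ w′ ] (w′ < w × Ev n w′ (pred k)))

    private
      quiet : ∀ {n w k} → InfinitelyOften (Guess n w k) → ∀ t → k ≤ t → Quiet n w t
      quiet io t k≤t = let u , t≤u , _ , q , _ = io t in q t (s≤s t≤u) k≤t

      guess-least : ∀ {n w k w′ k′} → InfinitelyOften (Guess n w k) → InfinitelyOften (Guess n w′ k′) → ¬ w < w′
      guess-least {k′ = k′} io io′ w<w′ = let t , k′≤t , ev , _ = io k′ in quiet io′ t k′≤t _ w<w′ ev

      guess-first : ∀ {n w k k′} → InfinitelyOften (Guess n w k) → InfinitelyOften (Guess n w k′) → ¬ k < k′
      guess-first {k′ = suc k′} io io′ k<k′ with proj₂ (proj₂ (proj₂ (proj₂ (io′ 0))))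
      ... | inj₂ (w′ , w′<w , ev) = quiet io k′ (s≤s⁻¹ k<k′) w′ w′<w ev

    -- A larger `w` would need the smaller one to fall quiet, but that one acts infinitely often.
    -- For equal `w`, the larger stage is justified by an event just before it, at a time that the
    -- smaller stage declares quiet.
    guess-unique : ∀ {n w k w′ k′} → InfinitelyOften (Guess n w k) → InfinitelyOften (Guess n w′ k′) →
                   w ≡ w′ × k ≡ k′
    guess-unique {n} {w} {k} {w′} {k′} io io′ with <-cmp w w′
    ... | tri< w<w′ _ _ = contradiction w<w′ (guess-least io io′)
    ... | tri> _ _ w′<w = contradiction w′<w (guess-least io′ io)
    ... | tri≈ _ refl _ with <-cmp k k′
    ...   | tri< k<k′ _ _ = contradiction k<k′ (guess-first io io′)
    ...   | tri≈ _ eq _   = refl , eq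
    ...   | tri> _ _ k′<k = contradiction k′<k (guess-first io′ io)

    -- Each of the finitely many smaller numbers acts only finitely often, so there is a least stage
    -- `k` of quiet; its minimality yields the event at `pred k`.
    guess-exists : ∀ n → ∃[ w ] InfinitelyOften (Ev n w) → ∃[ w ] ∃[ k ] InfinitelyOften (Guess n w k)
    guess-exists n ∃w =
      let w , io , minimal = least ∃w
          k , q , k-least  = least (Eventually-∀< w (λ w′ w′<w → ¬InfinitelyOften (minimal w′ w′<w)))
      in  w , k , λ s → let t , s≤t , ev = io s in t , s≤t , ev ,
            (λ t′ _ k≤t′ → q t′ k≤t′) , last-event k q k-least
      where
      last-event : ∀ {w} k → (∀ t → k ≤ t → Quiet n w t) →
                   (∀ j → j < k → ¬ (∀ t → j ≤ t → Quiet n w t)) →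
                   k ≡ 0 ⊎ ∃[ w′ ] (w′ < w × Ev n w′ (pred k))
      last-event zero    q k-least = inj₁ refl
      last-event (suc k) q k-least = inj₂ (byContradiction λ ¬∃ → k-least k ≤-refl λ t k≤t w′ w′<w ev →
        [ (λ k<t → q t k<t w′ w′<w ev) , (λ { refl → ¬∃ (w′ , w′<w , ev) }) ]′ (m≤n⇒m<n∨m≡n k≤t))

  entry : ℕ → ℕ → ℕ
  entry w i = fst (fold w snd i)

  encode : (ℕ → ℕ) → ℕ → ℕ
  encode g zero    = 0
  encode g (suc m) = ⟪ g 0 , encode (g ∘ suc) m ⟫

  entry-encode : ∀ g {m} i → i < m → entry (encode g m) i ≡ g i
  entry-encode g {suc m} zero    _ = fst-⟪⟫ (g 0) _
  entry-encode g {suc m} (suc i) (s≤s i<m) = trans (cong fst (sym (fold-suc snd _ i)))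
    (trans (cong (λ w → entry w i) (snd-⟪⟫ (g 0) _)) (entry-encode (g ∘ suc) i i<m))

  T-χ : ∀ b → T b → (if b then 1 else 0) ≡ 1
  T-χ true _ = refl

  χ-T : ∀ b → (if b then 1 else 0) ≡ 1 → T b
  χ-T true _ = tt

  -- The chain s = ⟪ n , ⟪ w , k ⟫ ⟫ guesses that, for each i ≤ n, the i-th entry
  -- of w is f i paired with a witness z of the Σ₃ definition of its graph.  All
  -- values up to n are stored because the right guesses can only be found up to
  -- a permutation.
  module Coding {f : ℕ → ℕ} (R : Vec ℕ 5 → Bool) (e : Rec [] 5)
    (e-converges : ∀ xs → Converges [] e xs (if R xs then 1 else 0))
    (graph : ∀ xs → Graph f xs ⇔ ∃-prefix 3 R xs) where

    private
      args : ℕ → ℕ → ℕ → ℕ → Vec ℕ 5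
      -- The outer witness, the two inner quantified variables, then the point of the graph.
      args w i u v = snd (entry w i) ∷ u ∷ v ∷ i ∷ fst (entry w i) ∷ []

    Q : ℕ → ℕ → ℕ → Set
    Q n w u = ∀ i → i < suc n → ∃[ v ] T (R (args w i u v))

    -- Here `2` is the code of the value `1`, that is, of truth of the matrix.
    P : ℕ → ℕ → ℕ → ℕ → Set
    P n w u t = ∀ i → i < suc n → ∃[ v ] (v < t × run e t (args w i u v) ≡ 2)

    module _ (n w : ℕ) where
      open Events (P n w) public using (progress; Event)

    open Guesses Event

    E : ℕ → ℕ → Set
    E s = Guess (fst s) (fst (snd s)) (snd (snd s))

    P-complete : ∀ n w u → Q n w u → Eventually (P n w u)
    P-complete n w u q = Eventually-∀< (suc n) λ i i<1+n →
      let v , r = q i i<1+n in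
      Eventually-map (λ t (v<t , eq) → v , v<t , trans eq (cong suc (T-χ _ r)))
        (Eventually-× {P = λ t → v < t} (suc v , λ _ v<t → v<t) (run-complete (e-converges (args w i u v))))

    P-sound : ∀ n w u t → P n w u t → Q n w u
    P-sound n w u t p i i<1+n =
      let v , _ , eq = p i i<1+n in
      v , [ (λ ≡0 → contradiction (trans (sym ≡0) eq) λ ()) ,
            (λ ≡ → χ-T _ (suc-injective (trans (sym ≡) eq))) ]′ (run-sound (e-converges (args w i u v)) t)

    -- Infinitely many events of `w` confirm the Π⁰₂ condition, so each entry up to `fst s` carries
    -- a genuine witness that its value is right.
    E⇒value : ∀ {s} → InfinitelyOften (E s) → ∀ x → x ≤ fst s → fst (entry (fst (snd s)) x) ≡ f x
    E⇒value {s} io x x≤n = sym (Equivalence.from (graph (x ∷ fst (entry w x) ∷ []))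
        (snd (entry w x) , λ u → Events.infinitelyOften⇒∀ (P (fst s) w) (P-sound (fst s) w)
           (λ t → let t′ , t≤t′ , ev , _ = io t in t′ , t≤t′ , ev) u x (s≤s x≤n)))
      where w = fst (snd s)

    E-exists : ∀ n → ∃[ w ] ∃[ k ] InfinitelyOften (E ⟪ n , ⟪ w , k ⟫ ⟫)
    E-exists n =
      let w , k , io = guess-exists n (encode witness (suc n) ,
                         Events.∀⇒infinitelyOften (P n _) (P-complete n _) Q-encode)
      in  w , k , λ t → let t′ , t≤t′ , g = io t in t′ , t≤t′ ,
            subst (λ (n , w , k) → Guess n w k t′) (cong₂ _,_ (sym (fst-⟪⟫ n _)) (sym (decode n w k))) g
      where
      decode : ∀ n w k → (fst (snd ⟪ n , ⟪ w , k ⟫ ⟫) , snd (snd ⟪ n , ⟪ w , k ⟫ ⟫)) ≡ (w , k)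
      decode n w k = cong₂ _,_ (trans (cong fst (snd-⟪⟫ n _)) (fst-⟪⟫ w k))
                                  (trans (cong snd (snd-⟪⟫ n _)) (snd-⟪⟫ w k))
      prefix : ∀ i → ∃-prefix 3 R (i ∷ f i ∷ [])
      prefix i = Equivalence.to (graph (i ∷ f i ∷ [])) refl
      witness : ℕ → ℕ
      witness i = ⟪ f i , proj₁ (prefix i) ⟫
      Q-encode : ∀ u → Q n (encode witness (suc n)) u
      Q-encode u i i<1+n = let v , r = proj₂ (prefix i) u in v ,
        subst₂ (λ z y → T (R (z ∷ u ∷ v ∷ i ∷ y ∷ [])))
          (sym (trans (cong snd (entry-encode witness i i<1+n)) (snd-⟪⟫ (f i) _)))
          (sym (trans (cong fst (entry-encode witness i i<1+n)) (fst-⟪⟫ (f i) _))) r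

    E-unique : ∀ {s s′} → InfinitelyOften (E s) → InfinitelyOften (E s′) → fst s ≡ fst s′ → s ≡ s′
    E-unique {s} {s′} io io′ n≡ =
      let w≡ , k≡ = guess-unique (subst (λ n → InfinitelyOften (Guess n (fst (snd s)) (snd (snd s)))) n≡ io) io′
      in  trans (sym (⟪fst,snd⟫ s)) (trans (cong₂ ⟪_,_⟫ n≡
            (trans (sym (⟪fst,snd⟫ (snd s))) (trans (cong₂ ⟪_,_⟫ w≡ k≡) (⟪fst,snd⟫ (snd s′))))) (⟪fst,snd⟫ s′))

    module _ where
      open PRClosed (isPR-closed [])
      open Pairing (isPR-closed [])

      entry-closed : ∀ {n} {F G : Vec ℕ n → ℕ} → IsPR [] F → IsPR [] G → IsPR [] (λ xs → entry (F xs) (G xs))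
      entry-closed f g = fst-closed (fold-closed {g = snd} (snd-closed var0) f g)

      P-decides : Decides {4} (λ v → P (head (tail (tail v))) (head (tail (tail (tail v)))) (head v) (head (tail v)))
      P-decides = ∀<-decides
        {P = λ i v → ∃[ x ] (x < head (tail v) ×
          run e (head (tail v)) (args (head (tail (tail (tail v)))) i (head v) x) ≡ 2)}
        (∃<-decides
          {P = λ x v → run e (head (tail (tail v)))
            (args (head (tail (tail (tail (tail v))))) (head v) (head (tail v)) x) ≡ 2}
          (≡-decides (comp-closed (run-PR e)
            (var3 ∷-closed snd-closed (entry-closed (weaken var4) var1) ∷-closed var2 ∷-closed var0 ∷-closed
             var1 ∷-closed fst-closed (entry-closed (weaken var4) var1) ∷-closed []-closed))
            (const-closed 2))
          var2)
        (suc-closed var2)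

      below-decides : Decides {4} (λ v → ∀ u → u < suc (head v) →
        P (head (tail (tail v))) (head (tail (tail (tail v)))) u (head (tail v)))
      below-decides = ∀<-decides
        {P = λ u v → P (head (tail (tail v))) (head (tail (tail (tail v)))) u (head (tail v))}
        (comp-closed P-decides (var0 ∷-closed var2 ∷-closed var3 ∷-closed var4 ∷-closed []-closed)) (suc-closed var0)

      progress-closed : IsPR [] {3} (λ v → progress (head v) (head (tail v)) (head (tail (tail v))))
      progress-closed = natrec-closed zero-closed
        (ite-closed
          (comp-closed below-decides (var1 ∷-closed var0 ∷-closed var2 ∷-closed var3 ∷-closed []-closed))
          (suc-closed var1) var1)
        var2

      event-decides : Decides₃ Event
      event-decides = comp-closed below-decides
        (progress-closed ∷-closed var2 ∷-closed var0 ∷-closed var1 ∷-closed []-closed)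

      E-decides : Decides₂ E
      E-decides = ×-decides (dec₃ Event event-decides (fst-closed var0) (fst-closed (snd-closed var0)) var1)
        (×-decides
          (∀<-decides {P = λ t v → snd (snd (head v)) ≤ t → Quiet (fst (head v)) (fst (snd (head v))) t}
            (→-decides (≤-decides (snd-closed (snd-closed var1)) var0)
              (∀<-decides {P = λ w v → ¬ Event (fst (head (tail v))) w (head v)}
                (¬-decides (dec₃ Event event-decides (fst-closed var2) var0 var1))
                (fst-closed (snd-closed var1))))
            (suc-closed var1))
          (⊎-decides (≡-decides (snd-closed (snd-closed var0)) (const-closed 0))
            (∃<-decides {P = λ w v → Event (fst (head v)) w (pred (snd (snd (head v))))}
              (dec₃ Event event-decides (fst-closed var1) var0 (pred-closed (snd-closed (snd-closed var1))))
              (fst-closed (snd-closed var0)))))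

  -- Bounded search and decoding of `f` from an isomorphism

  large-value : ∀ (g : ℕ → ℕ) → (∀ i j → g i ≡ g j → i ≡ j) → ∀ n → ∃[ i ] (i ≤ n × n ≤ g i)
  large-value g g-injective n = byContradiction λ ¬∃ →
    let small : ∀ i → i < suc n → g i < n
        small i i<1+n = ≰⇒> λ n≤g → ¬∃ (i , s≤s⁻¹ i<1+n , n≤g)
        i , j , i<j , eq = pigeonhole ≤-refl (λ (i : Fin (suc n)) → fromℕ< (small (toℕ i) (toℕ<n i)))
    in  <⇒≢ i<j (g-injective _ _ (trans (sym (toℕ-fromℕ< _)) (trans (cong toℕ eq) (toℕ-fromℕ< _))))

  -- By the pigeonhole principle a search up to `n` succeeds for injective `g`, so no unbounded
  -- search is involved.
  firstLarge : (ℕ → ℕ) → ℕ → ℕ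
  firstLarge g n = count (λ j → ∀ i → i < suc j → g i < n) n

  firstLarge-correct : ∀ g → (∀ i j → g i ≡ g j → i ≡ j) → ∀ n → n ≤ g (firstLarge g n)
  firstLarge-correct g g-injective n =
    let i , i≤n , n≤gi = large-value g g-injective n
        j , n≤gj , minimal = least {λ i → n ≤ g i} (i , n≤gi)
    in  subst (λ i → n ≤ g i) (sym (count-initial {λ j → ∀ i → i < suc j → g i < n} {j}
          (λ k<j i i≤k → ≰⇒> (minimal i (≤-trans i≤k k<j)))
          (λ {k} h → ≰⇒> λ j≤k → <⇒≱ (h j (s≤s j≤k)) n≤gj)
          (≤-trans (≮⇒≥ (λ i<j → minimal i i<j n≤gi)) i≤n))) n≤gj

  PRCatSpec⊆cone : ∀ A → Punctual A → InjectionStructure A → InfinitelyMany A 0 → InfinitelyMany A 1 →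
                   ∀ {d} → PRCatSpec A d → ConeΔ⁰ 3 d
  PRCatSpec⊆cone A A-punctual A-injective A-ℤ A-ω {d} spec f ((R , (e , e-converges) , graph) , _) =
    program f-PR , λ x → correct f-PR (x ∷ [])
    where
    open Coding {f} R e e-converges graph
    -- Every stage is an event, so every chain of this copy has type ℤ.
    module N = Model A A-injective (λ _ _ → ⊤)
    module B = Model A A-injective E

    -- Returning `t` itself makes the chosen event of each chain the stage `0`, so the elements of
    -- `N-ℤ` are the explicit points `start i`.
    always : ∀ (n : ℕ) → InfinitelyOften (λ _ → ⊤)
    always _ t = t , ≤-refl , tt

    N-ℤ : InfinitelyMany N.model 0
    N-ℤ = N.infinitelyManyℤ id (λ _ _ eq → eq) always

    chain : ℕ → ℕ
    chain n = let w , k , _ = E-exists n in ⟪ n , ⟪ w , k ⟫ ⟫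

    chain-injective : ∀ m n → chain m ≡ chain n → m ≡ n
    chain-injective _ _ = ⟪⟫-injectiveˡ

    B-ℤ : InfinitelyMany B.model 0
    B-ℤ = B.infinitelyManyℤ chain chain-injective (λ n → proj₂ (proj₂ (E-exists n)))

    punctual : ∀ {f} → PRClosed.Closed₁ (isPR-closed []) f → Punctual f
    punctual c = program c , λ x → correct c (x ∷ [])

    A-PR : PRClosed.Closed₁ (isPR-closed []) A
    A-PR = punctual⇒isPR [] A-punctual

    N-copy : Σ[ h ∈ A ≅ N.model ] (to h ≤PR d × from h ≤PR d)
    N-copy = spec N.model
      (punctual (N.model-closed (isPR-closed []) A-PR true-decides)) (N.A≅model A-ℤ A-ω N-ℤ)
      where
      open PRClosed (isPR-closed [])
      true-decides : Decides₂ (λ _ _ → ⊤)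
      true-decides = ext (λ _ → sym (ite-yes tt)) (const-closed 1)

    B-copy : Σ[ h ∈ A ≅ B.model ] (to h ≤PR d × from h ≤PR d)
    B-copy = spec B.model
      (punctual (B.model-closed (isPR-closed []) A-PR E-decides)) (B.A≅model A-ℤ A-ω B-ℤ)

    N≅B : N.model ≅ B.model
    N≅B = ≅-trans (≅-sym (proj₁ N-copy)) (proj₁ B-copy)

    start : ℕ → ℕ
    start i = ⟪ ⟪ suc i , 0 ⟫ , 0 ⟫

    image : ℕ → ℕ
    image i = to N≅B (start i)

    image-ℤ : ∀ i → HasType B.model (image i) 0
    image-ℤ i = type-preserves N≅B 0 {start i} (InfinitelyMany.hasType N-ℤ i)

    code : ℕ → ℕ
    code i = B.chainOf (image i)

    code-events : ∀ i → InfinitelyOften (E (code i))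
    code-events i = B.ℤ-chain (image-ℤ i)

    -- Equal lengths force equal guesses by `E-unique`, hence the same chain, hence the same
    -- ℤ-orbit, and the isomorphism reflects this to the first copy.
    length-injective : ∀ i j → fst (code i) ≡ fst (code j) → i ≡ j
    length-injective i j eq = InfinitelyMany.distinct N-ℤ i j (Transport.∼-reflects N≅B {start i} {start j}
      (B.ℤ-chain-injective (image-ℤ i) (image-ℤ j) (E-unique (code-events i) (code-events j) eq)))

    length : ℕ → ℕ
    length i = fst (code i)

    -- The chain found has length at least `x`, so its code `w` contains the value at `x`, which is
    -- read off as the first component of the `x`-th entry.
    f-PR : IsPR ⟨ d ⟩ {1} (λ v → f (head v))
    f-PR = ext (λ v → E⇒value (code-events (firstLarge length (head v))) (head v)
        (firstLarge-correct length length-injective (head v)))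
      (fst-closed (fst-closed (fold-closed {g = snd} (snd-closed var0)
        (fst-closed (snd-closed (app₁ code code-closed firstLarge-closed))) var0)))
      where
      open PRClosed (isPR-closed ⟨ d ⟩)
      open Pairing (isPR-closed ⟨ d ⟩)
      reducible : ∀ {g} → g ≤PR d → Closed₁ g
      reducible (Ψ , Ψ≡g) = isPR Ψ λ { (x ∷ []) → Ψ≡g x }
      code-closed : Closed₁ code
      code-closed = pred-closed (fst-closed (fst-closed
        (app₁ (to (proj₁ B-copy)) (reducible (proj₁ (proj₂ B-copy)))
          (app₁ (from (proj₁ N-copy)) (reducible (proj₂ (proj₂ N-copy)))
            (pair-closed (pair-closed (suc-closed var0) zero-closed) zero-closed)))))
      firstLarge-closed : Closed₁ (firstLarge length)
      firstLarge-closed = count-closed {P = λ j v → ∀ i → i < suc j → length i < head v}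
        (∀<-decides {P = λ i v → length i < head (tail v)}
          (<-decides (fst-closed (app₁ code code-closed var0)) var2) (suc-closed var0)) var0

theorem2p4 : ExcludedMiddle 0ℓ →
    (A : UnaryStructure) → Punctual A → InjectionStructure A →
    RelativelyΔ⁰-categorical 3 A → ¬ RelativelyΔ⁰-categorical 2 A →
    PRCatSpec A ≐ ConeΔ⁰ 3
theorem2p4 em A A-punctual A-injective Δ⁰₃-categorical ¬Δ⁰₂-categorical =
    (λ {d} → PRCatSpec⊆cone A A-punctual A-injective (many 0 (inj₁ refl)) (many 1 (inj₂ refl)) {d})
  , (λ {d} → cone⊆PRCatSpec A Δ⁰₃-categorical {d})
  where
  open Classical em
  many : ∀ τ → τ ≡ 0 ⊎ τ ≡ 1 → InfinitelyMany A τ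
  many = ¬Δ⁰₂-categorical⇒infinitelyMany A-punctual A-injective ¬Δ⁰₂-categorical
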